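{- Let $D(n)=n^{ -1}|D\cap\{1,\dots,n\}|$. For $n\ge1$ write $n=\frac{1}{\sqrt5}c\phi^p$ with $p$ an integer and $\frac1{\sqrt5}\le c<\frac1{\sqrt5}\phi$. Then \[ D(n)=\begin{cases} 1-\frac12 c-\frac{1}{10c}+O(n^{ -1/2}) & p\equiv 0 \pmod 4,\\ \frac{1}{2\phi}c+\frac{\phi}{10c}+O(n^{ -1/2}) & p\equiv 1\pmod 4,\\ \frac12 c+\frac{1}{10c}+O(n^{ -1/2}) & p\equiv 2\pmod 4,\\ 1-\frac{1}{2\phi}c-\frac{\phi}{10c}+O(n^{ -1/2}) & p\equiv 3\pmod 4. \end{cases} \]
   Context: $\phi=(1+\sqrt5)/2$. For positive integers $a_1,a_2$, the $(a_1,a_2)$-Fibonacci walk is $w_k=w_k(a_1,a_2)$ with $w_1=a_1$, $w_2=a_2$, $w_{k+2}=w_{k+1}+w_k$. Let $s(n;a_1,a_2)$ be the integer $s$ with $w_s(a_1,a_2)=n$ ($-\infty$ if none), and $s(n)=\max_{a_1,a_2\ge1}s(n;a_1,a_2)$. A pair $(a_1,a_2)$ is $n$-good if $a_1,a_2\ge1$ and $s(n;a_1,a_2)=s(n)$; its walk is then called an $n$-slow Fibonacci walk. An integer $n\ge2$ is a down-integer if $w_{s(n)+1}=\lfloor\phi n\rfloor$ for some $n$-slow Fibonacci walk $(w_k)$; $D$ is the set of down-integers. The implied constants in $O(\cdot)$ are absolute. -}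

module Defs where

open import Data.Nat as ℕ using (ℕ; zero; suc)
open import Data.Integer as ℤ using (ℤ; +_; -[1+_])
open import Data.Integer.DivMod using (_%ℕ_)
open import Data.Rational as ℚ using (ℚ; 0ℚ; 1ℚ; 1/_; ≢-nonZero)
open import Data.Rational.Properties using (_≟_)
open import Data.Product using (_×_; Σ; ∃; ∃-syntax; _,_)
open import Data.Sum using (_⊎_)
open import Data.Fin using (Fin; toℕ)
open import Data.Fin.Subset using (Subset; _∈_; ∣_∣)
open import Relation.Binary.PropositionalEquality using (_≡_)
open import Relation.Nullary using (yes; no)
open import Function.Bundles using (_⇔_)

-- walk a₁ a₂ k = w_k(a₁,a₂), with the paper's 1-based indexing
-- (index 0 is an auxiliary value never used: w₀ := a₂ ∸ a₁).
walk : ℕ → ℕ → ℕ → ℕ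
walk a₁ a₂ 0 = a₂ ℕ.∸ a₁
walk a₁ a₂ 1 = a₁
walk a₁ a₂ 2 = a₂
walk a₁ a₂ (suc (suc (suc k))) = walk a₁ a₂ (suc (suc k)) ℕ.+ walk a₁ a₂ (suc k)

Occurs : ℕ → ℕ → Set
Occurs n s = 1 ℕ.≤ s × ∃[ a₁ ] ∃[ a₂ ] (1 ℕ.≤ a₁ × 1 ℕ.≤ a₂ × walk a₁ a₂ s ≡ n)

IsSMax : ℕ → ℕ → Set
IsSMax n s = Occurs n s × (∀ k → Occurs n k → k ℕ.≤ s)

record Q5 : Set where
  constructor _+√5·_
  field
    re : ℚ
    ir : ℚ
open Q5 public

infixl 6 _⊕_ _⊖_
infixl 7 _⊛_

qℕ : ℕ → ℚ
qℕ n = (+ n) ℚ./ 1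

fromℚ : ℚ → Q5
fromℚ q = q +√5· 0ℚ

fromℕ : ℕ → Q5
fromℕ n = fromℚ (qℕ n)

_⊕_ : Q5 → Q5 → Q5
(a +√5· b) ⊕ (c +√5· d) = (a ℚ.+ c) +√5· (b ℚ.+ d)

⊝_ : Q5 → Q5
⊝ (a +√5· b) = (ℚ.- a) +√5· (ℚ.- b)

_⊖_ : Q5 → Q5 → Q5
x ⊖ y = x ⊕ (⊝ y)

_⊛_ : Q5 → Q5 → Q5
(a +√5· b) ⊛ (c +√5· d) =
  (a ℚ.* c ℚ.+ qℕ 5 ℚ.* (b ℚ.* d)) +√5· (a ℚ.* d ℚ.+ b ℚ.* c)

-- total inverse on ℚ (with 0⁻¹ = 0); only applied to nonzero arguments
invℚ : ℚ → ℚ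
invℚ q with q ≟ 0ℚ
... | yes _ = 0ℚ
... | no q≢0 = 1/_ q {{≢-nonZero q≢0}}

-- total inverse on ℚ(√5): (a + b√5)⁻¹ = (a - b√5)/(a² - 5b²), 0⁻¹ = 0
inv : Q5 → Q5
inv (a +√5· b) = (a ℚ.* N⁻¹) +√5· (ℚ.- (b ℚ.* N⁻¹))
  where N⁻¹ = invℚ (a ℚ.* a ℚ.- qℕ 5 ℚ.* (b ℚ.* b))

-- division (only applied to nonzero divisors)
_⊘_ : Q5 → Q5 → Q5
x ⊘ y = x ⊛ inv y

√5 : Q5
√5 = 0ℚ +√5· 1ℚ

φ : Q5
φ = (1ℚ ℚ.÷ qℕ 2) +√5· (1ℚ ℚ.÷ qℕ 2)

-- φ⁻¹ = φ - 1
φ⁻¹ : Q5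
φ⁻¹ = (ℚ.- (1ℚ ℚ.÷ qℕ 2)) +√5· (1ℚ ℚ.÷ qℕ 2)

powℕ : Q5 → ℕ → Q5
powℕ x zero = fromℚ 1ℚ
powℕ x (suc k) = x ⊛ powℕ x k

φ^ : ℤ → Q5
φ^ (+ k) = powℕ φ k
φ^ -[1+ k ] = powℕ φ⁻¹ (suc k)

-- order on ℚ(√5) (the order induced from ℝ, √5 > 0)
NonNeg : Q5 → Set
NonNeg (a +√5· b) =
    (0ℚ ℚ.≤ a × 0ℚ ℚ.≤ b)
  ⊎ (0ℚ ℚ.≤ a × b ℚ.< 0ℚ × qℕ 5 ℚ.* (b ℚ.* b) ℚ.≤ a ℚ.* a)
  ⊎ (a ℚ.< 0ℚ × 0ℚ ℚ.≤ b × a ℚ.* a ℚ.≤ qℕ 5 ℚ.* (b ℚ.* b))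

infix 4 _≤₅_ _<₅_

_≤₅_ : Q5 → Q5 → Set
x ≤₅ y = NonNeg (y ⊖ x)

_<₅_ : Q5 → Q5 → Set
x <₅ y = NonNeg (y ⊖ x) × (Q5.re x ≡ Q5.re y → Q5.ir x ≡ Q5.ir y → Data.Empty.⊥)
  where import Data.Empty

IsFloor : Q5 → ℕ → Set
IsFloor x m = fromℕ m ≤₅ x × x <₅ fromℕ (suc m)

Down : ℕ → Set
Down n = 2 ℕ.≤ n × ∃[ s ] ∃[ a₁ ] ∃[ a₂ ]
  ( IsSMax n s × 1 ℕ.≤ a₁ × 1 ℕ.≤ a₂ × walk a₁ a₂ s ≡ n
  × IsFloor (φ ⊛ fromℕ n) (walk a₁ a₂ (suc s)) )

-- S ⊆ Fin n represents D ∩ {1,…,n} (i ↦ i+1)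
RepresentsD : (n : ℕ) → Subset n → Set
RepresentsD n S = ∀ (i : Fin n) → (i ∈ S) ⇔ Down (suc (toℕ i))

half : Q5
half = fromℚ (1ℚ ℚ.÷ qℕ 2)

tenth : Q5
tenth = fromℚ (1ℚ ℚ.÷ qℕ 10)

one : Q5
one = fromℚ 1ℚ

mainTerm : ℕ → Q5 → Q5
mainTerm 0 c = one ⊖ half ⊛ c ⊖ tenth ⊘ c
mainTerm 1 c = (half ⊘ φ) ⊛ c ⊕ (φ ⊛ tenth) ⊘ c
mainTerm 2 c = half ⊛ c ⊕ tenth ⊘ c
mainTerm 3 c = one ⊖ (half ⊘ φ) ⊛ c ⊖ (φ ⊛ tenth) ⊘ c
mainTerm (suc (suc (suc (suc _)))) c = fromℚ 0ℚ   -- unreachable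

-- |x| ≤ C · n^{-1/2}  ⇔  x² · n ≤ C²   (for n ≥ 1)
BoundedBy : Q5 → ℕ → ℕ → Set
BoundedBy x C n = (x ⊛ x) ⊛ fromℕ n ≤₅ fromℕ (C ℕ.* C)

{-# OPTIONS --safe #-}

-- Writing e = s − 2, a walk with w_s = m is a representation m = a F_e + b F_{e+1} with a, b ≥ 1.
-- The longest one can be chosen with b ≤ a ≤ F_{e+1}, and conversely such a triple (e, a, b) is unique
-- for m and has s(m) = e + 2.  As x² + x y − y² changes sign along a walk, w_{s+1} then lies below φ m
-- exactly when e is odd, and a ≤ F_{e+1} keeps it within 1 of φ m; so m is a down-integer iff e is odd.
-- Hence #{m ≤ n : s(m) = e + 2} counts the lattice points (a, b) with 1 ≤ b ≤ a ≤ F_{e+1} and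
-- a F_e + b F_{e+1} ≤ n.
--
-- Let k = ⌈p/2⌉, so that F_{k-1} F_k ≤ n ≤ F_k F_{k+1}.  For e ≤ k − 2 all of the
-- F_{e+1} (F_{e+1} + 1) / 2 points count; for e ≥ k the bound a ≤ F_{e+1} is void and the points fill a
-- triangle of area n² / (2 F_e F_{e+2}).  Only e = k − 1 mixes the two constraints, so one counts the
-- parity class of k: the full cells add up to about F_{2k} / 10 and the triangle areas telescope to about
-- n² / (2 F_{2k}), with errors O(F_k) = O(√n).  For k odd this class is D, for k even its complement.

module Submission where

open import Defs
open import Algebra.Bundles using (CommutativeRing)
open import Algebra.Structures using (IsCommutativeRing)
open import Algebra.Solver.Ring.AlmostCommutativeRing using (fromCommutativeRing; _-Raw-AlmostCommutative⟶_)
import Algebra.Solver.Ring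
import Data.Rational.Solver
open import Data.Maybe using (map)
open import Data.Product using (Σ; _×_; _,_; proj₁; proj₂; ∃-syntax)
open import Data.Sum using (_⊎_; inj₁; inj₂)
open import Data.Empty using (⊥)
open import Function.Bundles using (Equivalence)
open import Level using (0ℓ)
open import Relation.Nullary using (¬_; yes; no; contradiction)
open import Relation.Nullary.Decidable using (dec⇒maybe)
open import Relation.Binary.PropositionalEquality

-- The order of ℚ(√5)

-- The four cases are really two. The range of `c` says φ^p ≤ 5 n ≤ φ^(p+1), so p = 2k - 1 and p =
-- 2k share the same k, and what the count needs, F_{k-1} F_k ≤ n ≤ F_k F_{k+1}, follows from
-- φ^(2k-1) ≤ 5 n ≤ φ^(2k+1). With F_{2k} ≈ φ^(2k) / √5 and c₀ = √5 n φ^(-2k), the count F_{2k} / 10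
-- + n² / (2 F_{2k}) divided by n becomes c₀ / 2 + 1 / (10 c₀). For p = 2k one has c = c₀; for p =
-- 2k - 1 one has c = φ c₀, which is the origin of the factors φ in the cases 1 and 3.
--
-- The errors stay O(F_k) because they are geometric on both sides of k: a full cell is off by about
-- F_{e+1} / 2, increasing with e, and a triangle by at most n / (2 F_e), decreasing with e.
--
-- Counts are compared in ℕ, without subtraction and multiplied by their denominators. The field
-- ℚ(√5) enters only for the floor of φ n and, through Binet's formulas, for the final comparison.

module _ where

  open import Data.Rational
  open import Data.Rational.Properties
  open Data.Rational.Solver.+-*-Solver

  ℚ-≤⇒≯ : ∀ {p q} → p ≤ q → ¬ q < p
  ℚ-≤⇒≯ p≤q q<p = <-irrefl refl (<-≤-trans q<p p≤q)

  *-nonNeg : ∀ {p q} → 0ℚ ≤ p → 0ℚ ≤ q → 0ℚ ≤ p * q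
  *-nonNeg {p} {q} 0≤p 0≤q = nonNegative⁻¹ (p * q)
    {{nonNeg*nonNeg⇒nonNeg p {{nonNegative 0≤p}} q {{nonNegative 0≤q}}}}

  +-nonNeg : ∀ {p q} → 0ℚ ≤ p → 0ℚ ≤ q → 0ℚ ≤ p + q
  +-nonNeg = +-mono-≤

  *-mono-≤-nonNeg : ∀ {p q r s} → 0ℚ ≤ p → 0ℚ ≤ r → p ≤ q → r ≤ s → p * r ≤ q * s
  *-mono-≤-nonNeg {p} {q} {r} {s} 0≤p 0≤r p≤q r≤s = ≤-trans
    (*-monoʳ-≤-nonNeg r {{nonNegative 0≤r}} p≤q)
    (*-monoˡ-≤-nonNeg q {{nonNegative (≤-trans 0≤p p≤q)}} r≤s)

  square-nonNeg : ∀ p → 0ℚ ≤ p * p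
  square-nonNeg p with ≤-total 0ℚ p
  ... | inj₁ 0≤p = *-nonNeg 0≤p 0≤p
  ... | inj₂ p≤0 = subst (0ℚ ≤_) (solve 1 (λ p → :- p :* :- p := p :* p) refl p)
                     (*-nonNeg (neg-antimono-≤ p≤0) (neg-antimono-≤ p≤0))

  square-mono-< : ∀ {p q} → 0ℚ ≤ p → p < q → p * p < q * q
  square-mono-< {p} {q} 0≤p p<q = ≤-<-trans
    (*-monoˡ-≤-nonNeg p {{nonNegative 0≤p}} (<⇒≤ p<q))
    (*-monoˡ-<-pos q {{positive (≤-<-trans 0≤p p<q)}} p<q)

  square-cancel-≤ : ∀ {p q} → 0ℚ ≤ q → p * p ≤ q * q → p ≤ q
  square-cancel-≤ {p} {q} 0≤q pp≤qq with p ≤? q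
  ... | yes p≤q = p≤q
  ... | no p≰q = contradiction (square-mono-< 0≤q (≰⇒> p≰q)) (ℚ-≤⇒≯ pp≤qq)

  -- The product of the two hypotheses compares the squares of the two sides of the conclusion. The
  -- weights `α`, `β` will be 1 and 5 in either order, so that one statement serves both kinds of
  -- dominance.
  cross-≤ : ∀ α β {a b c d} → 0ℚ ≤ α → 0ℚ ≤ β → 0ℚ ≤ a → 0ℚ ≤ c →
    α * (b * b) ≤ β * (a * a) → α * (d * d) ≤ β * (c * c) → α * (b * d) ≤ β * (a * c)
  cross-≤ α β {a} {b} {c} {d} 0≤α 0≤β 0≤a 0≤c b≤a d≤c =
    square-cancel-≤ (*-nonNeg 0≤β (*-nonNeg 0≤a 0≤c)) (subst₂ _≤_ (eq α b d) (eq β a c)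
      (*-mono-≤-nonNeg (*-nonNeg 0≤α (square-nonNeg b)) (*-nonNeg 0≤α (square-nonNeg d)) b≤a d≤c))
    where
      eq : ∀ α b d → (α * (b * b)) * (α * (d * d)) ≡ (α * (b * d)) * (α * (b * d))
      eq = solve 3 (λ α b d → (α :* (b :* b)) :* (α :* (d :* d)) := (α :* (b :* d)) :* (α :* (b :* d))) refl

  binomial : ∀ α b d → α * (b * b) + α * (d * d) + (α * (b * d) + α * (b * d)) ≡ α * ((b + d) * (b + d))
  binomial = solve 3 (λ α b d → α :* (b :* b) :+ α :* (d :* d) :+ (α :* (b :* d) :+ α :* (b :* d))
                        := α :* ((b :+ d) :* (b :+ d))) refl

  -- The pairs with a ≥ 0 and α b² ≤ β a² form a convex cone; in the expanded square the mixed term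
  -- is controlled by `cross-≤`.
  minkowski-≤ : ∀ α β {a b c d} → 0ℚ ≤ α → 0ℚ ≤ β → 0ℚ ≤ a → 0ℚ ≤ c →
    α * (b * b) ≤ β * (a * a) → α * (d * d) ≤ β * (c * c) →
    α * ((b + d) * (b + d)) ≤ β * ((a + c) * (a + c))
  minkowski-≤ α β {a} {b} {c} {d} 0≤α 0≤β 0≤a 0≤c b≤a d≤c =
    subst₂ _≤_ (binomial α b d) (binomial β a c) (+-mono-≤ (+-mono-≤ b≤a d≤c) (+-mono-≤ bd≤ac bd≤ac))
    where bd≤ac = cross-≤ α β {a} {b} {c} {d} 0≤α 0≤β 0≤a 0≤c b≤a d≤c

  minkowski-< : ∀ α β {a b c d} → 0ℚ ≤ α → 0ℚ ≤ β → 0ℚ ≤ a → 0ℚ ≤ c →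
    α * (b * b) ≤ β * (a * a) → α * (d * d) < β * (c * c) →
    α * ((b + d) * (b + d)) < β * ((a + c) * (a + c))
  minkowski-< α β {a} {b} {c} {d} 0≤α 0≤β 0≤a 0≤c b≤a d<c =
    subst₂ _<_ (binomial α b d) (binomial β a c) (+-mono-<-≤ (+-mono-≤-< b≤a d<c) (+-mono-≤ bd≤ac bd≤ac))
    where bd≤ac = cross-≤ α β {a} {b} {c} {d} 0≤α 0≤β 0≤a 0≤c b≤a (<⇒≤ d<c)

  5ℚ : ℚ
  5ℚ = qℕ 5

  0≤5 : 0ℚ ≤ 5ℚ
  0≤5 = nonNegative⁻¹ 5ℚ

  -- a + b√5 with a ≥ |b|√5, respectively b√5 ≥ |a|: together these exhaust the nonnegative elements.
  record RationalDominant (a b : ℚ) : Set where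
    constructor dominant
    field
      0≤a : 0ℚ ≤ a
      5b²≤a² : 5ℚ * (b * b) ≤ a * a

  record IrrationalDominant (a b : ℚ) : Set where
    constructor dominant
    field
      0≤b : 0ℚ ≤ b
      a²≤5b² : a * a ≤ 5ℚ * (b * b)

  split-NonNeg : ∀ {a b} → NonNeg (a +√5· b) → RationalDominant a b ⊎ IrrationalDominant a b
  split-NonNeg {a} {b} (inj₁ (0≤a , 0≤b)) with ≤-total (5ℚ * (b * b)) (a * a)
  ... | inj₁ b≤a = inj₁ (dominant 0≤a b≤a)
  ... | inj₂ a≤b = inj₂ (dominant 0≤b a≤b)
  split-NonNeg (inj₂ (inj₁ (0≤a , _ , b≤a))) = inj₁ (dominant 0≤a b≤a)
  split-NonNeg (inj₂ (inj₂ (_ , 0≤b , a≤b))) = inj₂ (dominant 0≤b a≤b)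

  rationalDominant⇒NonNeg : ∀ {a b} → RationalDominant a b → NonNeg (a +√5· b)
  rationalDominant⇒NonNeg {a} {b} (dominant 0≤a b≤a) with 0ℚ ≤? b
  ... | yes 0≤b = inj₁ (0≤a , 0≤b)
  ... | no 0≰b = inj₂ (inj₁ (0≤a , ≰⇒> 0≰b , b≤a))

  irrationalDominant⇒NonNeg : ∀ {a b} → IrrationalDominant a b → NonNeg (a +√5· b)
  irrationalDominant⇒NonNeg {a} {b} (dominant 0≤b a≤b) with 0ℚ ≤? a
  ... | yes 0≤a = inj₁ (0≤a , 0≤b)
  ... | no 0≰a = inj₂ (inj₂ (≰⇒> 0≰a , 0≤b , a≤b))

  -- The signs of the two coordinates of the sum decide which clause of `NonNeg` to prove. If its
  -- comparison of squares failed, the negated sum, after conjugation in one of the cases, would lie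
  -- strictly inside the cone of one summand; adding it to that summand by `minkowski-<` contradicts
  -- the dominance of the other.
  mixed-+ : ∀ {a b c d} → RationalDominant a b → IrrationalDominant c d → NonNeg ((a + c) +√5· (b + d))
  mixed-+ {a} {b} {c} {d} (dominant 0≤a b≤a) (dominant 0≤d c≤d) with 0ℚ ≤? a + c | 0ℚ ≤? b + d
  ... | yes 0≤A | yes 0≤B = inj₁ (0≤A , 0≤B)
  ... | yes 0≤A | no 0≰B with 5ℚ * ((b + d) * (b + d)) ≤? (a + c) * (a + c)
  ...   | yes B≤A = inj₂ (inj₁ (0≤A , ≰⇒> 0≰B , B≤A))
  ...   | no B≰A = contradiction
          (subst₂ _<_ (solve 2 (λ a c → con 1ℚ :* ((c :+ (:- (a :+ c))) :* (c :+ (:- (a :+ c)))) := a :* a) refl a c)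
            (solve 3 (λ f b d → f :* ((d :+ (:- (b :+ d))) :* (d :+ (:- (b :+ d)))) := f :* (b :* b)) refl 5ℚ b d)
            (minkowski-< 1ℚ 5ℚ {d} {c} { - (b + d)} { - (a + c)} (nonNegative⁻¹ 1ℚ) 0≤5 0≤d (neg-antimono-≤ (<⇒≤ (≰⇒> 0≰B)))
              (subst (_≤ 5ℚ * (d * d)) (sym (*-identityˡ (c * c))) c≤d)
              (subst₂ _<_ (solve 2 (λ a c → (a :+ c) :* (a :+ c) := con 1ℚ :* (:- (a :+ c) :* :- (a :+ c))) refl a c)
                (solve 3 (λ f b d → f :* ((b :+ d) :* (b :+ d)) := f :* (:- (b :+ d) :* :- (b :+ d))) refl 5ℚ b d) (≰⇒> B≰A))))
          (ℚ-≤⇒≯ b≤a)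
  mixed-+ {a} {b} {c} {d} (dominant 0≤a b≤a) (dominant 0≤d c≤d) | no 0≰A | yes 0≤B with (a + c) * (a + c) ≤? 5ℚ * ((b + d) * (b + d))
  ...   | yes A≤B = inj₂ (inj₂ (≰⇒> 0≰A , 0≤B , A≤B))
  ...   | no A≰B = contradiction
          (subst₂ _<_ (solve 3 (λ f b d → f :* (((:- b) :+ (b :+ d)) :* ((:- b) :+ (b :+ d))) := f :* (d :* d)) refl 5ℚ b d)
            (solve 2 (λ a c → con 1ℚ :* ((a :+ (:- (a :+ c))) :* (a :+ (:- (a :+ c)))) := c :* c) refl a c)
            (minkowski-< 5ℚ 1ℚ {a} { - b} { - (a + c)} {b + d} 0≤5 (nonNegative⁻¹ 1ℚ) 0≤a (neg-antimono-≤ (<⇒≤ (≰⇒> 0≰A)))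
              (subst₂ _≤_ (solve 2 (λ f b → f :* (b :* b) := f :* (:- b :* :- b)) refl 5ℚ b) (sym (*-identityˡ (a * a))) b≤a)
              (subst (5ℚ * ((b + d) * (b + d)) <_) (solve 2 (λ a c → (a :+ c) :* (a :+ c) := con 1ℚ :* (:- (a :+ c) :* :- (a :+ c))) refl a c) (≰⇒> A≰B))))
          (ℚ-≤⇒≯ c≤d)
  -- Two negative coordinates would give a² < c² ≤ 5 d² ≤ 5 b² ≤ a².
  mixed-+ {a} {b} {c} {d} (dominant 0≤a b≤a) (dominant 0≤d c≤d) | no 0≰A | no 0≰B = contradiction
    (<-≤-trans aa<cc (≤-trans c≤d (≤-trans (*-monoˡ-≤-nonNeg 5ℚ (<⇒≤ dd<bb)) b≤a))) (<-irrefl refl)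
    where
      below : ∀ {x y} → x + y < 0ℚ → x < - y
      below {x} {y} x+y<0 = subst₂ _<_ (solve 2 (λ x y → x :+ y :+ (:- y) := x) refl x y) (+-identityˡ (- y)) (+-monoˡ-< (- y) x+y<0)
      neg² : ∀ x → - x * - x ≡ x * x
      neg² = solve 1 (λ x → :- x :* :- x := x :* x) refl
      aa<cc : a * a < c * c
      aa<cc = subst (a * a <_) (neg² c) (square-mono-< 0≤a (below (≰⇒> 0≰A)))
      dd<bb : d * d < b * b
      dd<bb = subst (d * d <_) (neg² b) (square-mono-< 0≤d (below (subst (_< 0ℚ) (+-comm b d) (≰⇒> 0≰B))))

  -- NonNeg computes on every argument, as Q5 has η; the wrapper keeps its argument visible to unification.
  record Nonneg (x : Q5) : Set where
    constructor nonneg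
    field
      isNonNeg : NonNeg x

  open Nonneg public

  Nonneg-⊕ : ∀ {x y} → Nonneg x → Nonneg y → Nonneg (x ⊕ y)
  Nonneg-⊕ {a +√5· b} {c +√5· d} (nonneg nx) (nonneg ny) with split-NonNeg nx | split-NonNeg ny
  ... | inj₁ (dominant 0≤a b≤a) | inj₁ (dominant 0≤c d≤c) = nonneg (rationalDominant⇒NonNeg (dominant (+-nonNeg 0≤a 0≤c)
    (subst (5ℚ * ((b + d) * (b + d)) ≤_) (*-identityˡ _)
      (minkowski-≤ 5ℚ 1ℚ {a} {b} {c} {d} 0≤5 (nonNegative⁻¹ 1ℚ) 0≤a 0≤c
        (subst (_ ≤_) (sym (*-identityˡ (a * a))) b≤a) (subst (_ ≤_) (sym (*-identityˡ (c * c))) d≤c)))))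
  ... | inj₁ x | inj₂ y = nonneg (mixed-+ x y)
  ... | inj₂ x | inj₁ y = nonneg (subst₂ (λ u v → NonNeg (u +√5· v)) (+-comm c a) (+-comm d b) (mixed-+ y x))
  ... | inj₂ (dominant 0≤b a≤b) | inj₂ (dominant 0≤d c≤d) = nonneg (irrationalDominant⇒NonNeg (dominant (+-nonNeg 0≤b 0≤d)
    (subst (_≤ 5ℚ * ((b + d) * (b + d))) (*-identityˡ _)
      (minkowski-≤ 1ℚ 5ℚ {b} {a} {d} {c} (nonNegative⁻¹ 1ℚ) 0≤5 0≤b 0≤d
        (subst (_≤ _) (sym (*-identityˡ (a * a))) a≤b) (subst (_≤ _) (sym (*-identityˡ (c * c))) c≤d)))))

  -- Multiplication by √5 exchanges the two kinds of dominance.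
  irrational⇒rational : ∀ {a b} → IrrationalDominant a b → RationalDominant (5ℚ * b) a
  irrational⇒rational {a} {b} (dominant 0≤b a≤b) = dominant (*-nonNeg 0≤5 0≤b)
    (subst (5ℚ * (a * a) ≤_) (solve 2 (λ f b → f :* (f :* (b :* b)) := (f :* b) :* (f :* b)) refl 5ℚ b)
      (*-monoˡ-≤-nonNeg 5ℚ a≤b))

  5*-cancel-nonNeg : ∀ {p} → 0ℚ ≤ 5ℚ * p → 0ℚ ≤ p
  5*-cancel-nonNeg {p} 0≤5p = *-cancelˡ-≤-pos 5ℚ (subst (_≤ 5ℚ * p) (sym (*-zeroʳ 5ℚ)) 0≤5p)

  rational⇒irrational : ∀ {a b} → RationalDominant (5ℚ * b) a → IrrationalDominant a b
  rational⇒irrational {a} {b} (dominant 0≤5b a≤b) = dominant (5*-cancel-nonNeg 0≤5b)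
    (*-cancelˡ-≤-pos 5ℚ (subst (5ℚ * (a * a) ≤_)
      (solve 2 (λ f b → (f :* b) :* (f :* b) := f :* (f :* (b :* b))) refl 5ℚ b) a≤b))

  -- The norm a² - 5 b² is multiplicative, so the product of two elements of nonnegative norm has
  -- nonnegative norm; `cross-≤`, applied to -b and d, gives the sign of the rational part.
  rational-⊛ : ∀ {a b c d} → RationalDominant a b → RationalDominant c d →
    RationalDominant (a * c + 5ℚ * (b * d)) (a * d + b * c)
  rational-⊛ {a} {b} {c} {d} (dominant 0≤a b≤a) (dominant 0≤c d≤c) = dominant 0≤re norm
    where
      -5bd≤ac : 5ℚ * (- b * d) ≤ 1ℚ * (a * c)
      -5bd≤ac = cross-≤ 5ℚ 1ℚ {a} { - b} {c} {d} 0≤5 (nonNegative⁻¹ 1ℚ) 0≤a 0≤c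
        (subst₂ _≤_ (solve 2 (λ f b → f :* (b :* b) := f :* (:- b :* :- b)) refl 5ℚ b) (sym (*-identityˡ (a * a))) b≤a)
        (subst (_ ≤_) (sym (*-identityˡ (c * c))) d≤c)
      0≤re : 0ℚ ≤ a * c + 5ℚ * (b * d)
      0≤re = subst₂ _≤_ (solve 3 (λ f b d → f :* (:- b :* d) :+ f :* (b :* d) := con 0ℚ) refl 5ℚ b d)
        (cong (_+ 5ℚ * (b * d)) (*-identityˡ (a * c))) (+-monoˡ-≤ (5ℚ * (b * d)) -5bd≤ac)
      diff : ∀ {p q} → p ≤ q → 0ℚ ≤ q + - p
      diff {p} {q} p≤q = subst (_≤ q + - p) (+-inverseʳ p) (+-monoˡ-≤ (- p) p≤q)
      norm : 5ℚ * ((a * d + b * c) * (a * d + b * c)) ≤ (a * c + 5ℚ * (b * d)) * (a * c + 5ℚ * (b * d))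
      norm = subst₂ _≤_ (+-identityˡ _)
        (solve 5 (λ f a b c d → (a :* a :+ :- (f :* (b :* b))) :* (c :* c :+ :- (f :* (d :* d)))
            :+ f :* ((a :* d :+ b :* c) :* (a :* d :+ b :* c))
            := (a :* c :+ f :* (b :* d)) :* (a :* c :+ f :* (b :* d))) refl 5ℚ a b c d)
        (+-monoˡ-≤ (5ℚ * ((a * d + b * c) * (a * d + b * c))) (*-nonNeg (diff b≤a) (diff d≤c)))

  mixed-⊛ : ∀ {a b c d} → RationalDominant a b → IrrationalDominant c d →
    IrrationalDominant (a * c + 5ℚ * (b * d)) (a * d + b * c)
  mixed-⊛ {a} {b} {c} {d} x y = rational⇒irrational (subst₂ RationalDominant
    (solve 5 (λ f a b c d → a :* (f :* d) :+ f :* (b :* c) := f :* (a :* d :+ b :* c)) refl 5ℚ a b c d)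
    (solve 5 (λ f a b c d → a :* c :+ b :* (f :* d) := a :* c :+ f :* (b :* d)) refl 5ℚ a b c d)
    (rational-⊛ x (irrational⇒rational y)))

  -- When both factors are turned by √5, their product comes out multiplied by 5; this removes that
  -- factor.
  rational-cancel-5 : ∀ {a b} → RationalDominant (5ℚ * a) (5ℚ * b) → RationalDominant a b
  rational-cancel-5 {a} {b} (dominant 0≤5a b≤a) = dominant (5*-cancel-nonNeg 0≤5a)
    (*-cancelˡ-≤-pos 5ℚ (*-cancelˡ-≤-pos 5ℚ (subst₂ _≤_
      (solve 2 (λ f b → f :* ((f :* b) :* (f :* b)) := f :* (f :* (f :* (b :* b)))) refl 5ℚ b)
      (solve 2 (λ f a → (f :* a) :* (f :* a) := f :* (f :* (a :* a))) refl 5ℚ a) b≤a)))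

  irrational-⊛ : ∀ {a b c d} → IrrationalDominant a b → IrrationalDominant c d →
    RationalDominant (a * c + 5ℚ * (b * d)) (a * d + b * c)
  irrational-⊛ {a} {b} {c} {d} x y = rational-cancel-5 (subst₂ RationalDominant
    (solve 5 (λ f a b c d → (f :* b) :* (f :* d) :+ f :* (a :* c) := f :* (a :* c :+ f :* (b :* d))) refl 5ℚ a b c d)
    (solve 5 (λ f a b c d → (f :* b) :* c :+ a :* (f :* d) := f :* (a :* d :+ b :* c)) refl 5ℚ a b c d)
    (rational-⊛ (irrational⇒rational x) (irrational⇒rational y)))

  Nonneg-⊛ : ∀ {x y} → Nonneg x → Nonneg y → Nonneg (x ⊛ y)
  Nonneg-⊛ {a +√5· b} {c +√5· d} (nonneg nx) (nonneg ny) with split-NonNeg nx | split-NonNeg ny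
  ... | inj₁ x | inj₁ y = nonneg (rationalDominant⇒NonNeg (rational-⊛ x y))
  ... | inj₁ x | inj₂ y = nonneg (irrationalDominant⇒NonNeg (mixed-⊛ x y))
  ... | inj₂ x | inj₁ y = nonneg (irrationalDominant⇒NonNeg (subst₂ IrrationalDominant
    (solve 5 (λ f a b c d → c :* a :+ f :* (d :* b) := a :* c :+ f :* (b :* d)) refl 5ℚ a b c d)
    (solve 4 (λ a b c d → c :* b :+ d :* a := a :* d :+ b :* c) refl a b c d) (mixed-⊛ y x)))
  ... | inj₂ x | inj₂ y = nonneg (rationalDominant⇒NonNeg (irrational-⊛ x y))

open import Data.Nat
open import Data.Nat.Properties
open import Data.Nat.Divisibility using (_∣_; ∣⇒≤; ∣1⇒≡1; ∣m+n∣m⇒∣n; n∣m*n)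
open import Data.Nat.DivMod using (m%n<n; m≡m%n+[m/n]*n; [m+kn]%n≡m%n)
open import Data.Nat.Coprimality as Coprimality using (Coprime; coprime-divisor)
open import Data.Nat.Tactic.RingSolver using (solve-∀)
open import Data.Integer as ℤ using (ℤ)
open import Data.Integer.DivMod using (_%ℕ_)
import Data.Integer.Properties as ℤₚ
open import Data.Rational as ℚ using (ℚ; 0ℚ; 1ℚ; ½; mkℚ)
import Data.Rational.Properties as ℚₚ
open import Data.Fin using (toℕ; zero; suc)
open import Data.Fin.Properties using (toℕ<n)
open import Data.Fin.Subset using (Subset; ∣_∣; inside; outside; _∈_)
open import Data.Vec using ([]; _∷_; here; there)

-- Fibonacci and Lucas identities

fib : ℕ → ℕ
fib 0 = 0
fib 1 = 1
fib (suc (suc n)) = fib (suc n) + fib n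

lucas : ℕ → ℕ
lucas 0 = 2
lucas 1 = 1
lucas (suc (suc n)) = lucas (suc n) + lucas n

double : ℕ → ℕ
double zero = zero
double (suc n) = suc (suc (double n))

data Parity : ℕ → Set where
  even : ∀ i → Parity (double i)
  odd  : ∀ i → Parity (suc (double i))

parityView : ∀ n → Parity n
parityView zero = even 0
parityView (suc n) with parityView n
... | even i = odd i
... | odd i = even (suc i)

Fibonacci : (ℕ → ℕ) → Set
Fibonacci g = ∀ n → g (suc (suc n)) ≡ g (suc n) + g n

mutual
  -- This and `lucas-*-odd` are L_k g_k = g_{2k} + (-1)^k g_0, split by parity to avoid the sign.
  -- The sequence g is arbitrary because expanding L_{k+2} = L_{k+1} + L_k leads to the same
  -- identity for shifts of g, of both parities.
  lucas-*-even : ∀ i g → Fibonacci g →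
    lucas (double i) * g (double i) ≡ g (double (double i)) + g 0
  lucas-*-even zero g rec = cong (g 0 +_) (+-identityʳ (g 0))
  lucas-*-even (suc i) g rec = +-cancelʳ-≡ _ _ _ (begin
    (lucas (suc k) + lucas k) * g (suc (suc k)) + g 1
      ≡⟨ distr (lucas (suc k)) (lucas k) (g (suc (suc k))) (g 1) ⟩
    (lucas (suc k) * g (suc (suc k)) + g 1) + lucas k * g (suc (suc k))
      ≡⟨ cong₂ _+_ (lucas-*-odd i (λ n → g (suc n)) (λ n → rec (suc n))) (lucas-*-even i (λ n → g (2 + n)) (λ n → rec (2 + n))) ⟩
    g (3 + double k) + (g (2 + double k) + g 2)
      ≡⟨ sym (+-assoc (g (3 + double k)) _ _) ⟩
    g (3 + double k) + g (2 + double k) + g 2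
      ≡⟨ cong₂ _+_ (sym (rec (2 + double k))) (trans (rec 0) (+-comm (g 1) (g 0))) ⟩
    g (4 + double k) + (g 0 + g 1)
      ≡⟨ sym (+-assoc (g (4 + double k)) _ _) ⟩
    g (4 + double k) + g 0 + g 1 ∎)
    where
      open ≡-Reasoning
      k = double i
      distr : ∀ a b c d → (a + b) * c + d ≡ (a * c + d) + b * c
      distr = solve-∀

  lucas-*-odd : ∀ i g → Fibonacci g →
    lucas (suc (double i)) * g (suc (double i)) + g 0 ≡ g (double (suc (double i)))
  lucas-*-odd zero g rec = trans (cong (_+ g 0) (*-identityˡ (g 1))) (sym (rec 0))
  lucas-*-odd (suc i) g rec = +-cancelʳ-≡ _ _ _ (begin
    (lucas (suc k) + lucas k) * g (suc (suc k)) + g 0 + g 1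
      ≡⟨ distr (lucas (suc k)) (lucas k) (g (suc (suc k))) (g 0) (g 1) ⟩
    lucas (suc k) * g (suc (suc k)) + (lucas k * g (suc (suc k)) + (g 1 + g 0))
      ≡⟨ cong (λ x → lucas (suc k) * g (suc (suc k)) + (lucas k * g (suc (suc k)) + x)) (sym (rec 0)) ⟩
    lucas (suc k) * g (suc (suc k)) + (lucas k * g (suc (suc k)) + g 2)
      ≡⟨ cong₂ _+_ (lucas-*-even (suc i) (λ n → g (suc n)) (λ n → rec (suc n))) (lucas-*-odd i (λ n → g (2 + n)) (λ n → rec (2 + n))) ⟩
    g (3 + double k) + g 1 + g (2 + double k)
      ≡⟨ swap (g (3 + double k)) (g 1) (g (2 + double k)) ⟩
    g (3 + double k) + g (2 + double k) + g 1
      ≡⟨ cong (_+ g 1) (sym (rec (2 + double k))) ⟩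
    g (4 + double k) + g 1 ∎)
    where
      open ≡-Reasoning
      k = suc (double i)
      distr : ∀ a b c d e → (a + b) * c + d + e ≡ a * c + (b * c + (e + d))
      distr = solve-∀
      swap : ∀ a b c → a + b + c ≡ a + c + b
      swap = solve-∀

mutual
  -- The companion identity F_{k+1} (g_{k+2} + g_k) = g_{2k+2} + (-1)^k g_0. For g = `lucas` the
  -- second factor is 5 F_{k+1}, which produces the estimates for 5 F_{k+1}² and 5 F_k F_{k+1}.
  fib-*-even : ∀ i g → Fibonacci g →
    fib (suc (double i)) * (g (2 + double i) + g (double i)) ≡ g (double (suc (double i))) + g 0
  fib-*-even zero g rec = *-identityˡ (g 2 + g 0)
  fib-*-even (suc i) g rec = +-cancelʳ-≡ _ _ _ (begin
    (fib (suc k) + fib k) * (g (3 + k) + g (suc k)) + g 1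
      ≡⟨ distr (fib (suc k)) (fib k) (g (3 + k) + g (suc k)) (g 1) ⟩
    (fib (suc k) * (g (3 + k) + g (suc k)) + g 1) + fib k * (g (3 + k) + g (suc k))
      ≡⟨ cong₂ _+_ (fib-*-odd i (λ n → g (suc n)) (λ n → rec (suc n))) (fib-*-even i (λ n → g (2 + n)) (λ n → rec (2 + n))) ⟩
    g (3 + double k) + (g (2 + double k) + g 2)
      ≡⟨ sym (+-assoc (g (3 + double k)) _ _) ⟩
    g (3 + double k) + g (2 + double k) + g 2
      ≡⟨ cong₂ _+_ (sym (rec (2 + double k))) (trans (rec 0) (+-comm (g 1) (g 0))) ⟩
    g (4 + double k) + (g 0 + g 1)
      ≡⟨ sym (+-assoc (g (4 + double k)) _ _) ⟩
    g (4 + double k) + g 0 + g 1 ∎)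
    where
      open ≡-Reasoning
      k = suc (double i)
      distr : ∀ a b c d → (a + b) * c + d ≡ (a * c + d) + b * c
      distr = solve-∀

  fib-*-odd : ∀ i g → Fibonacci g →
    fib (2 + double i) * (g (3 + double i) + g (suc (double i))) + g 0 ≡ g (double (2 + double i))
  fib-*-odd zero g rec = begin
    1 * (g 3 + g 1) + g 0       ≡⟨ lem (g 3) (g 1) (g 0) ⟩
    g 3 + (g 1 + g 0)           ≡⟨ cong (g 3 +_) (sym (rec 0)) ⟩
    g 3 + g 2                   ≡⟨ sym (rec 2) ⟩
    g 4 ∎
    where
      open ≡-Reasoning
      lem : ∀ a b c → 1 * (a + b) + c ≡ a + (b + c)
      lem = solve-∀
  fib-*-odd (suc i) g rec = +-cancelʳ-≡ _ _ _ (begin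
    (fib (suc k) + fib k) * (g (3 + k) + g (suc k)) + g 0 + g 1
      ≡⟨ distr (fib (suc k)) (fib k) (g (3 + k) + g (suc k)) (g 0) (g 1) ⟩
    fib (suc k) * (g (3 + k) + g (suc k)) + (fib k * (g (3 + k) + g (suc k)) + (g 1 + g 0))
      ≡⟨ cong (λ x → fib (suc k) * (g (3 + k) + g (suc k)) + (fib k * (g (3 + k) + g (suc k)) + x)) (sym (rec 0)) ⟩
    fib (suc k) * (g (3 + k) + g (suc k)) + (fib k * (g (3 + k) + g (suc k)) + g 2)
      ≡⟨ cong₂ _+_ (fib-*-even (suc i) (λ n → g (suc n)) (λ n → rec (suc n))) (fib-*-odd i (λ n → g (2 + n)) (λ n → rec (2 + n))) ⟩
    g (3 + double k) + g 1 + g (2 + double k)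
      ≡⟨ swap (g (3 + double k)) (g 1) (g (2 + double k)) ⟩
    g (3 + double k) + g (2 + double k) + g 1
      ≡⟨ cong (_+ g 1) (sym (rec (2 + double k))) ⟩
    g (4 + double k) + g 1 ∎)
    where
      open ≡-Reasoning
      k = 2 + double i
      distr : ∀ a b c d e → (a + b) * c + d + e ≡ a * c + (b * c + (e + d))
      distr = solve-∀
      swap : ∀ a b c → a + b + c ≡ a + c + b
      swap = solve-∀

infix 4 _≈[_]_
_≈[_]_ : ℕ → ℕ → ℕ → Set
x ≈[ d ] y = x ≤ y + d × y ≤ x + d

≡+⇒≈ : ∀ {x y d} → x ≡ y + d → x ≈[ d ] y
≡+⇒≈ {y = y} {d} refl = ≤-refl , ≤-trans (m≤m+n y d) (m≤m+n (y + d) d)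

+≡⇒≈ : ∀ {x y d} → x + d ≡ y → x ≈[ d ] y
+≡⇒≈ {x} {d = d} refl = ≤-trans (m≤m+n x d) (m≤m+n (x + d) d) , ≤-refl

lucas-*-≈ : ∀ k g → Fibonacci g → lucas k * g k ≈[ g 0 ] g (double k)
lucas-*-≈ k g rec with parityView k
... | even i = ≡+⇒≈ (lucas-*-even i g rec)
... | odd i = +≡⇒≈ (lucas-*-odd i g rec)

fib-*-≈ : ∀ k g → Fibonacci g → fib (suc k) * (g (2 + k) + g k) ≈[ g 0 ] g (double (suc k))
fib-*-≈ k g rec with parityView k
... | even i = ≡+⇒≈ (fib-*-even i g rec)
... | odd i = +≡⇒≈ (fib-*-odd i g rec)

lucas+lucas : ∀ k → lucas (2 + k) + lucas k ≡ 5 * fib (suc k)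
lucas+lucas 0 = refl
lucas+lucas 1 = refl
lucas+lucas (suc (suc k)) = begin
  lucas (3 + k) + lucas (2 + k) + (lucas (suc k) + lucas k)
    ≡⟨ lem (lucas (3 + k)) (lucas (2 + k)) (lucas (suc k)) (lucas k) ⟩
  (lucas (3 + k) + lucas (suc k)) + (lucas (2 + k) + lucas k)
    ≡⟨ cong₂ _+_ (lucas+lucas (suc k)) (lucas+lucas k) ⟩
  5 * fib (2 + k) + 5 * fib (suc k)
    ≡⟨ sym (*-distribˡ-+ 5 (fib (2 + k)) (fib (suc k))) ⟩
  5 * (fib (2 + k) + fib (suc k)) ∎
  where
    open ≡-Reasoning
    lem : ∀ a b c d → a + b + (c + d) ≡ (a + c) + (b + d)
    lem = solve-∀

-- Together with `5fib²≈lucas` this makes the squares telescope along a parity class: 5 F_{e+1}² is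
-- about L_{2e+2} = F_{2e+4} - F_{2e}.
fib+lucas : ∀ k → fib (4 + k) ≡ fib k + lucas (2 + k)
fib+lucas 0 = refl
fib+lucas 1 = refl
fib+lucas (suc (suc k)) = begin
  fib (5 + k) + fib (4 + k)
    ≡⟨ cong₂ _+_ (fib+lucas (suc k)) (fib+lucas k) ⟩
  (fib (suc k) + lucas (3 + k)) + (fib k + lucas (2 + k))
    ≡⟨ lem (fib (suc k)) (lucas (3 + k)) (fib k) (lucas (2 + k)) ⟩
  fib (suc k) + fib k + (lucas (3 + k) + lucas (2 + k)) ∎
  where
    open ≡-Reasoning
    lem : ∀ a b c d → (a + b) + (c + d) ≡ a + c + (b + d)
    lem = solve-∀

5fib²≈lucas : ∀ k → fib (suc k) * (5 * fib (suc k)) ≈[ 2 ] lucas (double (suc k))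
5fib²≈lucas k = subst (λ x → fib (suc k) * x ≈[ 2 ] lucas (double (suc k)))
  (lucas+lucas k) (fib-*-≈ k lucas (λ _ → refl))

-- Connects the thresholds F_k F_{k+1} for n with φ^(2k+1) / 5, as L_{2k+1} is within 1 of φ^(2k+1).
5fibfib≈lucas : ∀ k → fib k * (5 * fib (suc k)) ≈[ 1 ] lucas (suc (double k))
5fibfib≈lucas zero = z≤n , ≤-refl
5fibfib≈lucas (suc k) = subst (λ x → fib (suc k) * x ≈[ 1 ] lucas (suc (double (suc k))))
  (lucas+lucas (suc k)) (fib-*-≈ k (λ n → lucas (suc n)) (λ _ → refl))

lucas*fib≈fib : ∀ k q → lucas k * fib (k + q) ≈[ fib q ] fib (double k + q)
lucas*fib≈fib k q = lucas-*-≈ k (λ n → fib (n + q)) (λ _ → refl)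

lucas*fib≡fib : ∀ k → lucas k * fib k ≡ fib (double k)
lucas*fib≡fib k with lucas-*-≈ k fib (λ _ → refl)
... | p , q = ≤-antisym (subst (lucas k * fib k ≤_) (+-identityʳ (fib (double k))) p)
                      (subst (fib (double k) ≤_) (+-identityʳ (lucas k * fib k)) q)

fib-suc-+ : ∀ m n → fib (suc m + n) ≡ fib (suc m) * fib (suc n) + fib m * fib n
fib-suc-+ 0 n = sym (trans (+-identityʳ _) (*-identityˡ (fib (suc n))))
fib-suc-+ 1 n = cong₂ _+_ (sym (*-identityˡ (fib (suc n)))) (sym (*-identityˡ (fib n)))
fib-suc-+ (suc (suc m)) n = begin
  fib (2 + m + n) + fib (suc m + n)
    ≡⟨ cong₂ _+_ (fib-suc-+ (suc m) n) (fib-suc-+ m n) ⟩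
  (fib (2 + m) * fib (suc n) + fib (suc m) * fib n) + (fib (suc m) * fib (suc n) + fib m * fib n)
    ≡⟨ lem (fib (2 + m)) (fib (suc m)) (fib m) (fib (suc n)) (fib n) ⟩
  (fib (2 + m) + fib (suc m)) * fib (suc n) + (fib (suc m) + fib m) * fib n ∎
  where
    open ≡-Reasoning
    lem : ∀ a b c x y → (a * x + b * y) + (b * x + c * y) ≡ (a + b) * x + (b + c) * y
    lem = solve-∀

-- One telescoping step. With T = k + j + 2 it reads 1 / (F_k F_{k+2}) = F_{j+2} / (F_k F_T) - F_j /
-- (F_{k+2} F_T).
fib-product : ∀ k j → fib (2 + k + j) + fib k * fib j ≡ fib (2 + k) * fib (2 + j)
fib-product k j = begin
  fib (2 + k + j) + fib k * fib j
    ≡⟨ cong (_+ fib k * fib j) (fib-suc-+ (suc k) j) ⟩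
  (fib (suc k) + fib k) * fib (suc j) + fib (suc k) * fib j + fib k * fib j
    ≡⟨ lem (fib (suc k)) (fib k) (fib (suc j)) (fib j) ⟩
  (fib (suc k) + fib k) * (fib (suc j) + fib j) ∎
  where
    open ≡-Reasoning
    lem : ∀ a b x y → (a + b) * x + a * y + b * y ≡ (a + b) * (x + y)
    lem = solve-∀

fib-pos : ∀ k → 1 ≤ fib (suc k)
fib-pos zero = ≤-refl
fib-pos (suc k) = ≤-trans (fib-pos k) (m≤m+n _ _)

fib≤fib-suc : ∀ k → fib k ≤ fib (suc k)
fib≤fib-suc zero = z≤n
fib≤fib-suc (suc k) = m≤m+n _ _

fib-mono : ∀ {i j} → i ≤ j → fib i ≤ fib j
fib-mono {i} i≤j = go (≤⇒≤′ i≤j)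
  where
    go : ∀ {j} → i ≤′ j → fib i ≤ fib j
    go ≤′-refl = ≤-refl
    go (≤′-step {j} p) = ≤-trans (go p) (fib≤fib-suc j)

2fib≤fib : ∀ k → 2 * fib k ≤ fib (2 + k)
2fib≤fib k = begin
  fib k + (fib k + 0)  ≡⟨ cong (fib k +_) (+-identityʳ (fib k)) ⟩
  fib k + fib k        ≤⟨ +-monoˡ-≤ (fib k) (fib≤fib-suc k) ⟩
  fib (suc k) + fib k  ∎
  where open ≤-Reasoning

fib-suc≤2fib : ∀ {k} → 1 ≤ k → fib (suc k) ≤ 2 * fib k
fib-suc≤2fib {suc j} _ = subst (fib (suc j) + fib j ≤_) (cong (fib (suc j) +_) (sym (+-identityʳ _)))
  (+-monoʳ-≤ (fib (suc j)) (fib≤fib-suc j))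

k≤fib-suc : ∀ k → k ≤ fib (suc k)
k≤fib-suc 0 = z≤n
k≤fib-suc 1 = ≤-refl
k≤fib-suc (suc (suc k)) = begin
  suc (suc k)                   ≡⟨ +-comm 1 (suc k) ⟩
  suc k + 1                     ≤⟨ +-mono-≤ (k≤fib-suc (suc k)) (fib-pos k) ⟩
  fib (2 + k) + fib (suc k)     ∎
  where open ≤-Reasoning

lucas-pos : ∀ k → 1 ≤ lucas k
lucas-pos 0 = s≤s z≤n
lucas-pos 1 = ≤-refl
lucas-pos (suc (suc k)) = ≤-trans (lucas-pos (suc k)) (m≤m+n _ _)

-- Counting the values of a cell

sum< : ℕ → (ℕ → ℕ) → ℕ
sum< zero f = 0
sum< (suc n) f = f 0 + sum< n (λ i → f (suc i))

sum<-cong : ∀ n {f g : ℕ → ℕ} → (∀ i → i < n → f i ≡ g i) → sum< n f ≡ sum< n g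
sum<-cong zero eq = refl
sum<-cong (suc n) eq = cong₂ _+_ (eq 0 z<s) (sum<-cong n (λ i i<n → eq (suc i) (s<s i<n)))

sum<-0 : ∀ n {f : ℕ → ℕ} → (∀ i → i < n → f i ≡ 0) → sum< n f ≡ 0
sum<-0 zero eq = refl
sum<-0 (suc n) eq = cong₂ _+_ (eq 0 z<s) (sum<-0 n (λ i i<n → eq (suc i) (s<s i<n)))

sum<-1 : ∀ n {f : ℕ → ℕ} → (∀ i → i < n → f i ≡ 1) → sum< n f ≡ n
sum<-1 zero eq = refl
sum<-1 (suc n) eq = cong₂ _+_ (eq 0 z<s) (sum<-1 n (λ i i<n → eq (suc i) (s<s i<n)))

sum<-+ : ∀ n (f g : ℕ → ℕ) → sum< n (λ i → f i + g i) ≡ sum< n f + sum< n g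
sum<-+ zero f g = refl
sum<-+ (suc n) f g = begin
  f 0 + g 0 + sum< n (λ i → f (suc i) + g (suc i))
    ≡⟨ cong (f 0 + g 0 +_) (sum<-+ n (λ i → f (suc i)) (λ i → g (suc i))) ⟩
  f 0 + g 0 + (sum< n (λ i → f (suc i)) + sum< n (λ i → g (suc i)))
    ≡⟨ lem (f 0) (g 0) _ _ ⟩
  f 0 + sum< n (λ i → f (suc i)) + (g 0 + sum< n (λ i → g (suc i))) ∎
  where
    open ≡-Reasoning
    lem : ∀ a b c d → a + b + (c + d) ≡ a + c + (b + d)
    lem = solve-∀

sum<-swap : ∀ m n (f : ℕ → ℕ → ℕ) →
  sum< m (λ i → sum< n (λ j → f i j)) ≡ sum< n (λ j → sum< m (λ i → f i j))
sum<-swap zero n f = sym (sum<-0 n (λ _ _ → refl))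
sum<-swap (suc m) n f = begin
  sum< n (f 0) + sum< m (λ i → sum< n (f (suc i)))
    ≡⟨ cong (sum< n (f 0) +_) (sum<-swap m n (λ i → f (suc i))) ⟩
  sum< n (f 0) + sum< n (λ j → sum< m (λ i → f (suc i) j))
    ≡⟨ sym (sum<-+ n (f 0) (λ j → sum< m (λ i → f (suc i) j))) ⟩
  sum< n (λ j → f 0 j + sum< m (λ i → f (suc i) j)) ∎
  where open ≡-Reasoning

sum<-single : ∀ {n i} (f : ℕ → ℕ) → i < n → (∀ j → j < n → j ≢ i → f j ≡ 0) → sum< n f ≡ f i
sum<-single {suc n} {zero} f _ eq =
  trans (cong (f 0 +_) (sum<-0 n (λ j j<n → eq (suc j) (s<s j<n) λ ()))) (+-identityʳ (f 0))
sum<-single {suc n} {suc i} f (s≤s i<n) eq = cong₂ _+_ (eq 0 z<s λ ())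
  (sum<-single (λ j → f (suc j)) i<n (λ j j<n j≢i → eq (suc j) (s<s j<n) (λ { refl → j≢i refl })))

δ : ℕ → ℕ → ℕ
δ zero zero = 1
δ zero (suc n) = 0
δ (suc m) zero = 0
δ (suc m) (suc n) = δ m n

δ-refl : ∀ n → δ n n ≡ 1
δ-refl zero = refl
δ-refl (suc n) = δ-refl n

δ-≢ : ∀ {m n} → m ≢ n → δ m n ≡ 0
δ-≢ {zero} {zero} m≢n = contradiction refl m≢n
δ-≢ {zero} {suc n} m≢n = refl
δ-≢ {suc m} {zero} m≢n = refl
δ-≢ {suc m} {suc n} m≢n = δ-≢ (λ eq → m≢n (cong suc eq))

-- The indicator of 1 ≤ x ≤ n, written as a sum over the possible values so that counting lattice
-- points can be exchanged with counting the integers they represent.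
hit : ℕ → ℕ → ℕ
hit x n = sum< n (λ m → δ x (suc m))

sum<-δ-< : ∀ {x n} → x < n → sum< n (δ x) ≡ 1
sum<-δ-< {zero} {suc n} _ = cong suc (sum<-0 n (λ _ _ → refl))
sum<-δ-< {suc x} {suc n} (s≤s x<n) = sum<-δ-< x<n

sum<-δ-≥ : ∀ {x n} → n ≤ x → sum< n (δ x) ≡ 0
sum<-δ-≥ {x} {zero} _ = refl
sum<-δ-≥ {suc x} {suc n} (s≤s n≤x) = sum<-δ-≥ n≤x

hit-≤ : ∀ {x n} → 1 ≤ x → x ≤ n → hit x n ≡ 1
hit-≤ {suc x} _ x<n = sum<-δ-< x<n

hit-> : ∀ {x n} → n < x → hit x n ≡ 0
hit-> {suc x} (s≤s n≤x) = sum<-δ-≥ n≤x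

hit-shift : ∀ q {x n} → 1 ≤ x → hit (q + x) (q + n) ≡ hit x n
hit-shift q {x} {n} 1≤x with x ≤? n
... | yes x≤n = trans (hit-≤ (≤-trans 1≤x (m≤n+m x q)) (+-monoʳ-≤ q x≤n)) (sym (hit-≤ 1≤x x≤n))
... | no x≰n = trans (hit-> (+-monoʳ-< q (≰⇒> x≰n))) (sym (hit-> (≰⇒> x≰n)))

+-left-comm : ∀ a b c → a + (b + c) ≡ b + (a + c)
+-left-comm = solve-∀

-- The sum of w over t p + b q with t ≥ 0, b ≥ 1, t + b ≤ N (the index below is b − 1).
triangle : ℕ → ℕ → ℕ → (ℕ → ℕ) → ℕ
triangle p q N w = sum< N (λ b → sum< (N ∸ b) (λ t → w (t * p + suc b * q)))

column : ℕ → ℕ → ℕ → ℕ → ℕ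
column M p x n = sum< M (λ t → hit (t * p + x) (x + n))

-- As n < M p, the range t < M is not exhausted, and the column has ⌊n / p⌋ + 1 hits.
column-bounds : ∀ M p x n → 1 ≤ x → n < M * p →
  n < column M p x n * p × column M p x n * p ≤ n + p
column-bounds (suc M) p x n 1≤x n<Mp with p ≤? n
... | no p≰n rewrite hit-≤ {x} {x + n} 1≤x (m≤m+n x n)
                   | sum<-0 M {λ t → hit (p + t * p + x) (x + n)}
                       (λ t _ → hit-> (subst (_< p + t * p + x) (+-comm n x)
                         (+-monoˡ-< x (≤-trans (≰⇒> p≰n) (m≤m+n p (t * p))))))
                   | +-identityʳ p = ≰⇒> p≰n , m≤n+m p n
... | yes p≤n with m≤n⇒∃[o]m+o≡n p≤n
...   | n′ , refl
      rewrite hit-≤ {x} {x + (p + n′)} 1≤x (m≤m+n x (p + n′))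
            | sum<-cong M {λ t → hit (p + t * p + x) (x + (p + n′))} {λ t → hit (t * p + x) (x + n′)}
                (λ t _ → trans (cong₂ hit (+-assoc p (t * p) x) (+-left-comm x p n′))
                               (hit-shift p (≤-trans 1≤x (m≤n+m x (t * p)))))
  = let lo , hi = column-bounds M p x n′ 1≤x (+-cancelˡ-< p n′ (M * p) n<Mp)
    in +-monoʳ-< p lo , subst (p + column M p x n′ * p ≤_) (sym (+-assoc p n′ p)) (+-monoʳ-≤ p hi)

-- As p ≤ q, a point with t p + b q ≤ n satisfies (t + b) p ≤ n ≤ N p, so the bound t + b ≤ N never
-- cuts. The induction peels off the column b = 1 and continues with n′ = n - q. Scaled by 2 p q,
-- this column contributes between 2 q n′ and 2 q n′ + 2 q², while n² - n′² = 2 q n′ + q²; thus each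
-- column adds at most q² to the error, in total at most n q.
triangle-hit : ∀ N p q n → 1 ≤ p → p ≤ q → n ≤ N * p →
  2 * (p * q * triangle p q N (λ x → hit x n)) ≈[ n * q ] n * n
triangle-hit zero p q .zero 1≤p p≤q z≤n rewrite *-zeroʳ (p * q) = z≤n , z≤n
triangle-hit (suc N) p q n 1≤p p≤q n≤Np with q ≤? n
... | no q≰n rewrite sum<-0 (suc N) {λ b → sum< (suc N ∸ b) (λ t → hit (t * p + suc b * q) n)}
                       (λ b _ → sum<-0 (suc N ∸ b) (λ t _ → hit->
                          (≤-trans (≰⇒> q≰n) (≤-trans (m≤m+n q (b * q)) (m≤n+m (suc b * q) (t * p))))))
                   | *-zeroʳ (p * q) = z≤n , *-monoʳ-≤ n (<⇒≤ (≰⇒> q≰n))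
... | yes q≤n with m≤n⇒∃[o]m+o≡n q≤n
...   | n′ , refl = subst (λ C → 2 * (p * q * C) ≈[ n * q ] n * n) (sym split) (upper , lower)
  where
    1≤q : 1 ≤ q
    1≤q = ≤-trans 1≤p p≤q
    c = column (suc N) p q n′
    C′ = triangle p q N (λ x → hit x n′)
    split : triangle p q (suc N) (λ x → hit x (q + n′)) ≡ c + C′
    split = cong₂ _+_
      (sum<-cong (suc N) (λ t _ → cong (λ z → hit (t * p + z) (q + n′)) (+-identityʳ q)))
      (sum<-cong N (λ b _ → sum<-cong (N ∸ b) (λ t _ →
        trans (cong (λ z → hit z (q + n′)) (+-left-comm (t * p) q (suc b * q)))
              (hit-shift q (≤-trans 1≤q (≤-trans (m≤m+n q (b * q)) (m≤n+m (suc b * q) (t * p))))))))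
    col = column-bounds (suc N) p q n′ 1≤q (≤-trans (+-monoˡ-≤ n′ 1≤q) n≤Np)
    IH = triangle-hit N p q n′ 1≤p p≤q
      (+-cancelˡ-≤ p n′ (N * p) (≤-trans (+-monoˡ-≤ n′ p≤q) n≤Np))
    expand : 2 * (p * q * (c + C′)) ≡ 2 * (q * (c * p)) + 2 * (p * q * C′)
    expand = lem p q c C′
      where
        lem : ∀ p q c d → 2 * (p * q * (c + d)) ≡ 2 * (q * (c * p)) + 2 * (p * q * d)
        lem = solve-∀
    open ≤-Reasoning
    upper : 2 * (p * q * (c + C′)) ≤ (q + n′) * (q + n′) + (q + n′) * q
    upper = begin
      2 * (p * q * (c + C′))
        ≡⟨ expand ⟩
      2 * (q * (c * p)) + 2 * (p * q * C′)
        ≤⟨ +-mono-≤ (*-monoʳ-≤ 2 (*-monoʳ-≤ q (≤-trans (proj₂ col) (+-monoʳ-≤ n′ p≤q)))) (proj₁ IH) ⟩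
      2 * (q * (n′ + q)) + (n′ * n′ + n′ * q)
        ≡⟨ lem q n′ ⟩
      (q + n′) * (q + n′) + (q + n′) * q ∎
      where
        lem : ∀ q n → 2 * (q * (n + q)) + (n * n + n * q) ≡ (q + n) * (q + n) + (q + n) * q
        lem = solve-∀
    lower : (q + n′) * (q + n′) ≤ 2 * (p * q * (c + C′)) + (q + n′) * q
    lower = begin
      (q + n′) * (q + n′)
        ≡⟨ lem q n′ ⟩
      2 * (q * n′) + n′ * n′ + q * q
        ≤⟨ +-monoˡ-≤ (q * q) (+-mono-≤ (*-monoʳ-≤ 2 (*-monoʳ-≤ q (<⇒≤ (proj₁ col)))) (proj₂ IH)) ⟩
      2 * (q * (c * p)) + (2 * (p * q * C′) + n′ * q) + q * q
        ≡⟨ lem′ (2 * (q * (c * p))) (2 * (p * q * C′)) n′ q ⟩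
      2 * (q * (c * p)) + 2 * (p * q * C′) + (q + n′) * q
        ≡⟨ cong (_+ (q + n′) * q) (sym expand) ⟩
      2 * (p * q * (c + C′)) + (q + n′) * q ∎
      where
        lem : ∀ q n → (q + n) * (q + n) ≡ 2 * (q * n) + n * n + q * q
        lem = solve-∀
        lem′ : ∀ a b n q → a + (b + n * q) + q * q ≡ a + b + (q + n) * q
        lem′ = solve-∀

<∸⇒+suc≤ : ∀ {t} N b → t < N ∸ b → t + suc b ≤ N
<∸⇒+suc≤ {t} N b t<N∸b = subst (_≤ N) (sym (+-suc t b)) (m≤o∸n⇒m+n≤o (suc t)
  (<⇒≤ (m∸n≢0⇒n<m (m<n⇒n≢0 t<N∸b))) t<N∸b)

triangle-full : ∀ N p q {w : ℕ → ℕ} →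
  (∀ b t → t + suc b ≤ N → w (t * p + suc b * q) ≡ 1) → 2 * triangle p q N w ≡ N * suc N
triangle-full N p q {w} w≡1 = trans (cong (2 *_)
  (sum<-cong N (λ b _ → sum<-1 (N ∸ b) (λ t t<N∸b → w≡1 b t (<∸⇒+suc≤ N b t<N∸b))))) (sum-∸ N)
  where
    sum-∸ : ∀ N → 2 * sum< N (λ b → N ∸ b) ≡ N * suc N
    sum-∸ zero = refl
    sum-∸ (suc N) = begin
      2 * (suc N + sum< N (λ b → N ∸ b))     ≡⟨ *-distribˡ-+ 2 (suc N) _ ⟩
      2 * suc N + 2 * sum< N (λ b → N ∸ b)   ≡⟨ cong (2 * suc N +_) (sum-∸ N) ⟩
      2 * suc N + N * suc N                  ≡⟨ sym (*-distribʳ-+ (suc N) 2 N) ⟩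
      (2 + N) * suc N                        ≡⟨ *-comm (2 + N) (suc N) ⟩
      suc N * (2 + N)                        ∎
      where open ≡-Reasoning

-- The points (a, b) with 1 ≤ b ≤ a ≤ F_{e+1}, weighted by w (a F_e + b F_{e+1}), in the coordinate t = a − b.
cell : ℕ → (ℕ → ℕ) → ℕ
cell e = triangle (fib e) (fib (2 + e)) (fib (suc e))

-- The largest value in the cell is F_{e+1} F_{e+2}, attained at t = 0, b = F_{e+1}.
cell-full : ∀ e n → fib (suc e) * fib (2 + e) ≤ n →
  2 * cell e (λ x → hit x n) ≡ fib (suc e) * suc (fib (suc e))
cell-full e n le = triangle-full (fib (suc e)) (fib e) (fib (2 + e)) {λ x → hit x n} (λ b t t+b≤N → hit-≤
  (≤-trans (fib-pos (suc e)) (≤-trans (m≤m+n (fib (2 + e)) (b * fib (2 + e))) (m≤n+m _ (t * fib e))))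
  (begin
    t * fib e + suc b * fib (2 + e)
      ≤⟨ +-monoˡ-≤ _ (*-monoʳ-≤ t (m≤n+m (fib e) (fib (suc e)))) ⟩
    t * fib (2 + e) + suc b * fib (2 + e)
      ≡⟨ sym (*-distribʳ-+ (fib (2 + e)) t (suc b)) ⟩
    (t + suc b) * fib (2 + e)
      ≤⟨ *-monoˡ-≤ (fib (2 + e)) t+b≤N ⟩
    fib (suc e) * fib (2 + e)
      ≤⟨ le ⟩
    n ∎))
  where open ≤-Reasoning

-- Here N p = F_{e+1} F_e, so n ≤ N p is exactly the hypothesis. For e = 0 the step p = F_0 vanishes
-- and the triangle degenerates.
cell-triangle : ∀ e n → 1 ≤ e → n ≤ fib e * fib (suc e) →
  2 * (fib e * fib (2 + e) * cell e (λ x → hit x n)) ≈[ n * fib (2 + e) ] n * n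
cell-triangle (suc e) n _ le = triangle-hit (fib (2 + e)) (fib (suc e)) (fib (3 + e)) n
  (fib-pos e) (m≤n+m _ _) (subst (n ≤_) (*-comm (fib (suc e)) (fib (2 + e))) le)

-- Sums of cells over a parity class

stepSum : ℕ → ℕ → (ℕ → ℕ) → ℕ
stepSum k zero f = 0
stepSum k (suc d) f = f k + stepSum (2 + k) d f

double-+ : ∀ d k → double d + (2 + k) ≡ 2 + (double d + k)
double-+ zero k = refl
double-+ (suc d) k = cong (2 +_) (double-+ d k)

stepSum-split : ∀ k c d f → stepSum k (c + d) f ≡ stepSum k c f + stepSum (double c + k) d f
stepSum-split k zero d f = refl
stepSum-split k (suc c) d f = begin
  f k + stepSum (2 + k) (c + d) f
    ≡⟨ cong (f k +_) (stepSum-split (2 + k) c d f) ⟩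
  f k + (stepSum (2 + k) c f + stepSum (double c + (2 + k)) d f)
    ≡⟨ cong (λ z → f k + (stepSum (2 + k) c f + stepSum z d f)) (double-+ c k) ⟩
  f k + (stepSum (2 + k) c f + stepSum (2 + (double c + k)) d f)
    ≡⟨ sym (+-assoc (f k) _ _) ⟩
  f k + stepSum (2 + k) c f + stepSum (2 + (double c + k)) d f ∎
  where open ≡-Reasoning

-- Ten times a full cell is 5 F_{e+1}² + 5 F_{e+1}, which exceeds F_{2e+4} - F_{2e} by at most 5
-- F_{e+1} + 2 ≤ 7 F_{e+1} = 7 F_{e+2} - 7 F_e. So the error telescopes along with the main term,
-- which is why the upper bound carries `7 * fib r`. From below the linear term 5 F_{e+1} already
-- absorbs the discrepancy 2.
fullCells : ∀ c r k n → double c + r ≡ k → (∀ e → 2 + e ≤ k → fib (suc e) * fib (2 + e) ≤ n) →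
  let A = stepSum r c (λ e → cell e (λ x → hit x n)) in
  fib (double k) ≤ 10 * A + fib (double r) ×
  10 * A + fib (double r) + 7 * fib r ≤ fib (double k) + 7 * fib k
fullCells zero r .r n refl le = ≤-refl , ≤-refl
fullCells (suc c) r .(2 + (double c + r)) n refl le = lower , upper
  where
    k = 2 + (double c + r)
    A′ = stepSum (2 + r) c (λ e → cell e (λ x → hit x n))
    t = cell r (λ x → hit x n)
    f = fib (suc r)
    l = lucas (2 + double r)
    IH = fullCells c (2 + r) k n (double-+ c r) le
    10t : 10 * t ≡ f * (5 * f) + 5 * f
    10t = begin
      10 * t         ≡⟨ *-assoc 5 2 t ⟩
      5 * (2 * t)    ≡⟨ cong (5 *_) (cell-full r n (le r (s≤s (s≤s (m≤n+m r (double c)))))) ⟩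
      5 * (f * suc f) ≡⟨ lem f ⟩
      f * (5 * f) + 5 * f ∎
      where
        open ≡-Reasoning
        lem : ∀ f → 5 * (f * suc f) ≡ f * (5 * f) + 5 * f
        lem = solve-∀
    open ≤-Reasoning
    2≤5f : 2 ≤ 5 * f
    2≤5f = ≤-trans (s≤s (s≤s z≤n)) (*-monoʳ-≤ 5 (fib-pos r))
    lower : fib (double k) ≤ 10 * (t + A′) + fib (double r)
    lower = begin
      fib (double k)
        ≤⟨ proj₁ IH ⟩
      10 * A′ + fib (4 + double r)
        ≡⟨ cong (10 * A′ +_) (fib+lucas (double r)) ⟩
      10 * A′ + (fib (double r) + l)
        ≤⟨ +-monoʳ-≤ (10 * A′) (+-monoʳ-≤ (fib (double r)) (≤-trans (proj₂ (5fib²≈lucas r)) (+-monoʳ-≤ (f * (5 * f)) 2≤5f))) ⟩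
      10 * A′ + (fib (double r) + (f * (5 * f) + 5 * f))
        ≡⟨ cong (λ z → 10 * A′ + (fib (double r) + z)) (sym 10t) ⟩
      10 * A′ + (fib (double r) + 10 * t)
        ≡⟨ lem A′ (fib (double r)) t ⟩
      10 * (t + A′) + fib (double r) ∎
      where
        lem : ∀ a b c → 10 * a + (b + 10 * c) ≡ 10 * (c + a) + b
        lem = solve-∀
    upper : 10 * (t + A′) + fib (double r) + 7 * fib r ≤ fib (double k) + 7 * fib k
    upper = begin
      10 * (t + A′) + fib (double r) + 7 * fib r
        ≡⟨ lem t A′ (fib (double r)) (fib r) ⟩
      10 * t + (10 * A′ + fib (double r) + 7 * fib r)
        ≡⟨ cong (_+ (10 * A′ + fib (double r) + 7 * fib r)) 10t ⟩
      f * (5 * f) + 5 * f + (10 * A′ + fib (double r) + 7 * fib r)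
        ≤⟨ +-monoˡ-≤ _ (+-monoˡ-≤ (5 * f) (≤-trans (proj₁ (5fib²≈lucas r)) (+-monoʳ-≤ l (*-monoʳ-≤ 2 (fib-pos r))))) ⟩
      l + 2 * f + 5 * f + (10 * A′ + fib (double r) + 7 * fib r)
        ≡⟨ lem′ l f (10 * A′) (fib (double r)) (fib r) ⟩
      10 * A′ + (fib (double r) + l) + 7 * (f + fib r)
        ≡⟨ cong (λ z → 10 * A′ + z + 7 * (f + fib r)) (sym (fib+lucas (double r))) ⟩
      10 * A′ + fib (4 + double r) + 7 * fib (2 + r)
        ≤⟨ proj₂ IH ⟩
      fib (double k) + 7 * fib k ∎
      where
        lem : ∀ a b c d → 10 * (a + b) + c + 7 * d ≡ 10 * a + (10 * b + c + 7 * d)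
        lem = solve-∀
        lem′ : ∀ l f a b d → l + 2 * f + 5 * f + (a + b + 7 * d) ≡ a + (b + l) + 7 * (f + d)
        lem′ = solve-∀

-- The areas telescope: the sum of 1 / (F_e F_{e+2}) over e = k, k + 2, …, T − 2 is F_{T−k} / (F_k F_T).
triangleCells : ∀ d k T n → double d + k ≡ T → 1 ≤ k → n ≤ fib k * fib (suc k) →
  let G = stepSum k d (λ e → cell e (λ x → hit x n)) in
  2 * (fib k * fib T * G) ≈[ 2 * (n * fib T) ] n * n * fib (double d)
triangleCells zero k T n _ _ _ rewrite *-zeroʳ (fib k * fib T) | *-zeroʳ (n * n) = z≤n , z≤n
-- The new cell has denominator F_k F_{k+2} and the remaining sum F_{k+2} F_T, so both bounds are
-- proved multiplied by q = F_{k+2}.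
triangleCells (suc d) k T n eq 1≤k le = *-cancelˡ-≤ q {{>-nonZero (fib-pos (suc k))}} upper
                                      , *-cancelˡ-≤ q {{>-nonZero (fib-pos (suc k))}} lower
  where
    p = fib k
    q = fib (2 + k)
    τ = fib T
    c = cell k (λ x → hit x n)
    G′ = stepSum (2 + k) d (λ e → cell e (λ x → hit x n))
    f = fib (double d)
    f″ = fib (2 + double d)
    cb = cell-triangle k n 1≤k le
    IH = triangleCells d (2 + k) T n (trans (double-+ d k) eq) (s≤s z≤n)
      (≤-trans le (*-mono-≤ (m≤n+m (fib k) (fib (suc k))) (≤-trans (m≤m+n (fib (suc k)) (fib k)) (m≤m+n (fib (2 + k)) _))))
    product : τ + p * f ≡ q * f″
    product = trans (cong (λ z → fib z + p * f) (trans (sym eq) (cong (2 +_) (+-comm (double d) k))))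
                    (fib-product k (double d))
    expand : q * (2 * (p * τ * (c + G′))) ≡ τ * (2 * (p * q * c)) + p * (2 * (q * τ * G′))
    expand = lem p q τ c G′
      where
        lem : ∀ p q t c g → q * (2 * (p * t * (c + g))) ≡ t * (2 * (p * q * c)) + p * (2 * (q * t * g))
        lem = solve-∀
    -- The error bound 2 n F_T reproduces itself because 2 F_k ≤ F_{k+2}: passing to the next cell
    -- at least halves the inherited error.
    errors : τ * (n * q) + p * (2 * (n * τ)) ≤ q * (2 * (n * τ))
    errors = begin
      τ * (n * q) + p * (2 * (n * τ))   ≡⟨ lem τ n q p ⟩
      n * τ * (q + 2 * p)               ≤⟨ *-monoʳ-≤ (n * τ) (+-monoʳ-≤ q (2fib≤fib k)) ⟩
      n * τ * (q + q)                   ≡⟨ lem′ τ n q ⟩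
      q * (2 * (n * τ)) ∎
      where
        open ≤-Reasoning
        lem : ∀ t n q p → t * (n * q) + p * (2 * (n * t)) ≡ n * t * (q + 2 * p)
        lem = solve-∀
        lem′ : ∀ t n q → n * t * (q + q) ≡ q * (2 * (n * t))
        lem′ = solve-∀
    mains : τ * (n * n) + p * (n * n * f) ≡ q * (n * n * f″)
    mains = begin
      τ * (n * n) + p * (n * n * f)  ≡⟨ lem τ (n * n) p f ⟩
      n * n * (τ + p * f)            ≡⟨ cong (n * n *_) product ⟩
      n * n * (q * f″)               ≡⟨ lem′ (n * n) q f″ ⟩
      q * (n * n * f″) ∎
      where
        open ≡-Reasoning
        lem : ∀ t m p f → t * m + p * (m * f) ≡ m * (t + p * f)
        lem = solve-∀
        lem′ : ∀ m q f → m * (q * f) ≡ q * (m * f)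
        lem′ = solve-∀
    distribute : ∀ t p a b c d → t * (a + b) + p * (c + d) ≡ t * a + p * c + (t * b + p * d)
    distribute = solve-∀
    open ≤-Reasoning
    upper : q * (2 * (p * τ * (c + G′))) ≤ q * (n * n * f″ + 2 * (n * τ))
    upper = begin
      q * (2 * (p * τ * (c + G′)))
        ≡⟨ expand ⟩
      τ * (2 * (p * q * c)) + p * (2 * (q * τ * G′))
        ≤⟨ +-mono-≤ (*-monoʳ-≤ τ (proj₁ cb)) (*-monoʳ-≤ p (proj₁ IH)) ⟩
      τ * (n * n + n * q) + p * (n * n * f + 2 * (n * τ))
        ≡⟨ distribute τ p (n * n) (n * q) (n * n * f) (2 * (n * τ)) ⟩
      τ * (n * n) + p * (n * n * f) + (τ * (n * q) + p * (2 * (n * τ)))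
        ≤⟨ +-mono-≤ (≤-reflexive mains) errors ⟩
      q * (n * n * f″) + q * (2 * (n * τ))
        ≡⟨ sym (*-distribˡ-+ q (n * n * f″) (2 * (n * τ))) ⟩
      q * (n * n * f″ + 2 * (n * τ)) ∎
    lower : q * (n * n * f″) ≤ q * (2 * (p * τ * (c + G′)) + 2 * (n * τ))
    lower = begin
      q * (n * n * f″)
        ≡⟨ sym mains ⟩
      τ * (n * n) + p * (n * n * f)
        ≤⟨ +-mono-≤ (*-monoʳ-≤ τ (proj₂ cb)) (*-monoʳ-≤ p (proj₂ IH)) ⟩
      τ * (2 * (p * q * c) + n * q) + p * (2 * (q * τ * G′) + 2 * (n * τ))
        ≡⟨ distribute τ p (2 * (p * q * c)) (n * q) (2 * (q * τ * G′)) (2 * (n * τ)) ⟩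
      τ * (2 * (p * q * c)) + p * (2 * (q * τ * G′)) + (τ * (n * q) + p * (2 * (n * τ)))
        ≤⟨ +-mono-≤ (≤-reflexive (sym expand)) errors ⟩
      q * (2 * (p * τ * (c + G′))) + q * (2 * (n * τ))
        ≡⟨ sym (*-distribˡ-+ q (2 * (p * τ * (c + G′))) (2 * (n * τ))) ⟩
      q * (2 * (p * τ * (c + G′)) + 2 * (n * τ)) ∎

double≡+ : ∀ k → double k ≡ k + k
double≡+ zero = refl
double≡+ (suc k) = cong suc (trans (cong suc (double≡+ k)) (sym (+-suc k k)))

fib*fib≤fib : ∀ k → fib k * fib (suc k) ≤ fib (suc (double k))
fib*fib≤fib k = begin
  fib k * fib (suc k)
    ≤⟨ *-monoˡ-≤ (fib (suc k)) (fib≤fib-suc k) ⟩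
  fib (suc k) * fib (suc k)
    ≤⟨ m≤m+n _ (fib k * fib k) ⟩
  fib (suc k) * fib (suc k) + fib k * fib k
    ≡⟨ sym (fib-suc-+ k k) ⟩
  fib (suc k + k)
    ≡⟨ cong (λ z → fib (suc z)) (sym (double≡+ k)) ⟩
  fib (suc (double k)) ∎
  where open ≤-Reasoning

-- The telescoped value F_{T-k} / (F_k F_T) becomes 1 / F_{2k} by F_{2k} = L_k F_k and L_k F_{T-k} =
-- F_T ± F_{T-2k}; the hypothesis `k < double d` gives T > 2k. The correction is harmless however
-- large d is, since n ≤ F_{2k+1} gives n F_{T-2k} ≤ F_T.
triangleCells-≈ : ∀ d k n → 1 ≤ k → k < double d → n ≤ fib k * fib (suc k) →
  let G = stepSum k d (λ e → cell e (λ x → hit x n)) in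
  2 * (fib (double k) * G) ≈[ 3 * (n * lucas k) ] n * n
triangleCells-≈ d k n 1≤k k<2d le with m≤n⇒∃[o]m+o≡n k<2d
... | q , eq = *-cancelˡ-≤ τ {{τ≢0}} upper , *-cancelˡ-≤ τ {{τ≢0}} lower
  where
    T = double k + suc q
    τ = fib T
    τ≢0 : NonZero τ
    τ≢0 = >-nonZero (subst (λ z → 1 ≤ fib z) (sym (+-suc (double k) q)) (fib-pos (double k + q)))
    l = lucas k
    f = fib k
    F = fib (double k)
    G = stepSum k d (λ e → cell e (λ x → hit x n))
    2d≡ : double d ≡ k + suc q
    2d≡ = trans (sym eq) (sym (+-suc k q))
    T≡ : double d + k ≡ T
    T≡ = begin
      double d + k      ≡⟨ cong (_+ k) 2d≡ ⟩
      k + suc q + k     ≡⟨ lem k (suc q) ⟩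
      k + k + suc q     ≡⟨ cong (_+ suc q) (sym (double≡+ k)) ⟩
      double k + suc q  ∎
      where
        open ≡-Reasoning
        lem : ∀ k q → k + q + k ≡ k + k + q
        lem = solve-∀
    tc : 2 * (f * τ * G) ≈[ 2 * (n * τ) ] n * n * fib (k + suc q)
    tc = subst (λ z → 2 * (f * τ * G) ≈[ 2 * (n * τ) ] n * n * fib z) 2d≡
           (triangleCells d k T n T≡ 1≤k le)
    lf = lucas*fib≈fib k (suc q)
    small : n * n * fib (suc q) ≤ n * l * τ
    small = begin
      n * n * fib (suc q)
        ≡⟨ *-assoc n n _ ⟩
      n * (n * fib (suc q))
        ≤⟨ *-monoʳ-≤ n (*-monoˡ-≤ (fib (suc q)) (≤-trans le (fib*fib≤fib k))) ⟩
      n * (fib (suc (double k)) * fib (suc q))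
        ≤⟨ *-monoʳ-≤ n (m≤m+n _ (F * fib q)) ⟩
      n * (fib (suc (double k)) * fib (suc q) + F * fib q)
        ≡⟨ cong (n *_) (sym (trans (cong fib (+-suc (double k) q)) (fib-suc-+ (double k) q))) ⟩
      n * τ
        ≤⟨ *-monoˡ-≤ τ (subst (_≤ n * l) (*-identityʳ n) (*-monoʳ-≤ n (lucas-pos k))) ⟩
      n * l * τ ∎
      where open ≤-Reasoning
    expand : τ * (2 * (F * G)) ≡ l * (2 * (f * τ * G))
    expand = trans (cong (λ z → τ * (2 * (z * G))) (sym (lucas*fib≡fib k))) (lem τ l f G)
      where
        lem : ∀ t l f g → t * (2 * (l * f * g)) ≡ l * (2 * (f * t * g))
        lem = solve-∀
    open ≤-Reasoning
    upper : τ * (2 * (F * G)) ≤ τ * (n * n + 3 * (n * l))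
    upper = begin
      τ * (2 * (F * G))
        ≡⟨ expand ⟩
      l * (2 * (f * τ * G))
        ≤⟨ *-monoʳ-≤ l (proj₁ tc) ⟩
      l * (n * n * fib (k + suc q) + 2 * (n * τ))
        ≡⟨ lem l (n * n) (fib (k + suc q)) n τ ⟩
      n * n * (l * fib (k + suc q)) + 2 * (n * l * τ)
        ≤⟨ +-monoˡ-≤ _ (*-monoʳ-≤ (n * n) (proj₁ lf)) ⟩
      n * n * (τ + fib (suc q)) + 2 * (n * l * τ)
        ≡⟨ cong (_+ 2 * (n * l * τ)) (*-distribˡ-+ (n * n) τ (fib (suc q))) ⟩
      n * n * τ + n * n * fib (suc q) + 2 * (n * l * τ)
        ≤⟨ +-monoˡ-≤ _ (+-monoʳ-≤ (n * n * τ) small) ⟩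
      n * n * τ + n * l * τ + 2 * (n * l * τ)
        ≡⟨ lem′ (n * n) (n * l) τ ⟩
      τ * (n * n + 3 * (n * l)) ∎
      where
        lem : ∀ l m x n t → l * (m * x + 2 * (n * t)) ≡ m * (l * x) + 2 * (n * l * t)
        lem = solve-∀
        lem′ : ∀ m a t → m * t + a * t + 2 * (a * t) ≡ t * (m + 3 * a)
        lem′ = solve-∀
    lower : τ * (n * n) ≤ τ * (2 * (F * G) + 3 * (n * l))
    lower = begin
      τ * (n * n)
        ≡⟨ *-comm τ (n * n) ⟩
      n * n * τ
        ≤⟨ *-monoʳ-≤ (n * n) (proj₂ lf) ⟩
      n * n * (l * fib (k + suc q) + fib (suc q))
        ≡⟨ lem (n * n) l (fib (k + suc q)) (fib (suc q)) ⟩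
      l * (n * n * fib (k + suc q)) + n * n * fib (suc q)
        ≤⟨ +-mono-≤ (*-monoʳ-≤ l (proj₂ tc)) small ⟩
      l * (2 * (f * τ * G) + 2 * (n * τ)) + n * l * τ
        ≡⟨ lem′ l (2 * (f * τ * G)) n τ ⟩
      l * (2 * (f * τ * G)) + 3 * (n * l * τ)
        ≡⟨ cong (_+ 3 * (n * l * τ)) (sym expand) ⟩
      τ * (2 * (F * G)) + 3 * (n * l * τ)
        ≡⟨ lem″ τ (2 * (F * G)) (n * l) ⟩
      τ * (2 * (F * G) + 3 * (n * l)) ∎
      where
        lem : ∀ m l x y → m * (l * x + y) ≡ l * (m * x) + m * y
        lem = solve-∀
        lem′ : ∀ l x n t → l * (x + 2 * (n * t)) + n * l * t ≡ l * x + 3 * (n * l * t)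
        lem′ = solve-∀
        lem″ : ∀ t x a → t * x + 3 * (a * t) ≡ t * (x + 3 * a)
        lem″ = solve-∀

-- The first c cells, with e ≤ k - 2, are full and the other d, with e ≥ k, are triangles. The
-- constant is 37 = 7 + 5 · 3 · 2: the 7 of `fullCells`, and five times the error 3 n L_k of
-- `triangleCells-≈` with n L_k ≤ 2 F_k F_{2k}. The condition r ≤ 1 keeps the bottom term F_{2r} of
-- the telescoping at most 1.
stepSum-cell-≈ : ∀ c d r k n → r ≤ 1 → double c + r ≡ k → 1 ≤ k → k < double d →
  fib (pred k) * fib k ≤ n → n ≤ fib k * fib (suc k) →
  10 * stepSum r (c + d) (λ e → cell e (λ x → hit x n)) * fib (double k)
    ≈[ 37 * (fib k * fib (double k)) ] 5 * (n * n) + fib (double k) * fib (double k)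
stepSum-cell-≈ c d r k n r≤1 refl 1≤k k<2d lo hi =
  subst (λ X → 10 * X * F ≈[ 37 * (f * F) ] 5 * (n * n) + F * F)
    (sym (stepSum-split r c d (λ e → cell e (λ x → hit x n)))) (upper , lower)
  where
    f = fib k
    F = fib (double k)
    l = lucas k
    A = stepSum r c (λ e → cell e (λ x → hit x n))
    G = stepSum k d (λ e → cell e (λ x → hit x n))
    fullb = fullCells c r k n refl (λ e 2+e≤k → ≤-trans
      (*-mono-≤ (fib-mono {suc e} (pred-mono-≤ 2+e≤k)) (fib-mono 2+e≤k)) lo)
    trib = triangleCells-≈ d k n 1≤k k<2d hi
    1≤f : 1 ≤ f
    1≤f = fib-mono 1≤k
    fib-double-r : ∀ {r} → r ≤ 1 → fib (double r) ≤ 1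
    fib-double-r z≤n = z≤n
    fib-double-r (s≤s z≤n) = ≤-refl
    nl≤ : n * l ≤ 2 * (f * F)
    nl≤ = begin
      n * l                    ≤⟨ *-monoˡ-≤ l hi ⟩
      f * fib (suc k) * l      ≤⟨ *-monoˡ-≤ l (*-monoʳ-≤ f (fib-suc≤2fib 1≤k)) ⟩
      f * (2 * f) * l          ≡⟨ lem f l ⟩
      2 * (f * (l * f))        ≡⟨ cong (λ z → 2 * (f * z)) (lucas*fib≡fib k) ⟩
      2 * (f * F) ∎
      where
        open ≤-Reasoning
        lem : ∀ f l → f * (2 * f) * l ≡ 2 * (f * (l * f))
        lem = solve-∀
    expand : 10 * (A + G) * F ≡ 10 * A * F + 5 * (2 * (F * G))
    expand = lem A G F
      where
        lem : ∀ a g f → 10 * (a + g) * f ≡ 10 * a * f + 5 * (2 * (f * g))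
        lem = solve-∀
    open ≤-Reasoning
    upper : 10 * (A + G) * F ≤ 5 * (n * n) + F * F + 37 * (f * F)
    upper = begin
      10 * (A + G) * F
        ≡⟨ expand ⟩
      10 * A * F + 5 * (2 * (F * G))
        ≤⟨ +-mono-≤ (*-monoˡ-≤ F (≤-trans (m≤m+n (10 * A) (fib (double r))) (≤-trans (m≤m+n _ (7 * fib r)) (proj₂ fullb))))
                    (*-monoʳ-≤ 5 (≤-trans (proj₁ trib) (+-monoʳ-≤ (n * n) (*-monoʳ-≤ 3 nl≤)))) ⟩
      (F + 7 * f) * F + 5 * (n * n + 3 * (2 * (f * F)))
        ≡⟨ lem F f (n * n) ⟩
      5 * (n * n) + F * F + 37 * (f * F) ∎
      where
        lem : ∀ F f m → (F + 7 * f) * F + 5 * (m + 3 * (2 * (f * F))) ≡ 5 * m + F * F + 37 * (f * F)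
        lem = solve-∀
    lower : 5 * (n * n) + F * F ≤ 10 * (A + G) * F + 37 * (f * F)
    lower = begin
      5 * (n * n) + F * F
        ≤⟨ +-mono-≤ (*-monoʳ-≤ 5 (≤-trans (proj₂ trib) (+-monoʳ-≤ (2 * (F * G)) (*-monoʳ-≤ 3 nl≤))))
             (*-monoˡ-≤ F (≤-trans (proj₁ fullb) (+-monoʳ-≤ (10 * A) (≤-trans (fib-double-r r≤1) 1≤f)))) ⟩
      5 * (2 * (F * G) + 3 * (2 * (f * F))) + (10 * A + f) * F
        ≡⟨ lem (2 * (F * G)) f F (10 * A) ⟩
      10 * A * F + 5 * (2 * (F * G)) + 31 * (f * F)
        ≡⟨ cong (_+ 31 * (f * F)) (sym expand) ⟩
      10 * (A + G) * F + 31 * (f * F)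
        ≤⟨ +-monoʳ-≤ (10 * (A + G) * F) (*-monoˡ-≤ (f * F) (m≤m+n 31 6)) ⟩
      10 * (A + G) * F + 37 * (f * F) ∎
      where
        lem : ∀ g f F a → 5 * (g + 3 * (2 * (f * F))) + (a + f) * F ≡ a * F + 5 * g + 31 * (f * F)
        lem = solve-∀

-- Canonical forms of integers

walk-fib : ∀ a b e → walk a b (2 + e) ≡ a * fib e + b * fib (suc e)
walk-fib a b 0 = lem a b
  where
    lem : ∀ a b → b ≡ a * 0 + b * 1
    lem = solve-∀
walk-fib a b 1 = lem a b
  where
    lem : ∀ a b → b + a ≡ a * 1 + b * 1
    lem = solve-∀
walk-fib a b (suc (suc e)) = begin
  walk a b (3 + e) + walk a b (2 + e)
    ≡⟨ cong₂ _+_ (walk-fib a b (suc e)) (walk-fib a b e) ⟩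
  (a * fib (suc e) + b * fib (2 + e)) + (a * fib e + b * fib (suc e))
    ≡⟨ lem a b (fib (2 + e)) (fib (suc e)) (fib e) ⟩
  a * (fib (suc e) + fib e) + b * (fib (2 + e) + fib (suc e)) ∎
  where
    open ≡-Reasoning
    lem : ∀ a b x y z → (a * y + b * x) + (a * z + b * y) ≡ a * (y + z) + b * (x + y)
    lem = solve-∀

walk-tail : ∀ a b s → walk a b (2 + s) ≡ walk b (b + a) (suc s)
walk-tail a b 0 = refl
walk-tail a b 1 = refl
walk-tail a b (suc (suc s)) = cong₂ _+_ (walk-tail a b (suc s)) (walk-tail a b s)

-- Dropping the first entry of a walk leaves a walk with positive start, so the positions at which m
-- can occur form an initial segment; for maximality it is enough to exclude the next position.
Occurs-downward : ∀ {m j k} → 1 ≤ j → j ≤ k → Occurs m k → Occurs m j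
Occurs-downward {m} {j} 1≤j j≤k = go (≤⇒≤′ j≤k)
  where
    go : ∀ {k} → j ≤′ k → Occurs m k → Occurs m j
    go ≤′-refl occ = occ
    go (≤′-step {zero} j≤0) _ = contradiction (≤-trans 1≤j (≤′⇒≤ j≤0)) λ ()
    go (≤′-step {suc k} j≤k) (_ , a , b , 1≤a , 1≤b , eq) =
      go j≤k (s≤s z≤n , b , b + a , 1≤b , ≤-trans 1≤b (m≤m+n b a) , trans (sym (walk-tail a b k)) eq)

IsSMax-unique : ∀ {m s s′} → IsSMax m s → IsSMax m s′ → s ≡ s′
IsSMax-unique (occ , max) (occ′ , max′) = ≤-antisym (max′ _ occ) (max _ occ′)

fib-coprime : ∀ e → Coprime (fib (suc e)) (fib e)
fib-coprime zero (d∣1 , _) = ∣1⇒≡1 d∣1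
fib-coprime (suc e) (d∣F₂ , d∣F₁) = fib-coprime e (d∣F₁ , ∣m+n∣m⇒∣n d∣F₂ d∣F₁)

-- As F_e and F_{e+1} are coprime, the first coefficient is determined modulo F_{e+1}. If a′ < a,
-- then F_{e+1} would divide a - a′, which is positive and, as a′ ≥ 1, smaller than a ≤ F_{e+1}.
fib-combination-≤ : ∀ e a b a′ b′ → a ≤ fib (suc e) → 1 ≤ a′ →
  a * fib e + b * fib (suc e) ≡ a′ * fib e + b′ * fib (suc e) → a ≤ a′
fib-combination-≤ e a b a′ b′ a≤F 1≤a′ eq with a ≤? a′
... | yes a≤a′ = a≤a′
... | no a≰a′ with m≤n⇒∃[o]m+o≡n (≰⇒> a≰a′)
...   | x , refl = contradiction a≤F (<⇒≱ (begin-strict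
        fib (suc e)   ≤⟨ ∣⇒≤ (coprime-divisor (fib-coprime e) F∣xF) ⟩
        suc x         <⟨ s≤s (+-monoˡ-≤ x 1≤a′) ⟩
        suc a′ + x    ∎))
  where
    open ≤-Reasoning
    cancelled : b * fib (suc e) + fib e * suc x ≡ b′ * fib (suc e)
    cancelled = +-cancelˡ-≡ (a′ * fib e) _ _ (trans (lem a′ (fib e) b (fib (suc e)) x) eq)
      where
        lem : ∀ a p b q x → a * p + (b * q + p * suc x) ≡ (suc a + x) * p + b * q
        lem = solve-∀
    F∣xF : fib (suc e) ∣ fib e * suc x
    F∣xF = ∣m+n∣m⇒∣n (subst (fib (suc e) ∣_) (sym cancelled) (n∣m*n b′)) (n∣m*n b)

record Canonical (m e a b : ℕ) : Set where
  constructor canonical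
  field
    1≤b : 1 ≤ b
    b≤a : b ≤ a
    a≤fib : a ≤ fib (suc e)
    value : a * fib e + b * fib (suc e) ≡ m

-- If (a′, b′) reached m one position later, then (b′, a′ + b′) would represent m at level e.
-- Minimality of a gives b ≤ a ≤ b′ < a′ + b′, so that representation would have a strictly larger
-- value.
Canonical⇒IsSMax : ∀ {m e a b} → Canonical m e a b → IsSMax m (2 + e)
Canonical⇒IsSMax {m} {e} {a} {b} (canonical 1≤b b≤a a≤fib value) =
  occ , λ k occ′ → ≮⇒≥ (λ s<k → next (Occurs-downward (s≤s z≤n) s<k occ′))
  where
    occ : Occurs m (2 + e)
    occ = s≤s z≤n , a , b , ≤-trans 1≤b b≤a , 1≤b , trans (walk-fib a b e) value
    next : ¬ Occurs m (3 + e)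
    next (_ , a′ , b′ , 1≤a′ , 1≤b′ , eq) = <-irrefl eq′ (+-mono-≤-< (*-monoˡ-≤ (fib e) a≤b′)
        (*-monoˡ-< (fib (suc e)) {{>-nonZero (fib-pos e)}}
          (≤-trans (s≤s (≤-trans b≤a a≤b′)) (+-monoˡ-≤ b′ 1≤a′))))
      where
        lem : ∀ a b p q → b * q + (a + b) * p ≡ a * p + b * (p + q)
        lem = solve-∀
        eq′ : a * fib e + b * fib (suc e) ≡ b′ * fib e + (a′ + b′) * fib (suc e)
        eq′ = trans value (sym (trans (lem a′ b′ (fib (suc e)) (fib e)) (trans (sym (walk-fib a′ b′ (suc e))) eq)))
        a≤b′ : a ≤ b′
        a≤b′ = fib-combination-≤ e a b b′ (a′ + b′) a≤fib 1≤b′ eq′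

Canonical-unique : ∀ {m e a b e′ a′ b′} → Canonical m e a b → Canonical m e′ a′ b′ →
  e ≡ e′ × a ≡ a′ × b ≡ b′
Canonical-unique {m} {e} {a} {b} {e′} {a′} {b′} c c′
  with suc-injective (suc-injective (IsSMax-unique (Canonical⇒IsSMax c) (Canonical⇒IsSMax c′)))
... | refl with ≤-antisym (fib-combination-≤ e a b a′ b′ (Canonical.a≤fib c) (≤-trans (Canonical.1≤b c′) (Canonical.b≤a c′)) eq)
                          (fib-combination-≤ e a′ b′ a b (Canonical.a≤fib c′) (≤-trans (Canonical.1≤b c) (Canonical.b≤a c)) (sym eq))
  where
    eq : a * fib e + b * fib (suc e) ≡ a′ * fib e + b′ * fib (suc e)
    eq = trans (Canonical.value c) (sym (Canonical.value c′))
... | refl = refl , refl ,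
  *-cancelʳ-≡ b b′ (fib (suc e)) {{>-nonZero (fib-pos e)}}
    (+-cancelˡ-≡ (a * fib e) _ _ (trans (Canonical.value c) (sym (Canonical.value c′))))

Canonical-≤ : ∀ {m e a b} → Canonical m e a b → e ≤ m
Canonical-≤ {m} {e} {a} {b} c = begin
  e                            ≤⟨ k≤fib-suc e ⟩
  fib (suc e)                  ≡⟨ sym (*-identityˡ _) ⟩
  1 * fib (suc e)              ≤⟨ *-monoˡ-≤ (fib (suc e)) (Canonical.1≤b c) ⟩
  b * fib (suc e)              ≤⟨ m≤n+m _ (a * fib e) ⟩
  a * fib e + b * fib (suc e)  ≡⟨ Canonical.value c ⟩
  m                            ∎
  where open ≤-Reasoning

-- Read the walk (a, b) backwards as long as b > a, each time moving a into [1, F].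
Canonical-search : ∀ fuel e a b m → 1 ≤ a → a ≤ fib (suc e) → 1 ≤ b →
  a * fib e + b * fib (suc e) ≡ m → m < fuel + e → ∃[ e ] ∃[ a ] ∃[ b ] Canonical m e a b
Canonical-search zero e a b m 1≤a a≤F 1≤b eq m<e = contradiction m<e (≤⇒≯ (begin
  e                            ≤⟨ k≤fib-suc e ⟩
  fib (suc e)                  ≡⟨ sym (*-identityˡ _) ⟩
  1 * fib (suc e)              ≤⟨ *-monoˡ-≤ (fib (suc e)) 1≤b ⟩
  b * fib (suc e)              ≤⟨ m≤n+m _ (a * fib e) ⟩
  a * fib e + b * fib (suc e)  ≡⟨ eq ⟩
  m                            ∎))
  where open ≤-Reasoning
Canonical-search (suc fuel) e a b m 1≤a a≤F 1≤b eq m<e with b ≤? a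
... | yes b≤a = e , a , b , canonical 1≤b b≤a a≤F eq
... | no b≰a with m≤n⇒∃[o]m+o≡n (≰⇒> b≰a)
-- One step back the walk starts with b - a = `suc x`. It is reduced to 1 + x mod q, a residue in
-- [1, q], and the multiple of q = F_{e+2} taken from the coefficient of p = F_{e+1} returns as
-- `x / q * p` in the coefficient of q.
...   | x , refl = Canonical-search fuel (suc e) (suc (x % q)) (a + x / q * p) m
        (s≤s z≤n) (m%n<n x q) (≤-trans 1≤a (m≤m+n a _)) eq′
        (subst (m <_) (sym (+-suc fuel e)) m<e)
  where
    p = fib (suc e)
    q = fib (2 + e)
    instance
      q≢0 : NonZero q
      q≢0 = >-nonZero (fib-pos (suc e))
    open ≡-Reasoning
    eq′ : suc (x % q) * p + (a + x / q * p) * q ≡ m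
    eq′ = begin
      suc (x % q) * p + (a + x / q * p) * q
        ≡⟨ lem (x % q) (x / q) p a q ⟩
      p + a * q + (x % q + x / q * q) * p
        ≡⟨ cong (λ z → p + a * q + z * p) (sym (m≡m%n+[m/n]*n x q)) ⟩
      p + a * q + x * p
        ≡⟨ lem′ a p (fib e) x ⟩
      a * fib e + (suc a + x) * p
        ≡⟨ eq ⟩
      m ∎
      where
        lem : ∀ r d p a q → suc r * p + (a + d * p) * q ≡ p + a * q + (r + d * q) * p
        lem = solve-∀
        lem′ : ∀ a p f x → p + a * (p + f) + x * p ≡ a * f + (suc a + x) * p
        lem′ = solve-∀

Canonical-exists : ∀ m → 1 ≤ m → ∃[ e ] ∃[ a ] ∃[ b ] Canonical m e a b
Canonical-exists m 1≤m = Canonical-search (suc m) 0 1 m m ≤-refl ≤-refl 1≤m (*-identityʳ m)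
  (s≤s (m≤m+n m 0))

-- Cells and parity classes as indicators of canonical forms

cell-value : ∀ e t b → (t + suc b) * fib e + suc b * fib (suc e) ≡ t * fib e + suc b * fib (2 + e)
cell-value e t b = lem (fib e) (fib (suc e)) t b
  where
    lem : ∀ p q t b → (t + suc b) * p + suc b * q ≡ t * p + suc b * (q + p)
    lem = solve-∀

cell-Canonical : ∀ {m} e t b → t < fib (suc e) ∸ b → t * fib e + suc b * fib (2 + e) ≡ m →
  Canonical m e (t + suc b) (suc b)
cell-Canonical e t b t< eq = canonical (s≤s z≤n) (m≤n+m (suc b) t) (<∸⇒+suc≤ (fib (suc e)) b t<) (trans (cell-value e t b) eq)

cell-δ-1 : ∀ {m e a b} → Canonical m e a b → cell e (λ x → δ x m) ≡ 1
cell-δ-1 {m} {e} {a} {suc b} c@(canonical _ b≤a a≤fib value) = begin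
  cell e (λ x → δ x m)
    ≡⟨ sum<-single _ (≤-trans b≤a a≤fib) (λ j _ j≢b → sum<-0 (N ∸ j) (λ t t< → δ-≢ (λ eq →
         j≢b (suc-injective (proj₂ (proj₂ (Canonical-unique (cell-Canonical e t j t< eq) c))))))) ⟩
  sum< (N ∸ b) (λ t → δ (t * fib e + suc b * fib (2 + e)) m)
    ≡⟨ sum<-single _ t₀< (λ t t< t≢t₀ → δ-≢ (λ eq → t≢t₀ (+-cancelʳ-≡ (suc b) t t₀
         (trans (proj₁ (proj₂ (Canonical-unique (cell-Canonical e t b t< eq) c))) (sym t₀+b≡a))))) ⟩
  δ (t₀ * fib e + suc b * fib (2 + e)) m
    ≡⟨ cong (λ x → δ x m) (trans (sym (cell-value e t₀ b)) (trans (cong (λ z → z * fib e + suc b * fib (suc e)) t₀+b≡a) value)) ⟩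
  δ m m
    ≡⟨ δ-refl m ⟩
  1 ∎
  where
    open ≡-Reasoning
    N = fib (suc e)
    t₀ = a ∸ suc b
    t₀+b≡a : t₀ + suc b ≡ a
    t₀+b≡a = m∸n+n≡m b≤a
    t₀< : t₀ < N ∸ b
    t₀< = m+n≤o⇒m≤o∸n (suc t₀) (subst (_≤ N) (trans (sym t₀+b≡a) (+-suc t₀ b)) a≤fib)

cell-δ-0 : ∀ {m e a b} e′ → Canonical m e a b → e′ ≢ e → cell e′ (λ x → δ x m) ≡ 0
cell-δ-0 e′ c e′≢e = sum<-0 (fib (suc e′)) (λ b _ → sum<-0 (fib (suc e′) ∸ b) (λ t t< →
  δ-≢ (λ eq → e′≢e (proj₁ (Canonical-unique (cell-Canonical e′ t b t< eq) c)))))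

stepSum≡sum< : ∀ r M f → stepSum r M f ≡ sum< M (λ i → f (double i + r))
stepSum≡sum< r zero f = refl
stepSum≡sum< r (suc M) f = cong (f r +_) (trans (stepSum≡sum< (2 + r) M f)
  (sum<-cong M (λ i _ → cong f (double-+ i r))))

-- The indicator that the e of the canonical form of m is one of r, r + 2, …, r + 2 (M − 1).
class : ℕ → ℕ → ℕ → ℕ
class r M m = stepSum r M (λ e → cell e (λ x → δ x m))

double-injective : ∀ {i j} → double i ≡ double j → i ≡ j
double-injective {zero} {zero} _ = refl
double-injective {suc i} {suc j} eq = cong suc (double-injective (suc-injective (suc-injective eq)))

double≢suc-double : ∀ i j → double i ≢ suc (double j)
double≢suc-double (suc i) (suc j) eq = double≢suc-double i j (suc-injective (suc-injective eq))

class-1 : ∀ {m e a b} r i M → Canonical m e a b → e ≡ double i + r → i < M → class r M m ≡ 1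
class-1 {m} r i M c refl i<M = begin
  class r M m
    ≡⟨ stepSum≡sum< r M _ ⟩
  sum< M (λ j → cell (double j + r) (λ x → δ x m))
    ≡⟨ sum<-single _ i<M (λ j _ j≢i → cell-δ-0 (double j + r) c
         (λ eq → j≢i (double-injective (+-cancelʳ-≡ r (double j) (double i) eq)))) ⟩
  cell (double i + r) (λ x → δ x m)
    ≡⟨ cell-δ-1 c ⟩
  1 ∎
  where open ≡-Reasoning

class-0 : ∀ {m e a b} r M → Canonical m e a b → (∀ j → double j + r ≢ e) → class r M m ≡ 0
class-0 r M c e≢ = trans (stepSum≡sum< r M _) (sum<-0 M (λ j _ → cell-δ-0 (double j + r) c (e≢ j)))

triangle-sum : ∀ p q N n (g : ℕ → ℕ → ℕ) →
  triangle p q N (λ x → sum< n (g x)) ≡ sum< n (λ m → triangle p q N (λ x → g x m))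
triangle-sum p q N n g = trans
  (sum<-cong N (λ b _ → sum<-swap (N ∸ b) n (λ t → g (t * p + suc b * q))))
  (sum<-swap N n (λ b m → sum< (N ∸ b) (λ t → g (t * p + suc b * q) m)))

-- Double counting: the lattice points of value at most n are sorted by their value.
stepSum-hit : ∀ r M n → stepSum r M (λ e → cell e (λ x → hit x n)) ≡ sum< n (λ m → class r M (suc m))
stepSum-hit r M n = begin
  stepSum r M (λ e → cell e (λ x → hit x n))
    ≡⟨ stepSum≡sum< r M _ ⟩
  sum< M (λ i → cell (double i + r) (λ x → hit x n))
    ≡⟨ sum<-cong M (λ i _ → triangle-sum (fib (double i + r)) (fib (2 + (double i + r)))
         (fib (suc (double i + r))) n (λ x m → δ x (suc m))) ⟩
  sum< M (λ i → sum< n (λ m → cell (double i + r) (λ x → δ x (suc m))))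
    ≡⟨ sum<-swap M n _ ⟩
  sum< n (λ m → sum< M (λ i → cell (double i + r) (λ x → δ x (suc m))))
    ≡⟨ sum<-cong n (λ m _ → sym (stepSum≡sum< r M _)) ⟩
  sum< n (λ m → class r M (suc m)) ∎
  where open ≡-Reasoning

double+1 : ∀ i → double i + 1 ≡ suc (double i)
double+1 i = +-comm (double i) 1

i≤double : ∀ i → i ≤ double i
i≤double zero = z≤n
i≤double (suc i) = s≤s (m≤n⇒m≤1+n (i≤double i))

-- With m < M the finite sum reaches the cell of m, because e ≤ F_{e+1} ≤ m.
class-even : ∀ {m a b} i M → m < M → Canonical m (double i) a b → class 0 M m ≡ 1 × class 1 M m ≡ 0
class-even {m} i M m<M c =
    class-1 0 i M c (sym (+-identityʳ (double i))) (≤-<-trans (≤-trans (i≤double i) (Canonical-≤ c)) m<M)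
  , class-0 1 M c (λ j eq → double≢suc-double i j (trans (sym eq) (double+1 j)))

class-odd : ∀ {m a b} i M → m < M → Canonical m (suc (double i)) a b → class 0 M m ≡ 0 × class 1 M m ≡ 1
class-odd {m} i M m<M c =
    class-0 0 M c (λ j eq → double≢suc-double j i (trans (sym (+-identityʳ (double j))) eq))
  , class-1 1 i M c (sym (double+1 i)) (≤-<-trans (≤-trans (i≤double i) (≤-trans (n≤1+n _) (Canonical-≤ c))) m<M)

class-0+class-1 : ∀ m M → 1 ≤ m → m < M → class 0 M m + class 1 M m ≡ 1
class-0+class-1 m M 1≤m m<M with Canonical-exists m 1≤m
... | e , a , b , c with parityView e
...   | even i = cong₂ _+_ (proj₁ (class-even i M m<M c)) (proj₂ (class-even i M m<M c))
...   | odd i = cong₂ _+_ (proj₁ (class-odd i M m<M c)) (proj₂ (class-odd i M m<M c))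

-- Arithmetic of ℚ(√5)

module ℚ-Solver = Data.Rational.Solver.+-*-Solver

⊕-⊛-isCommutativeRing : IsCommutativeRing _≡_ _⊕_ _⊛_ ⊝_ (fromℚ 0ℚ) one
⊕-⊛-isCommutativeRing = record
  { isRing = record
    { +-isAbelianGroup = record
      { isGroup = record
        { isMonoid = record
          { isSemigroup = record
            { isMagma = record { isEquivalence = isEquivalence ; ∙-cong = cong₂ _⊕_ }
            ; assoc = λ x y z → cong₂ _+√5·_ (ℚₚ.+-assoc (re x) (re y) (re z)) (ℚₚ.+-assoc (ir x) (ir y) (ir z)) }
          ; identity = (λ x → cong₂ _+√5·_ (ℚₚ.+-identityˡ (re x)) (ℚₚ.+-identityˡ (ir x)))
                     , (λ x → cong₂ _+√5·_ (ℚₚ.+-identityʳ (re x)) (ℚₚ.+-identityʳ (ir x))) }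
        ; inverse = (λ x → cong₂ _+√5·_ (ℚₚ.+-inverseˡ (re x)) (ℚₚ.+-inverseˡ (ir x)))
                  , (λ x → cong₂ _+√5·_ (ℚₚ.+-inverseʳ (re x)) (ℚₚ.+-inverseʳ (ir x)))
        ; ⁻¹-cong = cong ⊝_ }
      ; comm = λ x y → cong₂ _+√5·_ (ℚₚ.+-comm (re x) (re y)) (ℚₚ.+-comm (ir x) (ir y)) }
    ; *-cong = cong₂ _⊛_
    ; *-assoc = λ x y z → cong₂ _+√5·_
        (solve 7 (λ f a b c d g h → (a :* c :+ f :* (b :* d)) :* g :+ f :* ((a :* d :+ b :* c) :* h)
           := a :* (c :* g :+ f :* (d :* h)) :+ f :* (b :* (c :* h :+ d :* g)))
           refl 5ℚ (re x) (ir x) (re y) (ir y) (re z) (ir z))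
        (solve 7 (λ f a b c d g h → (a :* c :+ f :* (b :* d)) :* h :+ (a :* d :+ b :* c) :* g
           := a :* (c :* h :+ d :* g) :+ b :* (c :* g :+ f :* (d :* h)))
           refl 5ℚ (re x) (ir x) (re y) (ir y) (re z) (ir z))
    ; *-identity = ⊛-identityˡ , λ x → trans (⊛-comm x one) (⊛-identityˡ x)
    ; distrib = ⊛-distribˡ , λ x y z → trans (⊛-comm (y ⊕ z) x)
        (trans (⊛-distribˡ x y z) (cong₂ _⊕_ (⊛-comm x y) (⊛-comm x z))) }
  ; *-comm = ⊛-comm }
  where
    open ℚ-Solver
    ⊛-comm : ∀ x y → x ⊛ y ≡ y ⊛ x
    ⊛-comm x y = cong₂ _+√5·_
      (solve 5 (λ f a b c d → a :* c :+ f :* (b :* d) := c :* a :+ f :* (d :* b)) refl 5ℚ (re x) (ir x) (re y) (ir y))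
      (solve 4 (λ a b c d → a :* d :+ b :* c := c :* b :+ d :* a) refl (re x) (ir x) (re y) (ir y))
    ⊛-identityˡ : ∀ x → one ⊛ x ≡ x
    ⊛-identityˡ x = cong₂ _+√5·_
      (solve 3 (λ f a b → con 1ℚ :* a :+ f :* (con 0ℚ :* b) := a) refl 5ℚ (re x) (ir x))
      (solve 2 (λ a b → con 1ℚ :* b :+ con 0ℚ :* a := b) refl (re x) (ir x))
    ⊛-distribˡ : ∀ x y z → x ⊛ (y ⊕ z) ≡ x ⊛ y ⊕ x ⊛ z
    ⊛-distribˡ x y z = cong₂ _+√5·_
      (solve 7 (λ f a b c d g h → a :* (c :+ g) :+ f :* (b :* (d :+ h))
         := a :* c :+ f :* (b :* d) :+ (a :* g :+ f :* (b :* h))) refl 5ℚ (re x) (ir x) (re y) (ir y) (re z) (ir z))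
      (solve 6 (λ a b c d g h → a :* (d :+ h) :+ b :* (c :+ g)
         := a :* d :+ b :* c :+ (a :* h :+ b :* g)) refl (re x) (ir x) (re y) (ir y) (re z) (ir z))

⊕-⊛-commutativeRing : CommutativeRing 0ℓ 0ℓ
⊕-⊛-commutativeRing = record { isCommutativeRing = ⊕-⊛-isCommutativeRing }

fromℚ-* : ∀ p q → fromℚ (p ℚ.* q) ≡ fromℚ p ⊛ fromℚ q
fromℚ-* p q = cong₂ _+√5·_
  (solve 3 (λ f p q → p :* q := p :* q :+ f :* (con 0ℚ :* con 0ℚ)) refl 5ℚ p q)
  (solve 2 (λ p q → con 0ℚ := p :* con 0ℚ :+ con 0ℚ :* q) refl p q)
  where open ℚ-Solver

-- Rational coefficients let the ring solver compute with constants such as 1/50. The irrational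
-- elements φ, √5 and their powers are passed to it as variables, and relations such as φ φ⁻¹ = 1
-- are substituted between two solver steps.
fromℚ-morphism : CommutativeRing.rawRing ℚₚ.+-*-commutativeRing
                   -Raw-AlmostCommutative⟶ fromCommutativeRing ⊕-⊛-commutativeRing
fromℚ-morphism = record
  { ⟦_⟧ = fromℚ
  ; +-homo = λ _ _ → refl
  ; *-homo = fromℚ-*
  ; -‿homo = λ _ → refl
  ; 0-homo = refl
  ; 1-homo = refl
  }

module Q5-Solver = Algebra.Solver.Ring (CommutativeRing.rawRing ℚₚ.+-*-commutativeRing)
  (fromCommutativeRing ⊕-⊛-commutativeRing) fromℚ-morphism (λ p q → map (cong fromℚ) (dec⇒maybe (p ℚₚ.≟ q)))

open Q5-Solver using (solve; con; _:=_; _:+_; _:*_; _:-_; :-_)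

norm : Q5 → ℚ
norm (a +√5· b) = a ℚ.* a ℚ.- qℕ 5 ℚ.* (b ℚ.* b)

norm-⊛ : ∀ x y → norm (x ⊛ y) ≡ norm x ℚ.* norm y
norm-⊛ (a +√5· b) (c +√5· d) = S.solve 5 (λ f a b c d →
  (a S.:* c S.:+ f S.:* (b S.:* d)) S.:* (a S.:* c S.:+ f S.:* (b S.:* d))
    S.:- f S.:* ((a S.:* d S.:+ b S.:* c) S.:* (a S.:* d S.:+ b S.:* c))
  S.:= (a S.:* a S.:- f S.:* (b S.:* b)) S.:* (c S.:* c S.:- f S.:* (d S.:* d))) refl 5ℚ a b c d
  where module S = ℚ-Solver

*-invℚ : ∀ q → q ≢ 0ℚ → q ℚ.* invℚ q ≡ 1ℚ
*-invℚ q q≢0 with q ℚₚ.≟ 0ℚ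
... | yes q≡0 = contradiction q≡0 q≢0
... | no q≢0′ = ℚₚ.*-inverseʳ q {{ℚ.≢-nonZero q≢0′}}

⊛-inv : ∀ x → norm x ≢ 0ℚ → x ⊛ inv x ≡ one
⊛-inv x@(a +√5· b) N≢0 = cong₂ _+√5·_
  (trans (S.solve 4 (λ f a b m → a S.:* (a S.:* m) S.:+ f S.:* (b S.:* (S.:- (b S.:* m)))
                     S.:= (a S.:* a S.:- f S.:* (b S.:* b)) S.:* m) refl 5ℚ a b (invℚ (norm x)))
         (*-invℚ (norm x) N≢0))
  (S.solve 3 (λ a b m → a S.:* (S.:- (b S.:* m)) S.:+ b S.:* (a S.:* m) S.:= S.con 0ℚ) refl a b (invℚ (norm x)))
  where module S = ℚ-Solver

-- From x y = 1 and multiplicativity the norm of x is nonzero, so the total function `inv` is a true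
-- inverse at x. The divisions by φ and by c in the main term are evaluated through this.
inv-unique : ∀ x y → x ⊛ y ≡ one → inv x ≡ y
inv-unique x y xy≡1 = begin
  inv x              ≡⟨ solve 1 (λ i → i := i :* con 1ℚ) refl (inv x) ⟩
  inv x ⊛ one        ≡⟨ cong (inv x ⊛_) (sym xy≡1) ⟩
  inv x ⊛ (x ⊛ y)    ≡⟨ solve 3 (λ i x y → i :* (x :* y) := (x :* i) :* y) refl (inv x) x y ⟩
  (x ⊛ inv x) ⊛ y    ≡⟨ cong (_⊛ y) (⊛-inv x N≢0) ⟩
  one ⊛ y            ≡⟨ solve 1 (λ y → con 1ℚ :* y := y) refl y ⟩
  y ∎
  where
    open ≡-Reasoning
    N≢0 : norm x ≢ 0ℚ
    N≢0 N≡0 = ℚₚ.1≢0 (begin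
      1ℚ                        ≡⟨ cong norm (sym xy≡1) ⟩
      norm (x ⊛ y)              ≡⟨ norm-⊛ x y ⟩
      norm x ℚ.* norm y         ≡⟨ cong (ℚ._* norm y) N≡0 ⟩
      0ℚ ℚ.* norm y             ≡⟨ ℚₚ.*-zeroˡ (norm y) ⟩
      0ℚ ∎)

qℕ≡mkℚ : ∀ n → qℕ n ≡ mkℚ (ℤ.+ n) 0 (Coprimality.sym (Coprimality.1-coprimeTo n))
qℕ≡mkℚ n = ℚₚ.normalize-coprime (Coprimality.sym (Coprimality.1-coprimeTo n))

qℕ-+ : ∀ m n → qℕ (m + n) ≡ qℕ m ℚ.+ qℕ n
qℕ-+ m n = sym (trans (cong₂ ℚ._+_ (qℕ≡mkℚ m) (qℕ≡mkℚ n))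
  (cong (ℚ._/ 1) (cong₂ ℤ._+_ (ℤₚ.*-identityʳ (ℤ.+ m)) (ℤₚ.*-identityʳ (ℤ.+ n)))))

qℕ-* : ∀ m n → qℕ (m * n) ≡ qℕ m ℚ.* qℕ n
qℕ-* m n = sym (trans (cong₂ ℚ._*_ (qℕ≡mkℚ m) (qℕ≡mkℚ n)) (cong (ℚ._/ 1) (sym (ℤₚ.pos-* m n))))

qℕ-nonNeg : ∀ n → 0ℚ ℚ.≤ qℕ n
qℕ-nonNeg n = ℚₚ.nonNegative⁻¹ (qℕ n) {{ℚₚ.normalize-nonNeg n 1}}

qℕ-cancel-≤ : ∀ {m n} → qℕ m ℚ.≤ qℕ n → m ≤ n
qℕ-cancel-≤ {m} {n} le = ℤₚ.drop‿+≤+ (subst₂ ℤ._≤_ (ℤₚ.*-identityʳ (ℤ.+ m)) (ℤₚ.*-identityʳ (ℤ.+ n))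
  (ℚₚ.drop-*≤* (subst₂ ℚ._≤_ (qℕ≡mkℚ m) (qℕ≡mkℚ n) le)))

fromℕ-+ : ∀ m n → fromℕ (m + n) ≡ fromℕ m ⊕ fromℕ n
fromℕ-+ m n = cong fromℚ (qℕ-+ m n)

fromℕ-* : ∀ m n → fromℕ (m * n) ≡ fromℕ m ⊛ fromℕ n
fromℕ-* m n = trans (cong fromℚ (qℕ-* m n)) (fromℚ-* (qℕ m) (qℕ n))

Nonneg-fromℚ : ∀ {q} → 0ℚ ℚ.≤ q → Nonneg (fromℚ q)
Nonneg-fromℚ 0≤q = nonneg (inj₁ (0≤q , ℚₚ.≤-refl))

Nonneg-fromℕ : ∀ n → Nonneg (fromℕ n)
Nonneg-fromℕ n = Nonneg-fromℚ (qℕ-nonNeg n)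

⊖-fromℕ : ∀ m o → fromℕ (m + o) ⊖ fromℕ m ≡ fromℕ o
⊖-fromℕ m o = trans (cong (_⊖ fromℕ m) (fromℕ-+ m o))
  (solve 2 (λ m o → (m :+ o) :- m := o) refl (fromℕ m) (fromℕ o))

fromℕ-mono-≤ : ∀ {m n} → m ≤ n → Nonneg (fromℕ n ⊖ fromℕ m)
fromℕ-mono-≤ {m} m≤n with m≤n⇒∃[o]m+o≡n m≤n
... | o , refl = subst Nonneg (sym (⊖-fromℕ m o)) (Nonneg-fromℕ o)

Nonneg-fromℚ⁻¹ : ∀ {q} → Nonneg (fromℚ q) → 0ℚ ℚ.≤ q
Nonneg-fromℚ⁻¹ (nonneg (inj₁ (0≤q , _))) = 0≤q
Nonneg-fromℚ⁻¹ (nonneg (inj₂ (inj₁ (0≤q , _)))) = 0≤q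
Nonneg-fromℚ⁻¹ {q} (nonneg (inj₂ (inj₂ (q<0 , _ , qq≤0)))) = contradiction
  (ℚₚ.positive⁻¹ (q ℚ.* q) {{ℚₚ.neg*neg⇒pos q {{ℚ.negative q<0}} q {{ℚ.negative q<0}}}}) (ℚ-≤⇒≯ qq≤0)

fromℕ-cancel-≤ : ∀ {m n} → Nonneg (fromℕ n ⊖ fromℕ m) → m ≤ n
fromℕ-cancel-≤ {m} {n} le = qℕ-cancel-≤ (subst₂ ℚ._≤_ (ℚₚ.+-identityˡ (qℕ m))
  (S.solve 2 (λ m n → n S.:- m S.:+ m S.:= n) refl (qℕ m) (qℕ n))
  (ℚₚ.+-monoˡ-≤ (qℕ m) (Nonneg-fromℚ⁻¹ {qℕ n ℚ.- qℕ m} le)))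
  where module S = ℚ-Solver

qℕ-mono-≤ : ∀ {m n} → m ≤ n → qℕ m ℚ.≤ qℕ n
qℕ-mono-≤ {m} m≤n with m≤n⇒∃[o]m+o≡n m≤n
... | o , refl = subst₂ ℚ._≤_ (ℚₚ.+-identityʳ (qℕ m)) (sym (qℕ-+ m o)) (ℚₚ.+-monoʳ-≤ (qℕ m) (qℕ-nonNeg o))

fromℕ-inv : ∀ n → 1 ≤ n → fromℕ n ⊛ inv (fromℕ n) ≡ one × Nonneg (inv (fromℕ n))
fromℕ-inv n@(suc _) _ = subst (λ z → fromℕ n ⊛ z ≡ one) (sym inv≡) n*1/n≡1
  , subst Nonneg (sym inv≡) (Nonneg-fromℚ (ℚₚ.<⇒≤ (ℚₚ.positive⁻¹ (ℚ.1/ qℕ n) {{ℚₚ.1/pos⇒pos (qℕ n)}})))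
  where
    instance
      pos : ℚ.Positive (qℕ n)
      pos = ℚₚ.normalize-pos n 1
      nz : ℚ.NonZero (qℕ n)
      nz = ℚₚ.pos⇒nonZero (qℕ n)
    n*1/n≡1 : fromℕ n ⊛ fromℚ (ℚ.1/ qℕ n) ≡ one
    n*1/n≡1 = trans (sym (fromℚ-* (qℕ n) (ℚ.1/ qℕ n))) (cong fromℚ (ℚₚ.*-inverseʳ (qℕ n)))
    inv≡ : inv (fromℕ n) ≡ fromℚ (ℚ.1/ qℕ n)
    inv≡ = inv-unique (fromℕ n) (fromℚ (ℚ.1/ qℕ n)) n*1/n≡1

⊛-cancel : ∀ i n x → n ⊛ i ≡ one → i ⊛ (n ⊛ x) ≡ x
⊛-cancel i n x n⊛i≡1 = begin
  i ⊛ (n ⊛ x)   ≡⟨ solve 3 (λ i n x → i :* (n :* x) := (n :* i) :* x) refl i n x ⟩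
  (n ⊛ i) ⊛ x   ≡⟨ cong (_⊛ x) n⊛i≡1 ⟩
  one ⊛ x       ≡⟨ solve 1 (λ x → con 1ℚ :* x := x) refl x ⟩
  x ∎
  where open ≡-Reasoning

Nonneg-cancel : ∀ n x → 1 ≤ n → Nonneg (fromℕ n ⊛ x) → Nonneg x
Nonneg-cancel n x 1≤n nx = subst Nonneg (⊛-cancel (inv (fromℕ n)) (fromℕ n) x (proj₁ (fromℕ-inv n 1≤n)))
  (Nonneg-⊛ (proj₂ (fromℕ-inv n 1≤n)) nx)

Nonneg-φ : Nonneg φ
Nonneg-φ = nonneg (inj₁ (ℚₚ.nonNegative⁻¹ ½ , ℚₚ.nonNegative⁻¹ ½))

Nonneg-φ⁻¹ : Nonneg φ⁻¹
Nonneg-φ⁻¹ = nonneg (irrationalDominant⇒NonNeg (dominant (ℚₚ.nonNegative⁻¹ ½) (ℚₚ.≤ᵇ⇒≤ _)))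

φ⊛φ⁻¹≡1 : φ ⊛ φ⁻¹ ≡ one
φ⊛φ⁻¹≡1 = refl

φ⊖φ⁻¹≡1 : φ ⊖ φ⁻¹ ≡ one
φ⊖φ⁻¹≡1 = refl

√5⊛√5≡5 : √5 ⊛ √5 ≡ fromℕ 5
√5⊛√5≡5 = refl

-- Down-integers

φ⊛fromℕ : ∀ n → φ ⊛ fromℕ n ≡ (½ ℚ.* qℕ n) +√5· (½ ℚ.* qℕ n)
φ⊛fromℕ n = cong₂ _+√5·_
  (S.solve 2 (λ f n → S.con ½ S.:* n S.:+ f S.:* (S.con ½ S.:* S.con 0ℚ) S.:= S.con ½ S.:* n) refl 5ℚ (qℕ n))
  (S.solve 1 (λ n → S.con ½ S.:* S.con 0ℚ S.:+ S.con ½ S.:* n S.:= S.con ½ S.:* n) refl (qℕ n))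
  where module S = ℚ-Solver

-- φ n - w is (n/2 - w) + (n/2) √5, and adding n²/4 - n w to both sides of the hypothesis turns it
-- into (n/2 - w)² ≤ 5 (n/2)², the irrational dominance of this element.
fromℕ≤φ⊛fromℕ : ∀ n w → w * w ≤ n * n + n * w → fromℕ w ≤₅ φ ⊛ fromℕ n
fromℕ≤φ⊛fromℕ n w le = subst (λ z → NonNeg (z ⊖ fromℕ w)) (sym (φ⊛fromℕ n))
  (irrationalDominant⇒NonNeg {½ ℚ.* N ℚ.- W} {½ ℚ.* N ℚ.- 0ℚ} (dominant 0≤ir bound))
  where
    module S = ℚ-Solver
    N = qℕ n
    W = qℕ w
    0≤ir : 0ℚ ℚ.≤ ½ ℚ.* N ℚ.- 0ℚ
    0≤ir = subst (0ℚ ℚ.≤_) (sym (ℚₚ.+-identityʳ (½ ℚ.* N))) (*-nonNeg (ℚₚ.nonNegative⁻¹ ½) (qℕ-nonNeg n))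
    le′ : W ℚ.* W ℚ.≤ N ℚ.* N ℚ.+ N ℚ.* W
    le′ = subst₂ ℚ._≤_ (qℕ-* w w) (trans (qℕ-+ (n * n) (n * w)) (cong₂ ℚ._+_ (qℕ-* n n) (qℕ-* n w))) (qℕ-mono-≤ le)
    bound : (½ ℚ.* N ℚ.- W) ℚ.* (½ ℚ.* N ℚ.- W) ℚ.≤ 5ℚ ℚ.* ((½ ℚ.* N ℚ.- 0ℚ) ℚ.* (½ ℚ.* N ℚ.- 0ℚ))
    bound = subst₂ ℚ._≤_
      (S.solve 2 (λ N W → W S.:* W S.:+ (S.con (½ ℚ.* ½) S.:* N S.:* N S.:- N S.:* W)
         S.:= (S.con ½ S.:* N S.:- W) S.:* (S.con ½ S.:* N S.:- W)) refl N W)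
      (S.solve 2 (λ N W → (N S.:* N S.:+ N S.:* W) S.:+ (S.con (½ ℚ.* ½) S.:* N S.:* N S.:- N S.:* W)
         S.:= S.con 5ℚ S.:* ((S.con ½ S.:* N S.:- S.con 0ℚ) S.:* (S.con ½ S.:* N S.:- S.con 0ℚ))) refl N W)
      (ℚₚ.+-monoˡ-≤ (½ ℚ.* ½ ℚ.* N ℚ.* N ℚ.- N ℚ.* W) le′)

φ⊛fromℕ≤fromℕ : ∀ n v → n * n + n * v ≤ v * v → φ ⊛ fromℕ n ≤₅ fromℕ v
φ⊛fromℕ≤fromℕ n v le = subst (λ z → NonNeg (fromℕ v ⊖ z)) (sym (φ⊛fromℕ n))
  (rationalDominant⇒NonNeg {V ℚ.- ½ ℚ.* N} {0ℚ ℚ.- ½ ℚ.* N} (dominant 0≤re bound))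
  where
    module S = ℚ-Solver
    N = qℕ n
    V = qℕ v
    n≤v : n ≤ v
    n≤v = ≮⇒≥ (λ v<n → <⇒≱ (<-≤-trans (*-mono-< v<n v<n) (m≤m+n (n * n) (n * v))) le)
    0≤re : 0ℚ ℚ.≤ V ℚ.- ½ ℚ.* N
    0≤re = subst (0ℚ ℚ.≤_) (S.solve 2 (λ N V → S.con ½ S.:* N S.:+ (V S.:- N) S.:= V S.:- S.con ½ S.:* N) refl N V)
      (+-nonNeg (*-nonNeg (ℚₚ.nonNegative⁻¹ ½) (qℕ-nonNeg n)) (Nonneg-fromℚ⁻¹ {V ℚ.- N} (fromℕ-mono-≤ n≤v)))
    le′ : N ℚ.* N ℚ.+ N ℚ.* V ℚ.≤ V ℚ.* V
    le′ = subst₂ ℚ._≤_ (trans (qℕ-+ (n * n) (n * v)) (cong₂ ℚ._+_ (qℕ-* n n) (qℕ-* n v))) (qℕ-* v v) (qℕ-mono-≤ le)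
    bound : 5ℚ ℚ.* ((0ℚ ℚ.- ½ ℚ.* N) ℚ.* (0ℚ ℚ.- ½ ℚ.* N)) ℚ.≤ (V ℚ.- ½ ℚ.* N) ℚ.* (V ℚ.- ½ ℚ.* N)
    bound = subst₂ ℚ._≤_
      (S.solve 2 (λ N V → (N S.:* N S.:+ N S.:* V) S.:+ (S.con (½ ℚ.* ½) S.:* N S.:* N S.:- N S.:* V)
         S.:= S.con 5ℚ S.:* ((S.con 0ℚ S.:- S.con ½ S.:* N) S.:* (S.con 0ℚ S.:- S.con ½ S.:* N))) refl N V)
      (S.solve 2 (λ N V → V S.:* V S.:+ (S.con (½ ℚ.* ½) S.:* N S.:* N S.:- N S.:* V)
         S.:= (V S.:- S.con ½ S.:* N) S.:* (V S.:- S.con ½ S.:* N)) refl N V)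
      (ℚₚ.+-monoˡ-≤ (½ ℚ.* ½ ℚ.* N ℚ.* N ℚ.- N ℚ.* V) le′)

-- Supplies the strictness in `IsFloor`: the √5-part of φ n is n/2, that of an integer is 0.
φ⊛fromℕ-irrational : ∀ n → 1 ≤ n → ir (φ ⊛ fromℕ n) ≡ 0ℚ → ⊥
φ⊛fromℕ-irrational n 1≤n eq = contradiction (qℕ-cancel-≤ {n} {0} (ℚₚ.≤-reflexive N≡0)) (<⇒≱ 1≤n)
  where
    module S = ℚ-Solver
    N≡0 : qℕ n ≡ 0ℚ
    N≡0 = begin
      qℕ n                         ≡⟨ S.solve 1 (λ N → N S.:= S.con ½ S.:* N S.:+ S.con ½ S.:* N) refl (qℕ n) ⟩
      ½ ℚ.* qℕ n ℚ.+ ½ ℚ.* qℕ n    ≡⟨ cong (λ z → z ℚ.+ z) (trans (cong ir (sym (φ⊛fromℕ n))) eq) ⟩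
      0ℚ ∎
      where open ≡-Reasoning

IsFloor-φ : ∀ n w → 1 ≤ n → w * w ≤ n * n + n * w → n * n + n * suc w ≤ suc w * suc w →
  IsFloor (φ ⊛ fromℕ n) w
IsFloor-φ n w 1≤n lower upper = fromℕ≤φ⊛fromℕ n w lower , φ⊛fromℕ≤fromℕ n (suc w) upper
  , λ _ → φ⊛fromℕ-irrational n 1≤n

-- (φ n − w)(w + n/φ) = n² + n w − w²
IsFloor-φ⁻¹ : ∀ n w → IsFloor (φ ⊛ fromℕ n) w → w * w ≤ n * n + n * w
IsFloor-φ⁻¹ n w (lower , _) = fromℕ-cancel-≤ (subst Nonneg eq
  (Nonneg-⊛ {φ ⊛ fromℕ n ⊖ fromℕ w} (nonneg lower) (Nonneg-⊕ (Nonneg-fromℕ w) (Nonneg-⊛ Nonneg-φ⁻¹ (Nonneg-fromℕ n)))))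
  where
    N = fromℕ n
    W = fromℕ w
    expand : ∀ p q N W → (p ⊛ N ⊖ W) ⊛ (W ⊕ q ⊛ N) ≡ (p ⊛ q) ⊛ (N ⊛ N) ⊕ (p ⊖ q) ⊛ (N ⊛ W) ⊖ W ⊛ W
    expand = solve 4 (λ p q N W → (p :* N :- W) :* (W :+ q :* N)
      := (p :* q) :* (N :* N) :+ (p :- q) :* (N :* W) :- W :* W) refl
    unit : ∀ N W → one ⊛ (N ⊛ N) ⊕ one ⊛ (N ⊛ W) ⊖ W ⊛ W ≡ N ⊛ N ⊕ N ⊛ W ⊖ W ⊛ W
    unit = solve 2 (λ N W → con 1ℚ :* (N :* N) :+ con 1ℚ :* (N :* W) :- W :* W := N :* N :+ N :* W :- W :* W) refl
    eq : (φ ⊛ N ⊖ W) ⊛ (W ⊕ φ⁻¹ ⊛ N) ≡ fromℕ (n * n + n * w) ⊖ fromℕ (w * w)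
    eq = begin
      (φ ⊛ N ⊖ W) ⊛ (W ⊕ φ⁻¹ ⊛ N)
        ≡⟨ expand φ φ⁻¹ N W ⟩
      (φ ⊛ φ⁻¹) ⊛ (N ⊛ N) ⊕ (φ ⊖ φ⁻¹) ⊛ (N ⊛ W) ⊖ W ⊛ W
        ≡⟨ cong₂ (λ u v → u ⊛ (N ⊛ N) ⊕ v ⊛ (N ⊛ W) ⊖ W ⊛ W) φ⊛φ⁻¹≡1 φ⊖φ⁻¹≡1 ⟩
      one ⊛ (N ⊛ N) ⊕ one ⊛ (N ⊛ W) ⊖ W ⊛ W
        ≡⟨ unit N W ⟩
      N ⊛ N ⊕ N ⊛ W ⊖ W ⊛ W
        ≡⟨ sym (cong₂ _⊖_ (trans (fromℕ-+ (n * n) (n * w)) (cong₂ _⊕_ (fromℕ-* n n) (fromℕ-* n w))) (fromℕ-* w w)) ⟩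
      fromℕ (n * n + n * w) ⊖ fromℕ (w * w) ∎
      where open ≡-Reasoning

-- The form x² + x y − y² changes sign at every step of a Fibonacci walk.
walk-form-step : ∀ {x y u v} → y * y + u ≡ x * x + x * y + v →
  (y + x) * (y + x) + v ≡ y * y + y * (y + x) + u
walk-form-step {x} {y} {u} {v} eq = +-cancelʳ-≡ _ _ _ (begin
  (y + x) * (y + x) + v + y * y      ≡⟨ lem x y v ⟩
  x * x + x * y + v + (y * y + y * (y + x))  ≡⟨ cong (_+ (y * y + y * (y + x))) (sym eq) ⟩
  y * y + u + (y * y + y * (y + x))  ≡⟨ lem′ x y u ⟩
  y * y + y * (y + x) + u + y * y ∎)
  where
    open ≡-Reasoning
    lem : ∀ x y v → (y + x) * (y + x) + v + y * y ≡ x * x + x * y + v + (y * y + y * (y + x))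
    lem = solve-∀
    lem′ : ∀ x y u → y * y + u + (y * y + y * (y + x)) ≡ y * y + y * (y + x) + u + y * y
    lem′ = solve-∀

walk-form : ∀ a b i → let w = walk a b in
  w (2 + double i) * w (2 + double i) + (a * a + a * b)
    ≡ w (1 + double i) * w (1 + double i) + w (1 + double i) * w (2 + double i) + b * b
  × w (3 + double i) * w (3 + double i) + b * b
    ≡ w (2 + double i) * w (2 + double i) + w (2 + double i) * w (3 + double i) + (a * a + a * b)
walk-form a b zero = start , walk-form-step {a} {b} start
  where
    start : b * b + (a * a + a * b) ≡ a * a + a * b + b * b
    start = +-comm (b * b) _
walk-form a b (suc i) with walk-form a b i
... | _ , eq = let eq′ = walk-form-step {walk a b (2 + double i)} {walk a b (3 + double i)} eq in
  eq′ , walk-form-step {walk a b (3 + double i)} {walk a b (4 + double i)} eq′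

Canonical-odd⇒Down : ∀ {m a b} i → Canonical m (suc (double i)) a b → Down m
Canonical-odd⇒Down {m} {a} {b} i c@(canonical 1≤b b≤a a≤fib value) =
  2≤m , 2 + e , a , b , Canonical⇒IsSMax c , 1≤a , 1≤b , walk≡m
  , IsFloor-φ m w′ (≤-trans (s≤s z≤n) 2≤m) lower upper
  where
    e = suc (double i)
    w′ = walk a b (3 + e)
    1≤a = ≤-trans 1≤b b≤a
    walk≡m : walk a b (2 + e) ≡ m
    walk≡m = trans (walk-fib a b e) value
    2≤m : 2 ≤ m
    2≤m = subst (2 ≤_) value (+-mono-≤ (*-mono-≤ 1≤a (fib-pos (double i))) (*-mono-≤ 1≤b (fib-pos e)))
    form : w′ * w′ + (a * a + a * b) ≡ m * m + m * w′ + b * b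
    form = subst (λ z → w′ * w′ + (a * a + a * b) ≡ z * z + z * w′ + b * b) walk≡m (proj₁ (walk-form a b (suc i)))
    open ≤-Reasoning
    lower : w′ * w′ ≤ m * m + m * w′
    lower = +-cancelʳ-≤ (b * b) _ _ (begin
      w′ * w′ + b * b            ≤⟨ +-monoʳ-≤ (w′ * w′) (≤-trans (*-mono-≤ b≤a b≤a) (m≤m+n (a * a) (a * b))) ⟩
      w′ * w′ + (a * a + a * b)  ≡⟨ form ⟩
      m * m + m * w′ + b * b     ∎)
    -- By `form`, (w′ + 1)² - m² - m (w′ + 1) equals 2 w′ + 1 + b² - (a² + a b + m), so this
    -- inequality puts w′ + 1 above φ m. It is the place where a ≤ F_{e+1} is used.
    gap : a * a + a * b + m ≤ 2 * w′
    gap = begin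
      a * a + a * b + m
        ≡⟨ cong₂ _+_ (lem a b) (sym value) ⟩
      (a + b) * a + (a * fib e + b * fib (suc e))
        ≤⟨ +-mono-≤ (*-monoʳ-≤ (a + b) a≤fib) (+-mono-≤ (*-monoʳ-≤ a (fib≤fib-suc e)) (*-monoʳ-≤ b (fib≤fib-suc (suc e)))) ⟩
      (a + b) * fib (suc e) + (a * fib (suc e) + b * fib (2 + e))
        ≡⟨ lem′ a b (fib (suc e)) (fib (2 + e)) ⟩
      2 * (a * fib (suc e)) + (b * fib (suc e) + b * fib (2 + e))
        ≤⟨ +-monoʳ-≤ (2 * (a * fib (suc e))) (+-monoˡ-≤ (b * fib (2 + e)) (*-monoʳ-≤ b (fib≤fib-suc (suc e)))) ⟩
      2 * (a * fib (suc e)) + (b * fib (2 + e) + b * fib (2 + e))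
        ≡⟨ lem″ a b (fib (suc e)) (fib (2 + e)) ⟩
      2 * (a * fib (suc e) + b * fib (2 + e))
        ≡⟨ cong (2 *_) (sym (walk-fib a b (suc e))) ⟩
      2 * w′ ∎
      where
        lem : ∀ a b → a * a + a * b ≡ (a + b) * a
        lem = solve-∀
        lem′ : ∀ a b p q → (a + b) * p + (a * p + b * q) ≡ 2 * (a * p) + (b * p + b * q)
        lem′ = solve-∀
        lem″ : ∀ a b p q → 2 * (a * p) + (b * q + b * q) ≡ 2 * (a * p + b * q)
        lem″ = solve-∀
    upper : m * m + m * suc w′ ≤ suc w′ * suc w′
    upper = +-cancelʳ-≤ (b * b) _ _ (begin
      m * m + m * suc w′ + b * b          ≡⟨ lem m w′ (b * b) ⟩
      m * m + m * w′ + b * b + m          ≡⟨ cong (_+ m) (sym form) ⟩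
      w′ * w′ + (a * a + a * b) + m       ≡⟨ +-assoc (w′ * w′) _ m ⟩
      w′ * w′ + (a * a + a * b + m)       ≤⟨ +-monoʳ-≤ (w′ * w′) gap ⟩
      w′ * w′ + 2 * w′                    ≤⟨ m≤m+n _ (1 + b * b) ⟩
      w′ * w′ + 2 * w′ + (1 + b * b)      ≡⟨ lem′ w′ (b * b) ⟩
      suc w′ * suc w′ + b * b             ∎)
      where
        lem : ∀ m w c → m * m + m * suc w + c ≡ m * m + m * w + c + m
        lem = solve-∀
        lem′ : ∀ w c → w * w + 2 * w + (1 + c) ≡ suc w * suc w + c
        lem′ = solve-∀

-- If a < b, prepending b - a would give a walk that reaches m one position later.
slow-walk-descends : ∀ {m s a b} → IsSMax m (2 + s) → 1 ≤ a → walk a b (2 + s) ≡ m → b ≤ a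
slow-walk-descends {m} {s} {a} {b} (_ , max) 1≤a eq = ≮⇒≥ λ a<b →
  <⇒≱ ≤-refl (max (3 + s) (s≤s z≤n , b ∸ a , a , m<n⇒0<n∸m a<b , 1≤a ,
    trans (walk-tail (b ∸ a) a (suc s)) (trans (cong (λ z → walk a z (2 + s)) (m+[n∸m]≡n (<⇒≤ a<b))) eq)))

even-form-large : ∀ a b m w → 1 ≤ a → 1 ≤ b → b ≤ a →
  w * w + b * b ≡ m * m + m * w + (a * a + a * b) → ¬ w * w ≤ m * m + m * w
even-form-large a b m w 1≤a 1≤b b≤a form le = <⇒≱ (≤-reflexive (+-comm 1 (b * b))) (+-cancelˡ-≤ (w * w) _ _ (begin
  w * w + (b * b + 1)              ≤⟨ +-monoʳ-≤ (w * w) (+-mono-≤ (*-mono-≤ b≤a b≤a) (*-mono-≤ 1≤a 1≤b)) ⟩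
  w * w + (a * a + a * b)          ≤⟨ +-monoˡ-≤ _ le ⟩
  m * m + m * w + (a * a + a * b)  ≡⟨ sym form ⟩
  w * w + b * b                    ∎))
  where open ≤-Reasoning

even-walk-large : ∀ i {m a b} → IsSMax m (2 + double i) → 1 ≤ a → 1 ≤ b → walk a b (2 + double i) ≡ m →
  ¬ walk a b (3 + double i) * walk a b (3 + double i) ≤ m * m + m * walk a b (3 + double i)
even-walk-large i {m} {a} {b} smax 1≤a 1≤b eq = even-form-large a b m w 1≤a 1≤b (slow-walk-descends smax 1≤a eq)
  (subst (λ z → w * w + b * b ≡ z * z + z * w + (a * a + a * b)) eq (proj₂ (walk-form a b i)))
  where w = walk a b (3 + double i)

-- A down-integer may be witnessed by any slow walk, not only by the canonical one. Every slow walk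
-- has b ≤ a, and this already gives a² + a b - b² > 0, hence w_{s+1} > φ m for even e.
Canonical-even⇒¬Down : ∀ {m a b} i → Canonical m (double i) a b → ¬ Down m
Canonical-even⇒¬Down {m} i c (_ , s , a , b , smax , 1≤a , 1≤b , eq , floor) =
  subst (λ s → IsSMax m s → walk a b s ≡ m → ¬ walk a b (suc s) * walk a b (suc s) ≤ m * m + m * walk a b (suc s))
    (IsSMax-unique (Canonical⇒IsSMax c) smax) (λ smax eq → even-walk-large i smax 1≤a 1≤b eq)
    smax eq (IsFloor-φ⁻¹ m (walk a b (suc s)) floor)

Parity-elim : ∀ {p} (P : ℕ → Set p) → (∀ i → P (double i)) → (∀ i → P (suc (double i))) → ∀ n → P n
Parity-elim P pe po n with parityView n
... | even i = pe i
... | odd i = po i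

class-Down : ∀ m M → 1 ≤ m → m < M → (Down m → class 1 M m ≡ 1) × (¬ Down m → class 1 M m ≡ 0)
class-Down m M 1≤m m<M =
  let e , a , b , c = Canonical-exists m 1≤m in
  Parity-elim (λ e → Canonical m e a b → (Down m → class 1 M m ≡ 1) × (¬ Down m → class 1 M m ≡ 0))
    (λ i c → (λ d → contradiction d (Canonical-even⇒¬Down i c)) , λ _ → proj₂ (class-even i M m<M c))
    (λ i c → (λ _ → proj₂ (class-odd i M m<M c)) , λ ¬d → contradiction (Canonical-odd⇒Down i c) ¬d)
    e c

-- The cardinality of D up to n

∣∣≡sum< : ∀ {n} (S : Subset n) (f : ℕ → ℕ) →
  (∀ i → i ∈ S → f (toℕ i) ≡ 1) → (∀ i → ¬ i ∈ S → f (toℕ i) ≡ 0) → ∣ S ∣ ≡ sum< n f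
∣∣≡sum< [] f f∈ f∉ = refl
∣∣≡sum< (inside ∷ S) f f∈ f∉ = cong₂ _+_ (sym (f∈ zero here))
  (∣∣≡sum< S (λ i → f (suc i)) (λ i i∈ → f∈ (suc i) (there i∈)) (λ i i∉ → f∉ (suc i) (λ { (there i∈) → i∉ i∈ })))
∣∣≡sum< (outside ∷ S) f f∈ f∉ = cong₂ _+_ (sym (f∉ zero (λ ())))
  (∣∣≡sum< S (λ i → f (suc i)) (λ i i∈ → f∈ (suc i) (there i∈)) (λ i i∉ → f∉ (suc i) (λ { (there i∈) → i∉ i∈ })))

∣D∣≡stepSum-1 : ∀ n M (S : Subset n) → RepresentsD n S → n < M →
  ∣ S ∣ ≡ stepSum 1 M (λ e → cell e (λ x → hit x n))
∣D∣≡stepSum-1 n M S rep n<M = trans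
  (∣∣≡sum< S (λ m → class 1 M (suc m))
    (λ i i∈S → proj₁ (cd i) (Equivalence.to (rep i) i∈S))
    (λ i i∉S → proj₂ (cd i) (λ d → i∉S (Equivalence.from (rep i) d))))
  (sym (stepSum-hit 1 M n))
  where
    cd : ∀ i → (Down (suc (toℕ i)) → class 1 M (suc (toℕ i)) ≡ 1) × (¬ Down (suc (toℕ i)) → class 1 M (suc (toℕ i)) ≡ 0)
    cd i = class-Down (suc (toℕ i)) M (s≤s z≤n) (≤-<-trans (toℕ<n i) n<M)

stepSum-0+stepSum-1 : ∀ n M → n < M →
  stepSum 0 M (λ e → cell e (λ x → hit x n)) + stepSum 1 M (λ e → cell e (λ x → hit x n)) ≡ n
stepSum-0+stepSum-1 n M n<M = begin
  stepSum 0 M (λ e → cell e (λ x → hit x n)) + stepSum 1 M (λ e → cell e (λ x → hit x n))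
    ≡⟨ cong₂ _+_ (stepSum-hit 0 M n) (stepSum-hit 1 M n) ⟩
  sum< n (λ m → class 0 M (suc m)) + sum< n (λ m → class 1 M (suc m))
    ≡⟨ sym (sum<-+ n (λ m → class 0 M (suc m)) (λ m → class 1 M (suc m))) ⟩
  sum< n (λ m → class 0 M (suc m) + class 1 M (suc m))
    ≡⟨ sum<-1 n (λ m m<n → class-0+class-1 (suc m) M (s≤s z≤n) (≤-<-trans m<n n<M)) ⟩
  n ∎
  where open ≡-Reasoning

-- Comparison with the main term

pow-φ-rec : ∀ k → powℕ φ (2 + k) ≡ powℕ φ (suc k) ⊕ powℕ φ k
pow-φ-rec k = trans (assoc φ φ v) (trans (cong (_⊛ v) φ²) (distr φ v))
  where
    v = powℕ φ k
    φ² : φ ⊛ φ ≡ φ ⊕ one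
    φ² = refl
    assoc : ∀ x y z → x ⊛ (y ⊛ z) ≡ (x ⊛ y) ⊛ z
    assoc = solve 3 (λ x y z → x :* (y :* z) := (x :* y) :* z) refl
    distr : ∀ x z → (x ⊕ one) ⊛ z ≡ x ⊛ z ⊕ z
    distr = solve 2 (λ x z → (x :+ con 1ℚ) :* z := x :* z :+ z) refl

pow-φ⁻¹-rec : ∀ k → powℕ φ⁻¹ (2 + k) ≡ powℕ φ⁻¹ k ⊖ powℕ φ⁻¹ (suc k)
pow-φ⁻¹-rec k = trans (assoc φ⁻¹ φ⁻¹ u) (trans (cong (_⊛ u) φ⁻²) (distr φ⁻¹ u))
  where
    u = powℕ φ⁻¹ k
    φ⁻² : φ⁻¹ ⊛ φ⁻¹ ≡ one ⊖ φ⁻¹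
    φ⁻² = refl
    assoc : ∀ x y z → x ⊛ (y ⊛ z) ≡ (x ⊛ y) ⊛ z
    assoc = solve 3 (λ x y z → x :* (y :* z) := (x :* y) :* z) refl
    distr : ∀ x z → (one ⊖ x) ⊛ z ≡ z ⊖ x ⊛ z
    distr = solve 2 (λ x z → (con 1ℚ :- x) :* z := z :- x :* z) refl

pow-φ-inverse : ∀ k → powℕ φ k ⊛ powℕ φ⁻¹ k ≡ one
pow-φ-inverse zero = refl
pow-φ-inverse (suc k) = trans (interchange φ (powℕ φ k) φ⁻¹ (powℕ φ⁻¹ k))
  (cong₂ _⊛_ φ⊛φ⁻¹≡1 (pow-φ-inverse k))
  where
    interchange : ∀ a b c d → (a ⊛ b) ⊛ (c ⊛ d) ≡ (a ⊛ c) ⊛ (b ⊛ d)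
    interchange = solve 4 (λ a b c d → (a :* b) :* (c :* d) := (a :* c) :* (b :* d)) refl

-- `φ⁻¹` is minus the conjugate of φ, so the sign in Binet's formula alternates with the parity of
-- the exponent.
binet-fib : ∀ i →
  powℕ φ (double i) ⊖ powℕ φ⁻¹ (double i) ≡ √5 ⊛ fromℕ (fib (double i)) ×
  powℕ φ (suc (double i)) ⊕ powℕ φ⁻¹ (suc (double i)) ≡ √5 ⊛ fromℕ (fib (suc (double i)))
binet-fib zero = refl , refl
binet-fib (suc i) = ev , od
  where
    k = double i
    v₀ = powℕ φ k
    v₁ = powℕ φ (suc k)
    u₀ = powℕ φ⁻¹ k
    u₁ = powℕ φ⁻¹ (suc k)
    f₀ = fromℕ (fib k)
    f₁ = fromℕ (fib (suc k))
    open ≡-Reasoning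
    sum : ∀ m n → √5 ⊛ fromℕ m ⊕ √5 ⊛ fromℕ n ≡ √5 ⊛ fromℕ (m + n)
    sum m n = trans (factor √5 (fromℕ m) (fromℕ n)) (cong (√5 ⊛_) (sym (fromℕ-+ m n)))
      where
        factor : ∀ s a b → s ⊛ a ⊕ s ⊛ b ≡ s ⊛ (a ⊕ b)
        factor = solve 3 (λ s a b → s :* a :+ s :* b := s :* (a :+ b)) refl
    ev : powℕ φ (2 + k) ⊖ powℕ φ⁻¹ (2 + k) ≡ √5 ⊛ fromℕ (fib (2 + k))
    ev = begin
      powℕ φ (2 + k) ⊖ powℕ φ⁻¹ (2 + k)  ≡⟨ cong₂ _⊖_ (pow-φ-rec k) (pow-φ⁻¹-rec k) ⟩
      (v₁ ⊕ v₀) ⊖ (u₀ ⊖ u₁)              ≡⟨ lem v₁ v₀ u₀ u₁ ⟩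
      (v₁ ⊕ u₁) ⊕ (v₀ ⊖ u₀)              ≡⟨ cong₂ _⊕_ (proj₂ (binet-fib i)) (proj₁ (binet-fib i)) ⟩
      √5 ⊛ f₁ ⊕ √5 ⊛ f₀                  ≡⟨ sum (fib (suc k)) (fib k) ⟩
      √5 ⊛ fromℕ (fib (2 + k)) ∎
      where
        lem : ∀ a b c d → (a ⊕ b) ⊖ (c ⊖ d) ≡ (a ⊕ d) ⊕ (b ⊖ c)
        lem = solve 4 (λ a b c d → (a :+ b) :- (c :- d) := (a :+ d) :+ (b :- c)) refl
    od : powℕ φ (3 + k) ⊕ powℕ φ⁻¹ (3 + k) ≡ √5 ⊛ fromℕ (fib (3 + k))
    od = begin
      powℕ φ (3 + k) ⊕ powℕ φ⁻¹ (3 + k)  ≡⟨ cong₂ _⊕_ (pow-φ-rec (suc k)) (pow-φ⁻¹-rec (suc k)) ⟩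
      (powℕ φ (2 + k) ⊕ v₁) ⊕ (u₁ ⊖ powℕ φ⁻¹ (2 + k))
                                         ≡⟨ lem (powℕ φ (2 + k)) v₁ u₁ (powℕ φ⁻¹ (2 + k)) ⟩
      (powℕ φ (2 + k) ⊖ powℕ φ⁻¹ (2 + k)) ⊕ (v₁ ⊕ u₁)
                                         ≡⟨ cong₂ _⊕_ ev (proj₂ (binet-fib i)) ⟩
      √5 ⊛ fromℕ (fib (2 + k)) ⊕ √5 ⊛ f₁ ≡⟨ sum (fib (2 + k)) (fib (suc k)) ⟩
      √5 ⊛ fromℕ (fib (3 + k)) ∎
      where
        lem : ∀ a b c d → (a ⊕ b) ⊕ (c ⊖ d) ≡ (a ⊖ d) ⊕ (b ⊕ c)
        lem = solve 4 (λ a b c d → (a :+ b) :+ (c :- d) := (a :- d) :+ (b :+ c)) refl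

binet-lucas : ∀ i →
  powℕ φ (double i) ⊕ powℕ φ⁻¹ (double i) ≡ fromℕ (lucas (double i)) ×
  powℕ φ (suc (double i)) ⊖ powℕ φ⁻¹ (suc (double i)) ≡ fromℕ (lucas (suc (double i)))
binet-lucas zero = refl , refl
binet-lucas (suc i) = ev , od
  where
    k = double i
    v₀ = powℕ φ k
    v₁ = powℕ φ (suc k)
    u₀ = powℕ φ⁻¹ k
    u₁ = powℕ φ⁻¹ (suc k)
    open ≡-Reasoning
    ev : powℕ φ (2 + k) ⊕ powℕ φ⁻¹ (2 + k) ≡ fromℕ (lucas (2 + k))
    ev = begin
      powℕ φ (2 + k) ⊕ powℕ φ⁻¹ (2 + k)  ≡⟨ cong₂ _⊕_ (pow-φ-rec k) (pow-φ⁻¹-rec k) ⟩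
      (v₁ ⊕ v₀) ⊕ (u₀ ⊖ u₁)              ≡⟨ lem v₁ v₀ u₀ u₁ ⟩
      (v₁ ⊖ u₁) ⊕ (v₀ ⊕ u₀)              ≡⟨ cong₂ _⊕_ (proj₂ (binet-lucas i)) (proj₁ (binet-lucas i)) ⟩
      fromℕ (lucas (suc k)) ⊕ fromℕ (lucas k) ≡⟨ sym (fromℕ-+ (lucas (suc k)) (lucas k)) ⟩
      fromℕ (lucas (2 + k)) ∎
      where
        lem : ∀ a b c d → (a ⊕ b) ⊕ (c ⊖ d) ≡ (a ⊖ d) ⊕ (b ⊕ c)
        lem = solve 4 (λ a b c d → (a :+ b) :+ (c :- d) := (a :- d) :+ (b :+ c)) refl
    od : powℕ φ (3 + k) ⊖ powℕ φ⁻¹ (3 + k) ≡ fromℕ (lucas (3 + k))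
    od = begin
      powℕ φ (3 + k) ⊖ powℕ φ⁻¹ (3 + k)  ≡⟨ cong₂ _⊖_ (pow-φ-rec (suc k)) (pow-φ⁻¹-rec (suc k)) ⟩
      (powℕ φ (2 + k) ⊕ v₁) ⊖ (u₁ ⊖ powℕ φ⁻¹ (2 + k))
                                         ≡⟨ lem (powℕ φ (2 + k)) v₁ u₁ (powℕ φ⁻¹ (2 + k)) ⟩
      (powℕ φ (2 + k) ⊕ powℕ φ⁻¹ (2 + k)) ⊕ (v₁ ⊖ u₁)
                                         ≡⟨ cong₂ _⊕_ ev (proj₂ (binet-lucas i)) ⟩
      fromℕ (lucas (2 + k)) ⊕ fromℕ (lucas (suc k)) ≡⟨ sym (fromℕ-+ (lucas (2 + k)) (lucas (suc k))) ⟩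
      fromℕ (lucas (3 + k)) ∎
      where
        lem : ∀ a b c d → (a ⊕ b) ⊖ (c ⊖ d) ≡ (a ⊕ d) ⊕ (b ⊖ c)
        lem = solve 4 (λ a b c d → (a :+ b) :- (c :- d) := (a :+ d) :+ (b :- c)) refl

Nonneg-one : Nonneg one
Nonneg-one = Nonneg-fromℕ 1

Nonneg-pow : ∀ {x} → Nonneg x → ∀ k → Nonneg (powℕ x k)
Nonneg-pow nx zero = Nonneg-one
Nonneg-pow nx (suc k) = Nonneg-⊛ nx (Nonneg-pow nx k)

pow-φ⁻¹≤1 : ∀ k → Nonneg (one ⊖ powℕ φ⁻¹ k)
pow-φ⁻¹≤1 zero = Nonneg-fromℕ 0
pow-φ⁻¹≤1 (suc k) = subst Nonneg (lem φ⁻¹ (powℕ φ⁻¹ k))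
  (Nonneg-⊕ {one ⊖ φ⁻¹} (nonneg (rationalDominant⇒NonNeg (dominant (ℚₚ.≤ᵇ⇒≤ _) (ℚₚ.≤ᵇ⇒≤ _))))
    (Nonneg-⊛ Nonneg-φ⁻¹ (pow-φ⁻¹≤1 k)))
  where
    lem : ∀ x u → (one ⊖ x) ⊕ x ⊛ (one ⊖ u) ≡ one ⊖ x ⊛ u
    lem = solve 2 (λ x u → (con 1ℚ :- x) :+ x :* (con 1ℚ :- u) := con 1ℚ :- x :* u) refl

pow-φ-mono : ∀ k → Nonneg (powℕ φ (suc k) ⊖ powℕ φ k)
pow-φ-mono k = subst Nonneg (lem φ (powℕ φ k)) (Nonneg-⊛ {φ ⊖ one} Nonneg-φ⁻¹ (Nonneg-pow Nonneg-φ k))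
  where
    lem : ∀ x v → (x ⊖ one) ⊛ v ≡ x ⊛ v ⊖ v
    lem = solve 2 (λ x v → (x :- con 1ℚ) :* v := x :* v :- v) refl

-- Passing between 5 n, a power of φ, a Lucas number and 5 F_k F_{k+1} costs at most 1 for Binet's
-- formula and 1 for `5fibfib≈lucas`. A slack of 2 is less than 5 and disappears on division, so the
-- thresholds for n come out exactly.
5*-cancel-≤+2 : ∀ a b → 5 * a ≤ 5 * b + 2 → a ≤ b
5*-cancel-≤+2 a b le = ≮⇒≥ λ b<a → contradiction
  (+-cancelˡ-≤ (5 * b) 5 2 (≤-trans (≤-reflexive (trans (+-comm (5 * b) 5) (sym (*-suc 5 b)))) (≤-trans (*-monoʳ-≤ 5 b<a) le)))
  (λ { (s≤s (s≤s ())) })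

fib*5fib : ∀ k → fib k * (5 * fib (suc k)) ≡ 5 * (fib k * fib (suc k))
fib*5fib k = lem (fib k) (fib (suc k))
  where
    lem : ∀ a b → a * (5 * b) ≡ 5 * (a * b)
    lem = solve-∀

pow-φ≤5n⇒fib*fib≤n : ∀ j n → Nonneg (fromℕ 5 ⊛ fromℕ n ⊖ powℕ φ (suc (double j))) → fib j * fib (suc j) ≤ n
pow-φ≤5n⇒fib*fib≤n j n le = 5*-cancel-≤+2 _ n (begin
  5 * (fib j * fib (suc j))    ≡⟨ sym (fib*5fib j) ⟩
  fib j * (5 * fib (suc j))    ≤⟨ proj₁ (5fibfib≈lucas j) ⟩
  lucas (suc (double j)) + 1   ≤⟨ +-mono-≤ l≤5n (s≤s z≤n) ⟩
  5 * n + 2 ∎)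
  where
    open ≤-Reasoning
    l≤5n : lucas (suc (double j)) ≤ 5 * n
    l≤5n = fromℕ-cancel-≤ (subst Nonneg (trans (lem (fromℕ 5 ⊛ fromℕ n) (powℕ φ (suc (double j))) (powℕ φ⁻¹ (suc (double j))))
        (cong₂ _⊖_ (sym (fromℕ-* 5 n)) (proj₂ (binet-lucas j))))
      (Nonneg-⊕ le (Nonneg-pow Nonneg-φ⁻¹ (suc (double j)))))
      where
        lem : ∀ a v u → (a ⊖ v) ⊕ u ≡ a ⊖ (v ⊖ u)
        lem = solve 3 (λ a v u → (a :- v) :+ u := a :- (v :- u)) refl

5n≤pow-φ⇒n≤fib*fib : ∀ k n → Nonneg (powℕ φ (suc (double k)) ⊖ fromℕ 5 ⊛ fromℕ n) → n ≤ fib k * fib (suc k)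
5n≤pow-φ⇒n≤fib*fib k n le = 5*-cancel-≤+2 n _ (begin
  5 * n                              ≤⟨ 5n≤l+1 ⟩
  lucas (suc (double k)) + 1         ≤⟨ +-monoˡ-≤ 1 (proj₂ (5fibfib≈lucas k)) ⟩
  fib k * (5 * fib (suc k)) + 1 + 1  ≡⟨ +-assoc _ 1 1 ⟩
  fib k * (5 * fib (suc k)) + 2      ≡⟨ cong (_+ 2) (fib*5fib k) ⟩
  5 * (fib k * fib (suc k)) + 2 ∎)
  where
    open ≤-Reasoning
    5n≤l+1 : 5 * n ≤ lucas (suc (double k)) + 1
    5n≤l+1 = fromℕ-cancel-≤ (subst Nonneg (trans (lem (fromℕ 5 ⊛ fromℕ n) (powℕ φ (suc (double k))) (powℕ φ⁻¹ (suc (double k))))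
        (cong₂ _⊖_ (trans (cong (_⊕ one) (proj₂ (binet-lucas k))) (sym (fromℕ-+ (lucas (suc (double k))) 1))) (sym (fromℕ-* 5 n))))
      (Nonneg-⊕ le (pow-φ⁻¹≤1 (suc (double k)))))
      where
        lem : ∀ a v u → (v ⊖ a) ⊕ (one ⊖ u) ≡ ((v ⊖ u) ⊕ one) ⊖ a
        lem = solve 3 (λ a v u → (v :- a) :+ (con 1ℚ :- u) := ((v :- u) :+ con 1ℚ) :- a) refl

-- The hypothesis gives n φ^(-k) ≤ φ / 5 ≤ 1. This bounds the error 5 (n u)² that arises when F_{2k}
-- is replaced by φ^(2k) / √5.
n⊛pow-φ⁻¹≤1 : ∀ k n → Nonneg (powℕ φ (suc k) ⊖ fromℕ 5 ⊛ fromℕ n) → Nonneg (one ⊖ fromℕ n ⊛ powℕ φ⁻¹ k)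
n⊛pow-φ⁻¹≤1 k n le = Nonneg-cancel 5 _ (s≤s z≤n) (subst Nonneg
  (trans (cong (λ z → (φ ⊛ z ⊖ (fromℕ 5 ⊛ fromℕ n) ⊛ u) ⊕ (fromℕ 5 ⊖ φ)) (pow-φ-inverse k)) (lem′ φ (fromℕ n) u))
  (subst (λ z → Nonneg (z ⊕ (fromℕ 5 ⊖ φ))) (lem φ (powℕ φ k) (fromℕ 5 ⊛ fromℕ n) u)
    (Nonneg-⊕ (Nonneg-⊛ le (Nonneg-pow Nonneg-φ⁻¹ k)) φ≤5)))
  where
    u = powℕ φ⁻¹ k
    φ≤5 : Nonneg (fromℕ 5 ⊖ φ)
    φ≤5 = nonneg (rationalDominant⇒NonNeg (dominant (ℚₚ.≤ᵇ⇒≤ _) (ℚₚ.≤ᵇ⇒≤ _)))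
    lem : ∀ x v a u → (x ⊛ v ⊖ a) ⊛ u ≡ x ⊛ (v ⊛ u) ⊖ a ⊛ u
    lem = solve 4 (λ x v a u → (x :* v :- a) :* u := x :* (v :* u) :- a :* u) refl
    lem′ : ∀ x n u → (x ⊛ one ⊖ (fromℕ 5 ⊛ n) ⊛ u) ⊕ (fromℕ 5 ⊖ x) ≡ fromℕ 5 ⊛ (one ⊖ n ⊛ u)
    lem′ = solve 3 (λ x n u → (x :* con 1ℚ :- (con 5ℚ :* n) :* u) :+ (con 5ℚ :- x)
      := con 5ℚ :* (con 1ℚ :- n :* u)) refl

fifth fiftieth : Q5
fifth = fromℚ (1ℚ ℚ.÷ qℕ 5)
fiftieth = fromℚ (1ℚ ℚ.÷ qℕ 50)

-- n times the main term of the density is s n² u / 2 + s v / 50 for s = √5, u = φ⁻²ᵏ, v = φ²ᵏ.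
deviation : Q5 → Q5 → Q5 → Q5 → Q5 → Q5
deviation s n u v x = x ⊖ (half ⊛ s ⊛ (n ⊛ n) ⊛ u ⊕ fiftieth ⊛ s ⊛ v)

-- Multiplied by 10 F, the main term contains s only in the combination s F = v - u. Then v u = 1
-- and (v - u)² = 5 F² turn it into the integer 5 n² + F² up to the bounded terms 5 (n u)² and (1 -
-- u²) / 5.
deviation-scaled : ∀ s n u v x F → s ⊛ F ≡ v ⊖ u → v ⊛ u ≡ one → s ⊛ s ≡ fromℕ 5 →
  fromℕ 10 ⊛ F ⊛ deviation s n u v x ≡
    (fromℕ 10 ⊛ x ⊛ F ⊖ (fromℕ 5 ⊛ (n ⊛ n) ⊕ F ⊛ F)) ⊕ fromℕ 5 ⊛ ((n ⊛ u) ⊛ (n ⊛ u)) ⊖ fifth ⊛ (one ⊖ u ⊛ u)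
deviation-scaled s n u v x F sF≡ vu≡1 ss≡5 = begin
  fromℕ 10 ⊛ F ⊛ deviation s n u v x
    ≡⟨ solve 6 (λ s n u v x F → con (qℕ 10) :* F :* (x :- (con (1ℚ ℚ.÷ qℕ 2) :* s :* (n :* n) :* u :+ con (1ℚ ℚ.÷ qℕ 50) :* s :* v))
         := con (qℕ 10) :* x :* F :- (con 5ℚ :* (s :* F) :* (n :* n) :* u :+ con (1ℚ ℚ.÷ qℕ 5) :* (s :* F) :* v)) refl s n u v x F ⟩
  a ⊖ (fromℕ 5 ⊛ (s ⊛ F) ⊛ (n ⊛ n) ⊛ u ⊕ fifth ⊛ (s ⊛ F) ⊛ v)
    ≡⟨ cong (λ z → a ⊖ (fromℕ 5 ⊛ z ⊛ (n ⊛ n) ⊛ u ⊕ fifth ⊛ z ⊛ v)) sF≡ ⟩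
  a ⊖ (fromℕ 5 ⊛ (v ⊖ u) ⊛ (n ⊛ n) ⊛ u ⊕ fifth ⊛ (v ⊖ u) ⊛ v)
    ≡⟨ solve 4 (λ a n u v → a :- (con 5ℚ :* (v :- u) :* (n :* n) :* u :+ con (1ℚ ℚ.÷ qℕ 5) :* (v :- u) :* v)
         := a :- (con 5ℚ :* (v :* u) :* (n :* n) :- con 5ℚ :* ((n :* u) :* (n :* u))
              :+ con (1ℚ ℚ.÷ qℕ 5) :* ((v :- u) :* (v :- u) :+ v :* u :- u :* u))) refl a n u v ⟩
  a ⊖ (fromℕ 5 ⊛ (v ⊛ u) ⊛ (n ⊛ n) ⊖ fromℕ 5 ⊛ ((n ⊛ u) ⊛ (n ⊛ u)) ⊕ fifth ⊛ ((v ⊖ u) ⊛ (v ⊖ u) ⊕ v ⊛ u ⊖ u ⊛ u))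
    ≡⟨ cong₂ (λ y z → a ⊖ (fromℕ 5 ⊛ y ⊛ (n ⊛ n) ⊖ fromℕ 5 ⊛ ((n ⊛ u) ⊛ (n ⊛ u)) ⊕ fifth ⊛ (z ⊕ y ⊖ u ⊛ u))) vu≡1 square ⟩
  a ⊖ (fromℕ 5 ⊛ one ⊛ (n ⊛ n) ⊖ fromℕ 5 ⊛ ((n ⊛ u) ⊛ (n ⊛ u)) ⊕ fifth ⊛ (fromℕ 5 ⊛ (F ⊛ F) ⊕ one ⊖ u ⊛ u))
    ≡⟨ solve 4 (λ a n u F → a :- (con 5ℚ :* con 1ℚ :* (n :* n) :- con 5ℚ :* ((n :* u) :* (n :* u))
              :+ con (1ℚ ℚ.÷ qℕ 5) :* (con 5ℚ :* (F :* F) :+ con 1ℚ :- u :* u))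
         := (a :- (con 5ℚ :* (n :* n) :+ F :* F)) :+ con 5ℚ :* ((n :* u) :* (n :* u)) :- con (1ℚ ℚ.÷ qℕ 5) :* (con 1ℚ :- u :* u))
         refl a n u F ⟩
  (a ⊖ (fromℕ 5 ⊛ (n ⊛ n) ⊕ F ⊛ F)) ⊕ fromℕ 5 ⊛ ((n ⊛ u) ⊛ (n ⊛ u)) ⊖ fifth ⊛ (one ⊖ u ⊛ u) ∎
  where
    open ≡-Reasoning
    a = fromℕ 10 ⊛ x ⊛ F
    square : (v ⊖ u) ⊛ (v ⊖ u) ≡ fromℕ 5 ⊛ (F ⊛ F)
    square = begin
      (v ⊖ u) ⊛ (v ⊖ u)    ≡⟨ cong (λ z → z ⊛ z) (sym sF≡) ⟩
      (s ⊛ F) ⊛ (s ⊛ F)    ≡⟨ solve 2 (λ s F → (s :* F) :* (s :* F) := (s :* s) :* (F :* F)) refl s F ⟩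
      (s ⊛ s) ⊛ (F ⊛ F)    ≡⟨ cong (_⊛ (F ⊛ F)) ss≡5 ⟩
      fromℕ 5 ⊛ (F ⊛ F) ∎

Nonneg-1-square : ∀ {x} → Nonneg x → Nonneg (one ⊖ x) → Nonneg (one ⊖ x ⊛ x)
Nonneg-1-square {x} 0≤x x≤1 = subst Nonneg (lem x) (Nonneg-⊛ x≤1 (Nonneg-⊕ Nonneg-one 0≤x))
  where
    lem : ∀ x → (one ⊖ x) ⊛ (one ⊕ x) ≡ one ⊖ x ⊛ x
    lem = solve 1 (λ x → (con 1ℚ :- x) :* (con 1ℚ :+ x) := con 1ℚ :- x :* x) refl

-- Scaled by 10 F_{2k}, the bound 5 F_k is 50 F_k F_{2k}, where 50 = 37 + 13: the part 37 pays for
-- the error of the integer count, and 13 F_k F_{2k} ≥ 13 covers the terms 5 (n u)² ≤ 5 and (1 - u²)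
-- / 5.
deviation-bound : ∀ k n X → 1 ≤ k →
  10 * X * fib (double k) ≈[ 37 * (fib k * fib (double k)) ] 5 * (n * n) + fib (double k) * fib (double k) →
  Nonneg (one ⊖ fromℕ n ⊛ powℕ φ⁻¹ (double k)) →
  let y = deviation √5 (fromℕ n) (powℕ φ⁻¹ (double k)) (powℕ φ (double k)) (fromℕ X) in
  Nonneg (fromℕ 5 ⊛ fromℕ (fib k) ⊕ y) × Nonneg (fromℕ 5 ⊛ fromℕ (fib k) ⊖ y)
deviation-bound k n X 1≤k (hi , lo) nu≤1 =
    Nonneg-cancel (10 * F) _ 1≤10F (subst Nonneg (sym plus)
      (Nonneg-⊕ (Nonneg-⊕ (Nonneg-⊕ int-lo (Nonneg-⊛ (Nonneg-fromℕ 5) (Nonneg-⊛ 0≤nu 0≤nu))) 13c≥1)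
        (Nonneg-⊛ 0≤fifth (Nonneg-⊕ (Nonneg-fromℕ 4) (Nonneg-⊛ 0≤u 0≤u)))))
  , Nonneg-cancel (10 * F) _ 1≤10F (subst Nonneg (sym minus)
      (Nonneg-⊕ (Nonneg-⊕ (Nonneg-⊕ int-hi (Nonneg-⊛ (Nonneg-fromℕ 5) (Nonneg-1-square 0≤nu nu≤1))) 13c≥5)
        (Nonneg-⊛ 0≤fifth (Nonneg-1-square 0≤u (pow-φ⁻¹≤1 (double k))))))
  where
    f = fib k
    F = fib (double k)
    u = powℕ φ⁻¹ (double k)
    v = powℕ φ (double k)
    N = fromℕ n
    y = deviation √5 N u v (fromℕ X)
    c = fromℕ f ⊛ fromℕ F
    a₁ = fromℕ 10 ⊛ fromℕ X ⊛ fromℕ F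
    a₂ = fromℕ 5 ⊛ (N ⊛ N) ⊕ fromℕ F ⊛ fromℕ F
    q = (N ⊛ u) ⊛ (N ⊛ u)
    0≤u = Nonneg-pow Nonneg-φ⁻¹ (double k)
    0≤nu = Nonneg-⊛ (Nonneg-fromℕ n) 0≤u
    0≤fifth : Nonneg fifth
    0≤fifth = Nonneg-fromℚ (ℚₚ.≤ᵇ⇒≤ _)
    1≤f : 1 ≤ f
    1≤f = fib-mono 1≤k
    1≤F : 1 ≤ F
    1≤F = fib-mono (≤-trans 1≤k (subst (k ≤_) (sym (double≡+ k)) (m≤m+n k k)))
    1≤10F : 1 ≤ 10 * F
    1≤10F = *-mono-≤ {1} {10} (s≤s z≤n) 1≤F
    13≤13fF : 13 ≤ 13 * (f * F)
    13≤13fF = *-monoʳ-≤ 13 (*-mono-≤ 1≤f 1≤F)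
    c≡ : ∀ m → fromℕ (m * (f * F)) ≡ fromℕ m ⊛ c
    c≡ m = trans (fromℕ-* m (f * F)) (cong (fromℕ m ⊛_) (fromℕ-* f F))
    a₁≡ : fromℕ (10 * X * F) ≡ a₁
    a₁≡ = trans (fromℕ-* (10 * X) F) (cong (_⊛ fromℕ F) (fromℕ-* 10 X))
    a₂≡ : fromℕ (5 * (n * n) + F * F) ≡ a₂
    a₂≡ = trans (fromℕ-+ (5 * (n * n)) (F * F))
      (cong₂ _⊕_ (trans (fromℕ-* 5 (n * n)) (cong (fromℕ 5 ⊛_) (fromℕ-* n n))) (fromℕ-* F F))
    int-lo : Nonneg ((a₁ ⊕ fromℕ 37 ⊛ c) ⊖ a₂)
    int-lo = subst Nonneg (cong₂ _⊖_ (trans (fromℕ-+ (10 * X * F) (37 * (f * F))) (cong₂ _⊕_ a₁≡ (c≡ 37))) a₂≡) (fromℕ-mono-≤ lo)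
    int-hi : Nonneg ((a₂ ⊕ fromℕ 37 ⊛ c) ⊖ a₁)
    int-hi = subst Nonneg (cong₂ _⊖_ (trans (fromℕ-+ (5 * (n * n) + F * F) (37 * (f * F))) (cong₂ _⊕_ a₂≡ (c≡ 37))) a₁≡) (fromℕ-mono-≤ hi)
    13c≥1 : Nonneg (fromℕ 13 ⊛ c ⊖ one)
    13c≥1 = subst (λ z → Nonneg (z ⊖ one)) (c≡ 13) (fromℕ-mono-≤ (≤-trans (s≤s z≤n) 13≤13fF))
    13c≥5 : Nonneg (fromℕ 13 ⊛ c ⊖ fromℕ 5)
    13c≥5 = subst (λ z → Nonneg (z ⊖ fromℕ 5)) (c≡ 13) (fromℕ-mono-≤ (≤-trans (m≤m+n 5 8) 13≤13fF))
    open ≡-Reasoning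
    scaled : fromℕ 10 ⊛ fromℕ F ⊛ y ≡ (a₁ ⊖ a₂) ⊕ fromℕ 5 ⊛ q ⊖ fifth ⊛ (one ⊖ u ⊛ u)
    scaled = deviation-scaled √5 N u v (fromℕ X) (fromℕ F) (sym (proj₁ (binet-fib k))) (pow-φ-inverse (double k)) √5⊛√5≡5
    plus : fromℕ (10 * F) ⊛ (fromℕ 5 ⊛ fromℕ f ⊕ y)
      ≡ (((a₁ ⊕ fromℕ 37 ⊛ c) ⊖ a₂) ⊕ fromℕ 5 ⊛ q) ⊕ (fromℕ 13 ⊛ c ⊖ one) ⊕ fifth ⊛ (fromℕ 4 ⊕ u ⊛ u)
    plus = begin
      fromℕ (10 * F) ⊛ (fromℕ 5 ⊛ fromℕ f ⊕ y)
        ≡⟨ cong (_⊛ (fromℕ 5 ⊛ fromℕ f ⊕ y)) (fromℕ-* 10 F) ⟩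
      (fromℕ 10 ⊛ fromℕ F) ⊛ (fromℕ 5 ⊛ fromℕ f ⊕ y)
        ≡⟨ lem (fromℕ F) (fromℕ f) y ⟩
      fromℕ 50 ⊛ c ⊕ fromℕ 10 ⊛ fromℕ F ⊛ y
        ≡⟨ cong (fromℕ 50 ⊛ c ⊕_) scaled ⟩
      fromℕ 50 ⊛ c ⊕ ((a₁ ⊖ a₂) ⊕ fromℕ 5 ⊛ q ⊖ fifth ⊛ (one ⊖ u ⊛ u))
        ≡⟨ lem′ c a₁ a₂ q (u ⊛ u) ⟩
      (((a₁ ⊕ fromℕ 37 ⊛ c) ⊖ a₂) ⊕ fromℕ 5 ⊛ q) ⊕ (fromℕ 13 ⊛ c ⊖ one) ⊕ fifth ⊛ (fromℕ 4 ⊕ u ⊛ u) ∎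
      where
        lem : ∀ F f y → (fromℕ 10 ⊛ F) ⊛ (fromℕ 5 ⊛ f ⊕ y) ≡ fromℕ 50 ⊛ (f ⊛ F) ⊕ fromℕ 10 ⊛ F ⊛ y
        lem = solve 3 (λ F f y → (con (qℕ 10) :* F) :* (con 5ℚ :* f :+ y) := con (qℕ 50) :* (f :* F) :+ con (qℕ 10) :* F :* y) refl
        lem′ : ∀ c a b q w → fromℕ 50 ⊛ c ⊕ ((a ⊖ b) ⊕ fromℕ 5 ⊛ q ⊖ fifth ⊛ (one ⊖ w))
          ≡ (((a ⊕ fromℕ 37 ⊛ c) ⊖ b) ⊕ fromℕ 5 ⊛ q) ⊕ (fromℕ 13 ⊛ c ⊖ one) ⊕ fifth ⊛ (fromℕ 4 ⊕ w)
        lem′ = solve 5 (λ c a b q w → con (qℕ 50) :* c :+ ((a :- b) :+ con 5ℚ :* q :- con (1ℚ ℚ.÷ qℕ 5) :* (con 1ℚ :- w))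
          := (((a :+ con (qℕ 37) :* c) :- b) :+ con 5ℚ :* q) :+ (con (qℕ 13) :* c :- con 1ℚ) :+ con (1ℚ ℚ.÷ qℕ 5) :* (con (qℕ 4) :+ w)) refl
    minus : fromℕ (10 * F) ⊛ (fromℕ 5 ⊛ fromℕ f ⊖ y)
      ≡ (((a₂ ⊕ fromℕ 37 ⊛ c) ⊖ a₁) ⊕ fromℕ 5 ⊛ (one ⊖ q)) ⊕ (fromℕ 13 ⊛ c ⊖ fromℕ 5) ⊕ fifth ⊛ (one ⊖ u ⊛ u)
    minus = begin
      fromℕ (10 * F) ⊛ (fromℕ 5 ⊛ fromℕ f ⊖ y)
        ≡⟨ cong (_⊛ (fromℕ 5 ⊛ fromℕ f ⊖ y)) (fromℕ-* 10 F) ⟩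
      (fromℕ 10 ⊛ fromℕ F) ⊛ (fromℕ 5 ⊛ fromℕ f ⊖ y)
        ≡⟨ lem (fromℕ F) (fromℕ f) y ⟩
      fromℕ 50 ⊛ c ⊖ fromℕ 10 ⊛ fromℕ F ⊛ y
        ≡⟨ cong (fromℕ 50 ⊛ c ⊖_) scaled ⟩
      fromℕ 50 ⊛ c ⊖ ((a₁ ⊖ a₂) ⊕ fromℕ 5 ⊛ q ⊖ fifth ⊛ (one ⊖ u ⊛ u))
        ≡⟨ lem′ c a₁ a₂ q (u ⊛ u) ⟩
      (((a₂ ⊕ fromℕ 37 ⊛ c) ⊖ a₁) ⊕ fromℕ 5 ⊛ (one ⊖ q)) ⊕ (fromℕ 13 ⊛ c ⊖ fromℕ 5) ⊕ fifth ⊛ (one ⊖ u ⊛ u) ∎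
      where
        lem : ∀ F f y → (fromℕ 10 ⊛ F) ⊛ (fromℕ 5 ⊛ f ⊖ y) ≡ fromℕ 50 ⊛ (f ⊛ F) ⊖ fromℕ 10 ⊛ F ⊛ y
        lem = solve 3 (λ F f y → (con (qℕ 10) :* F) :* (con 5ℚ :* f :- y) := con (qℕ 50) :* (f :* F) :- con (qℕ 10) :* F :* y) refl
        lem′ : ∀ c a b q w → fromℕ 50 ⊛ c ⊖ ((a ⊖ b) ⊕ fromℕ 5 ⊛ q ⊖ fifth ⊛ (one ⊖ w))
          ≡ (((b ⊕ fromℕ 37 ⊛ c) ⊖ a) ⊕ fromℕ 5 ⊛ (one ⊖ q)) ⊕ (fromℕ 13 ⊛ c ⊖ fromℕ 5) ⊕ fifth ⊛ (one ⊖ w)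
        lem′ = solve 5 (λ c a b q w → con (qℕ 50) :* c :- ((a :- b) :+ con 5ℚ :* q :- con (1ℚ ℚ.÷ qℕ 5) :* (con 1ℚ :- w))
          := (((b :+ con (qℕ 37) :* c) :- a) :+ con 5ℚ :* (con 1ℚ :- q)) :+ (con (qℕ 13) :* c :- con 5ℚ) :+ con (1ℚ ℚ.÷ qℕ 5) :* (con 1ℚ :- w)) refl

-- For k ≥ 2, F_k ≤ 2 F_{k-1} gives 25 F_k² ≤ 50 n, and 64 = 8² is the least square above 50; this
-- is the origin of the final constant 8.
25fib²≤64n : ∀ k n → 1 ≤ n → fib (pred k) * fib k ≤ n → 25 * (fib k * fib k) ≤ 64 * n
25fib²≤64n 0 n 1≤n le = z≤n
25fib²≤64n 1 n 1≤n le = *-mono-≤ {25} {64} (m≤m+n 25 39) 1≤n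
25fib²≤64n (suc (suc j)) n 1≤n le = begin
  25 * (f * f)              ≤⟨ *-monoʳ-≤ 25 (*-monoˡ-≤ f (fib-suc≤2fib {suc j} (s≤s z≤n))) ⟩
  25 * (2 * fib (suc j) * f) ≡⟨ lem (fib (suc j)) f ⟩
  50 * (fib (suc j) * f)    ≤⟨ *-mono-≤ {50} {64} (m≤m+n 50 14) le ⟩
  64 * n ∎
  where
    f = fib (2 + j)
    open ≤-Reasoning
    lem : ∀ g f → 25 * (2 * g * f) ≡ 50 * (g * f)
    lem = solve-∀

record Bounded (x : Q5) (C n : ℕ) : Set where
  constructor bounded
  field
    isBoundedBy : BoundedBy x C n

open Bounded

-- Only the square of x is tied to y: for the complement of D the deviation changes its sign.
Bounded-scale : ∀ n y e x → 1 ≤ n → 25 * (e * e) ≤ 64 * n →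
  Nonneg (fromℕ 5 ⊛ fromℕ e ⊕ y) → Nonneg (fromℕ 5 ⊛ fromℕ e ⊖ y) →
  x ⊛ x ≡ (inv (fromℕ n) ⊛ y) ⊛ (inv (fromℕ n) ⊛ y) → Bounded x 8 n
Bounded-scale n y e x 1≤n le y≥ y≤ x²≡ = bounded (isNonNeg (subst Nonneg eq
  (Nonneg-⊛ (proj₂ (fromℕ-inv n 1≤n)) (Nonneg-⊕ (Nonneg-⊛ y≤ y≥) rest))))
  where
    N = fromℕ n
    i = inv N
    E = fromℕ e
    rest : Nonneg (fromℕ 64 ⊛ N ⊖ fromℕ 25 ⊛ (E ⊛ E))
    rest = subst Nonneg (cong₂ _⊖_ (fromℕ-* 64 n) (trans (fromℕ-* 25 (e * e)) (cong (fromℕ 25 ⊛_) (fromℕ-* e e))))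
      (fromℕ-mono-≤ le)
    open ≡-Reasoning
    eq : i ⊛ ((fromℕ 5 ⊛ E ⊖ y) ⊛ (fromℕ 5 ⊛ E ⊕ y) ⊕ (fromℕ 64 ⊛ N ⊖ fromℕ 25 ⊛ (E ⊛ E))) ≡ fromℕ 64 ⊖ (x ⊛ x) ⊛ N
    eq = begin
      i ⊛ ((fromℕ 5 ⊛ E ⊖ y) ⊛ (fromℕ 5 ⊛ E ⊕ y) ⊕ (fromℕ 64 ⊛ N ⊖ fromℕ 25 ⊛ (E ⊛ E)))
        ≡⟨ lem i N E y ⟩
      fromℕ 64 ⊛ (N ⊛ i) ⊖ one ⊛ (i ⊛ (y ⊛ y))
        ≡⟨ cong₂ (λ a b → fromℕ 64 ⊛ a ⊖ b ⊛ (i ⊛ (y ⊛ y))) N⊛i≡1 (sym N⊛i≡1) ⟩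
      fromℕ 64 ⊛ one ⊖ (N ⊛ i) ⊛ (i ⊛ (y ⊛ y))
        ≡⟨ lem′ i N y ⟩
      fromℕ 64 ⊖ ((i ⊛ y) ⊛ (i ⊛ y)) ⊛ N
        ≡⟨ cong (λ z → fromℕ 64 ⊖ z ⊛ N) (sym x²≡) ⟩
      fromℕ 64 ⊖ (x ⊛ x) ⊛ N ∎
      where
        N⊛i≡1 = proj₁ (fromℕ-inv n 1≤n)
        lem : ∀ i N E y → i ⊛ ((fromℕ 5 ⊛ E ⊖ y) ⊛ (fromℕ 5 ⊛ E ⊕ y) ⊕ (fromℕ 64 ⊛ N ⊖ fromℕ 25 ⊛ (E ⊛ E)))
          ≡ fromℕ 64 ⊛ (N ⊛ i) ⊖ one ⊛ (i ⊛ (y ⊛ y))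
        lem = solve 4 (λ i N E y → i :* ((con 5ℚ :* E :- y) :* (con 5ℚ :* E :+ y) :+ (con (qℕ 64) :* N :- con (qℕ 25) :* (E :* E)))
          := con (qℕ 64) :* (N :* i) :- con 1ℚ :* (i :* (y :* y))) refl
        lem′ : ∀ i N y → fromℕ 64 ⊛ one ⊖ (N ⊛ i) ⊛ (i ⊛ (y ⊛ y)) ≡ fromℕ 64 ⊖ ((i ⊛ y) ⊛ (i ⊛ y)) ⊛ N
        lem′ = solve 3 (λ i N y → con (qℕ 64) :* con 1ℚ :- (N :* i) :* (i :* (y :* y)) := con (qℕ 64) :- ((i :* y) :* (i :* y)) :* N) refl

-- The indices e ≡ r (mod 2) avoid e = k − 1, the only cell cut by both a ≤ F_{e+1} and a F_e + b F_{e+1} ≤ n.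
parityClass-Bounded : ∀ n k r c x → 1 ≤ n → r ≤ 1 → double c + r ≡ k →
  (∀ j → suc j ≡ k → Nonneg (fromℕ 5 ⊛ fromℕ n ⊖ powℕ φ (suc (double j)))) →
  Nonneg (powℕ φ (suc (double k)) ⊖ fromℕ 5 ⊛ fromℕ n) →
  let X = stepSum r (c + suc (n + k)) (λ e → cell e (λ x → hit x n))
      y = deviation √5 (fromℕ n) (powℕ φ⁻¹ (double k)) (powℕ φ (double k)) (fromℕ X) in
  x ⊛ x ≡ (inv (fromℕ n) ⊛ y) ⊛ (inv (fromℕ n) ⊛ y) → Bounded x 8 n
parityClass-Bounded n k r c x 1≤n r≤1 c≡k lower upper =
  Bounded-scale n (deviation √5 (fromℕ n) (powℕ φ⁻¹ (double k)) (powℕ φ (double k)) (fromℕ X)) (fib k) x 1≤n (25fib²≤64n k n 1≤n lo) (proj₁ bounds) (proj₂ bounds)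
  where
    X = stepSum r (c + suc (n + k)) (λ e → cell e (λ x → hit x n))
    hi : n ≤ fib k * fib (suc k)
    hi = 5n≤pow-φ⇒n≤fib*fib k n upper
    lower-fib : ∀ k → (∀ j → suc j ≡ k → Nonneg (fromℕ 5 ⊛ fromℕ n ⊖ powℕ φ (suc (double j)))) →
      fib (pred k) * fib k ≤ n
    lower-fib zero _ = z≤n
    lower-fib (suc j) low = pow-φ≤5n⇒fib*fib≤n j n (low j refl)
    lo : fib (pred k) * fib k ≤ n
    lo = lower-fib k lower
    positive : ∀ k → n ≤ fib k * fib (suc k) → 1 ≤ k
    positive zero n≤0 = ≤-trans 1≤n n≤0
    positive (suc k) _ = s≤s z≤n
    1≤k : 1 ≤ k
    1≤k = positive k hi
    -- The number n + k + 1 of triangle cells serves two ends: its double exceeds k, as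
    -- `triangleCells-≈` requires, and it exceeds n, so that every m ≤ n has its cell in the range.
    k<2d : k < double (suc (n + k))
    k<2d = ≤-trans (s≤s (m≤n+m k n)) (i≤double (suc (n + k)))
    bounds = deviation-bound k n X 1≤k
      (stepSum-cell-≈ c (suc (n + k)) r k n r≤1 c≡k 1≤k k<2d lo hi)
      (n⊛pow-φ⁻¹≤1 (double k) n upper)

inverse-c : ∀ s n i u v → s ⊛ s ≡ fromℕ 5 → n ⊛ i ≡ one → v ⊛ u ≡ one →
  (s ⊛ n) ⊛ u ⊛ (fifth ⊛ s ⊛ i ⊛ v) ≡ one
inverse-c s n i u v ss≡5 ni≡1 vu≡1 = begin
  (s ⊛ n) ⊛ u ⊛ (fifth ⊛ s ⊛ i ⊛ v)
    ≡⟨ solve 5 (λ s n i u v → (s :* n) :* u :* (con (1ℚ ℚ.÷ qℕ 5) :* s :* i :* v)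
         := con (1ℚ ℚ.÷ qℕ 5) :* (s :* s) :* (n :* i) :* (v :* u)) refl s n i u v ⟩
  fifth ⊛ (s ⊛ s) ⊛ (n ⊛ i) ⊛ (v ⊛ u)
    ≡⟨ cong₂ _⊛_ (cong₂ (λ a b → fifth ⊛ a ⊛ b) ss≡5 ni≡1) vu≡1 ⟩
  fifth ⊛ fromℕ 5 ⊛ one ⊛ one
    ≡⟨ refl ⟩
  one ∎
  where open ≡-Reasoning

direct-deviation : ∀ s n i u v x → n ⊛ i ≡ one →
  x ⊛ i ⊖ (half ⊛ ((s ⊛ n) ⊛ u) ⊕ tenth ⊛ (fifth ⊛ s ⊛ i ⊛ v)) ≡ i ⊛ deviation s n u v x
direct-deviation s n i u v x ni≡1 = begin
  x ⊛ i ⊖ (half ⊛ ((s ⊛ n) ⊛ u) ⊕ tenth ⊛ (fifth ⊛ s ⊛ i ⊛ v))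
    ≡⟨ solve 6 (λ s n i u v x → x :* i :- (con (1ℚ ℚ.÷ qℕ 2) :* ((s :* n) :* u) :+ con (1ℚ ℚ.÷ qℕ 10) :* (con (1ℚ ℚ.÷ qℕ 5) :* s :* i :* v))
         := x :* i :- (con 1ℚ :* (con (1ℚ ℚ.÷ qℕ 2) :* ((s :* n) :* u)) :+ con (1ℚ ℚ.÷ qℕ 50) :* (s :* i :* v))) refl s n i u v x ⟩
  x ⊛ i ⊖ (one ⊛ (half ⊛ ((s ⊛ n) ⊛ u)) ⊕ fiftieth ⊛ (s ⊛ i ⊛ v))
    ≡⟨ cong (λ z → x ⊛ i ⊖ (z ⊛ (half ⊛ ((s ⊛ n) ⊛ u)) ⊕ fiftieth ⊛ (s ⊛ i ⊛ v))) (sym ni≡1) ⟩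
  x ⊛ i ⊖ ((n ⊛ i) ⊛ (half ⊛ ((s ⊛ n) ⊛ u)) ⊕ fiftieth ⊛ (s ⊛ i ⊛ v))
    ≡⟨ solve 6 (λ s n i u v x → x :* i :- ((n :* i) :* (con (1ℚ ℚ.÷ qℕ 2) :* ((s :* n) :* u)) :+ con (1ℚ ℚ.÷ qℕ 50) :* (s :* i :* v))
         := i :* (x :- (con (1ℚ ℚ.÷ qℕ 2) :* s :* (n :* n) :* u :+ con (1ℚ ℚ.÷ qℕ 50) :* s :* v))) refl s n i u v x ⟩
  i ⊛ deviation s n u v x ∎
  where open ≡-Reasoning

complement-deviation : ∀ n i x x′ a b → n ⊛ i ≡ one → x ⊕ x′ ≡ n →
  x′ ⊛ i ⊖ (one ⊖ a ⊖ b) ≡ ⊝ (x ⊛ i ⊖ (a ⊕ b))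
complement-deviation n i x x′ a b ni≡1 x+x′≡n = begin
  x′ ⊛ i ⊖ (one ⊖ a ⊖ b)
    ≡⟨ cong (λ z → x′ ⊛ i ⊖ (z ⊖ a ⊖ b)) (trans (sym ni≡1) (cong (_⊛ i) (sym x+x′≡n))) ⟩
  x′ ⊛ i ⊖ ((x ⊕ x′) ⊛ i ⊖ a ⊖ b)
    ≡⟨ solve 5 (λ i x x′ a b → x′ :* i :- ((x :+ x′) :* i :- a :- b) := :- (x :* i :- (a :+ b))) refl i x x′ a b ⟩
  ⊝ (x ⊛ i ⊖ (a ⊕ b)) ∎
  where open ≡-Reasoning

⊝-square : ∀ x → (⊝ x) ⊛ (⊝ x) ≡ x ⊛ x
⊝-square = solve 1 (λ x → :- x :* :- x := x :* x) refl

-- The density for each residue of the exponent modulo 4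

module _ (n : ℕ) (1≤n : 1 ≤ n) (S : Subset n) (rep : RepresentsD n S) where

  private
    N = fromℕ n
    i = inv N
    N⊛i≡1 = proj₁ (fromℕ-inv n 1≤n)

  odd-count : ∀ k c → ∣ S ∣ ≡ stepSum 1 (c + suc (n + k)) (λ e → cell e (λ x → hit x n))
  odd-count k c = ∣D∣≡stepSum-1 n _ S rep (≤-trans (s≤s (m≤m+n n k)) (m≤n+m _ c))

  even-count : ∀ k c →
    fromℕ (stepSum 0 (c + suc (n + k)) (λ e → cell e (λ x → hit x n))) ⊕ fromℕ ∣ S ∣ ≡ N
  even-count k c = trans (sym (fromℕ-+ X ∣ S ∣)) (cong fromℕ (trans (cong (X +_) (∣D∣≡stepSum-1 n M S rep n<M))
    (stepSum-0+stepSum-1 n M n<M)))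
    where
      M = c + suc (n + k)
      X = stepSum 0 M (λ e → cell e (λ x → hit x n))
      n<M : n < M
      n<M = ≤-trans (s≤s (m≤m+n n k)) (m≤n+m _ c)

  odd-Bounded : ∀ k c → double c + 1 ≡ k →
    (∀ j → suc j ≡ k → Nonneg (fromℕ 5 ⊛ N ⊖ powℕ φ (suc (double j)))) →
    Nonneg (powℕ φ (suc (double k)) ⊖ fromℕ 5 ⊛ N) →
    Bounded (fromℕ ∣ S ∣ ⊛ i ⊖ (half ⊛ ((√5 ⊛ N) ⊛ powℕ φ⁻¹ (double k)) ⊕ tenth ⊛ (fifth ⊛ √5 ⊛ i ⊛ powℕ φ (double k)))) 8 n
  odd-Bounded k c c≡k lower upper = parityClass-Bounded n k 1 c (fromℕ ∣ S ∣ ⊛ i ⊖ (half ⊛ ((√5 ⊛ N) ⊛ u) ⊕ tenth ⊛ (fifth ⊛ √5 ⊛ i ⊛ v))) 1≤n ≤-refl c≡k lower upper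
    (cong (λ z → z ⊛ z) (trans
      (cong (λ m → fromℕ m ⊛ i ⊖ (half ⊛ ((√5 ⊛ N) ⊛ u) ⊕ tenth ⊛ (fifth ⊛ √5 ⊛ i ⊛ v))) (odd-count k c))
      (direct-deviation √5 N i u v (fromℕ X) N⊛i≡1)))
    where
      u = powℕ φ⁻¹ (double k)
      v = powℕ φ (double k)
      X = stepSum 1 (c + suc (n + k)) (λ e → cell e (λ x → hit x n))

  even-Bounded : ∀ k c → double c + 0 ≡ k →
    (∀ j → suc j ≡ k → Nonneg (fromℕ 5 ⊛ N ⊖ powℕ φ (suc (double j)))) →
    Nonneg (powℕ φ (suc (double k)) ⊖ fromℕ 5 ⊛ N) →
    Bounded (fromℕ ∣ S ∣ ⊛ i ⊖ (one ⊖ half ⊛ ((√5 ⊛ N) ⊛ powℕ φ⁻¹ (double k)) ⊖ tenth ⊛ (fifth ⊛ √5 ⊛ i ⊛ powℕ φ (double k)))) 8 n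
  even-Bounded k c c≡k lower upper = parityClass-Bounded n k 0 c (fromℕ ∣ S ∣ ⊛ i ⊖ (one ⊖ half ⊛ ((√5 ⊛ N) ⊛ u) ⊖ tenth ⊛ (fifth ⊛ √5 ⊛ i ⊛ v))) 1≤n z≤n c≡k lower upper
    (trans (cong (λ z → z ⊛ z) (trans
      (complement-deviation N i X (fromℕ ∣ S ∣) (half ⊛ ((√5 ⊛ N) ⊛ u)) (tenth ⊛ (fifth ⊛ √5 ⊛ i ⊛ v)) N⊛i≡1 (even-count k c))
      (cong ⊝_ (direct-deviation √5 N i u v X N⊛i≡1))))
      (⊝-square (i ⊛ deviation √5 N u v X)))
    where
      u = powℕ φ⁻¹ (double k)
      v = powℕ φ (double k)
      X = fromℕ (stepSum 0 (c + suc (n + k)) (λ e → cell e (λ x → hit x n)))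

  private
    c′ : ∀ p → Q5
    c′ p = (√5 ⊛ N) ⊛ powℕ φ⁻¹ p
    inv-c : ∀ p → inv (c′ p) ≡ fifth ⊛ √5 ⊛ i ⊛ powℕ φ p
    inv-c p = inv-unique (c′ p) (fifth ⊛ √5 ⊛ i ⊛ powℕ φ p)
      (inverse-c √5 N i (powℕ φ⁻¹ p) (powℕ φ p) √5⊛√5≡5 N⊛i≡1 (pow-φ-inverse p))

  -- The two hypotheses, φ^p ≤ 5 n ≤ φ^(p+1), are the range of c with denominators cleared. The
  -- residue r is a separate argument so that `mainTerm` reduces before `p % 4` is evaluated.
  Density : ℕ → ℕ → Set
  Density p r = Nonneg (fromℕ 5 ⊛ N ⊖ powℕ φ p) → Nonneg (powℕ φ (suc p) ⊖ fromℕ 5 ⊛ N) →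
    Bounded (fromℕ ∣ S ∣ ⊛ i ⊖ mainTerm r (c′ p)) 8 n

  lower-pred : ∀ k → Nonneg (fromℕ 5 ⊛ N ⊖ powℕ φ (double k)) →
    ∀ j → suc j ≡ k → Nonneg (fromℕ 5 ⊛ N ⊖ powℕ φ (suc (double j)))
  lower-pred .(suc j) low j refl = subst Nonneg (lem (fromℕ 5 ⊛ N) (powℕ φ (2 + double j)) (powℕ φ (suc (double j))))
    (Nonneg-⊕ low (pow-φ-mono (suc (double j))))
    where
      lem : ∀ a b c → (a ⊖ b) ⊕ (b ⊖ c) ≡ a ⊖ c
      lem = solve 3 (λ a b c → (a :- b) :+ (b :- c) := a :- c) refl

  upper-suc : ∀ p → Nonneg (powℕ φ (suc p) ⊖ fromℕ 5 ⊛ N) → Nonneg (powℕ φ (2 + p) ⊖ fromℕ 5 ⊛ N)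
  upper-suc p up = subst Nonneg (lem (fromℕ 5 ⊛ N) (powℕ φ (suc p)) (powℕ φ (2 + p)))
    (Nonneg-⊕ up (pow-φ-mono (suc p)))
    where
      lem : ∀ a b c → (b ⊖ a) ⊕ (c ⊖ b) ≡ c ⊖ a
      lem = solve 3 (λ a b c → (b :- a) :+ (c :- b) := c :- a) refl

  density-0 : ∀ q → Density (double (double q)) 0
  density-0 q low up = subst (λ z → Bounded (fromℕ ∣ S ∣ ⊛ i ⊖ z) 8 n) (sym main)
    (even-Bounded (double q) q (+-identityʳ (double q)) (lower-pred (double q) low) up)
    where
      p = double (double q)
      main : mainTerm 0 (c′ p) ≡ one ⊖ half ⊛ c′ p ⊖ tenth ⊛ (fifth ⊛ √5 ⊛ i ⊛ powℕ φ p)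
      main = cong (λ z → one ⊖ half ⊛ c′ p ⊖ tenth ⊛ z) (inv-c p)

  density-2 : ∀ q → Density (double (suc (double q))) 2
  density-2 q low up = subst (λ z → Bounded (fromℕ ∣ S ∣ ⊛ i ⊖ z) 8 n) (sym main)
    (odd-Bounded (suc (double q)) q (double+1 q) (lower-pred (suc (double q)) low) up)
    where
      p = double (suc (double q))
      main : mainTerm 2 (c′ p) ≡ half ⊛ c′ p ⊕ tenth ⊛ (fifth ⊛ √5 ⊛ i ⊛ powℕ φ p)
      main = cong (λ z → half ⊛ c′ p ⊕ tenth ⊛ z) (inv-c p)

  private
    -- c / φ at the exponent p is c at p + 1; this reduces odd p to the even exponent 2k = p + 1.
    shift-c : ∀ p → (half ⊘ φ) ⊛ c′ p ≡ half ⊛ c′ (suc p)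
    shift-c p = trans (cong (λ z → (half ⊛ z) ⊛ c′ p) (inv-unique φ φ⁻¹ φ⊛φ⁻¹≡1)) (lem half φ⁻¹ (√5 ⊛ N) (powℕ φ⁻¹ p))
      where
        lem : ∀ h q a u → (h ⊛ q) ⊛ (a ⊛ u) ≡ h ⊛ (a ⊛ (q ⊛ u))
        lem = solve 4 (λ h q a u → (h :* q) :* (a :* u) := h :* (a :* (q :* u))) refl
    shift-inv-c : ∀ p → (φ ⊛ tenth) ⊘ c′ p ≡ tenth ⊛ (fifth ⊛ √5 ⊛ i ⊛ powℕ φ (suc p))
    shift-inv-c p = trans (cong ((φ ⊛ tenth) ⊛_) (inv-c p)) (lem φ tenth (fifth ⊛ √5 ⊛ i) (powℕ φ p))
      where
        lem : ∀ x t a v → (x ⊛ t) ⊛ (a ⊛ v) ≡ t ⊛ (a ⊛ (x ⊛ v))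
        lem = solve 4 (λ x t a v → (x :* t) :* (a :* v) := t :* (a :* (x :* v))) refl

  density-1 : ∀ q → Density (suc (double (double q))) 1
  density-1 q low up = subst (λ z → Bounded (fromℕ ∣ S ∣ ⊛ i ⊖ z) 8 n) (sym main)
    -- Since p = 2k - 1 here, the lower bound is the hypothesis itself and the upper one is weakened
    -- by one power of φ. For p = 2k it is the other way round.
    (odd-Bounded (suc (double q)) q (double+1 q) (λ { _ refl → low }) (upper-suc p up))
    where
      p = suc (double (double q))
      main : mainTerm 1 (c′ p) ≡ half ⊛ c′ (suc p) ⊕ tenth ⊛ (fifth ⊛ √5 ⊛ i ⊛ powℕ φ (suc p))
      main = cong₂ _⊕_ (shift-c p) (shift-inv-c p)

  density-3 : ∀ q → Density (suc (double (suc (double q)))) 3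
  density-3 q low up = subst (λ z → Bounded (fromℕ ∣ S ∣ ⊛ i ⊖ z) 8 n) (sym main)
    (even-Bounded (double (suc q)) (suc q) (+-identityʳ (double (suc q))) (λ { _ refl → low }) (upper-suc p up))
    where
      p = suc (double (suc (double q)))
      main : mainTerm 3 (c′ p) ≡ one ⊖ half ⊛ c′ (suc p) ⊖ tenth ⊛ (fifth ⊛ √5 ⊛ i ⊛ powℕ φ (suc p))
      main = cong₂ (λ a b → one ⊖ a ⊖ b) (shift-c p) (shift-inv-c p)

  density : ∀ p → Density p (p % 4)
  density = Parity-elim (λ p → Density p (p % 4))
    (Parity-elim (λ p → Density (double p) (double p % 4))
      (λ q → subst (Density (double (double q))) (sym (residue 0 q)) (density-0 q))
      (λ q → subst (Density (double (suc (double q)))) (sym (residue 2 q)) (density-2 q)))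
    (Parity-elim (λ p → Density (suc (double p)) (suc (double p) % 4))
      (λ q → subst (Density (suc (double (double q)))) (sym (residue 1 q)) (density-1 q))
      (λ q → subst (Density (suc (double (suc (double q))))) (sym (residue 3 q)) (density-3 q)))
    where
      double² : ∀ q → double (double q) ≡ q * 4
      double² zero = refl
      double² (suc q) = cong (4 +_) (double² q)
      residue : ∀ r q → (r + double (double q)) % 4 ≡ r % 4
      residue r q = trans (cong (λ z → (r + z) % 4) (double² q)) ([m+kn]%n≡m%n r q 4)

-- Clearing denominators in the range of c

√5⊛inv-√5 : √5 ⊛ inv √5 ≡ one
√5⊛inv-√5 = refl

clear-lower : ∀ s t n u v → s ⊛ s ≡ fromℕ 5 → s ⊛ t ≡ one → v ⊛ u ≡ one →
  (s ⊛ v) ⊛ ((s ⊛ n) ⊛ u ⊖ fromℕ 1 ⊛ t) ≡ fromℕ 5 ⊛ n ⊖ v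
clear-lower s t n u v ss≡5 st≡1 vu≡1 = begin
  (s ⊛ v) ⊛ ((s ⊛ n) ⊛ u ⊖ fromℕ 1 ⊛ t)
    ≡⟨ solve 5 (λ s t n u v → (s :* v) :* ((s :* n) :* u :- con 1ℚ :* t) := (s :* s) :* n :* (v :* u) :- (s :* t) :* v) refl s t n u v ⟩
  (s ⊛ s) ⊛ n ⊛ (v ⊛ u) ⊖ (s ⊛ t) ⊛ v
    ≡⟨ cong₂ _⊖_ (cong₂ (λ a b → a ⊛ n ⊛ b) ss≡5 vu≡1) (cong (_⊛ v) st≡1) ⟩
  fromℕ 5 ⊛ n ⊛ one ⊖ one ⊛ v
    ≡⟨ solve 2 (λ n v → con 5ℚ :* n :* con 1ℚ :- con 1ℚ :* v := con 5ℚ :* n :- v) refl n v ⟩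
  fromℕ 5 ⊛ n ⊖ v ∎
  where open ≡-Reasoning

clear-upper : ∀ s t n u v x → s ⊛ s ≡ fromℕ 5 → s ⊛ t ≡ one → v ⊛ u ≡ one →
  (s ⊛ v) ⊛ (x ⊛ t ⊖ (s ⊛ n) ⊛ u) ≡ x ⊛ v ⊖ fromℕ 5 ⊛ n
clear-upper s t n u v x ss≡5 st≡1 vu≡1 = begin
  (s ⊛ v) ⊛ (x ⊛ t ⊖ (s ⊛ n) ⊛ u)
    ≡⟨ solve 6 (λ s t n u v x → (s :* v) :* (x :* t :- (s :* n) :* u) := (s :* t) :* (x :* v) :- (s :* s) :* n :* (v :* u)) refl s t n u v x ⟩
  (s ⊛ t) ⊛ (x ⊛ v) ⊖ (s ⊛ s) ⊛ n ⊛ (v ⊛ u)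
    ≡⟨ cong₂ _⊖_ (cong (_⊛ (x ⊛ v)) st≡1) (cong₂ (λ a b → a ⊛ n ⊛ b) ss≡5 vu≡1) ⟩
  one ⊛ (x ⊛ v) ⊖ fromℕ 5 ⊛ n ⊛ one
    ≡⟨ solve 3 (λ n v x → con 1ℚ :* (x :* v) :- con 5ℚ :* n :* con 1ℚ := x :* v :- con 5ℚ :* n) refl n v x ⟩
  x ⊛ v ⊖ fromℕ 5 ⊛ n ∎
  where open ≡-Reasoning

Nonneg-√5 : Nonneg √5
Nonneg-√5 = nonneg (inj₁ (ℚₚ.≤-refl , ℚₚ.≤ᵇ⇒≤ _))

module _ (n : ℕ) (u v : Q5) (vu≡1 : v ⊛ u ≡ one) (0≤v : Nonneg v) where

  private
    inv-v : inv v ≡ u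
    inv-v = inv-unique v u vu≡1

  5n≥ : Nonneg ((√5 ⊛ fromℕ n) ⊘ v ⊖ fromℕ 1 ⊘ √5) → Nonneg (fromℕ 5 ⊛ fromℕ n ⊖ v)
  5n≥ low = subst Nonneg (clear-lower √5 (inv √5) (fromℕ n) u v √5⊛√5≡5 √5⊛inv-√5 vu≡1)
    (Nonneg-⊛ (Nonneg-⊛ Nonneg-√5 0≤v) (subst (λ z → Nonneg ((√5 ⊛ fromℕ n) ⊛ z ⊖ fromℕ 1 ⊛ inv √5)) inv-v low))

  5n≤ : Nonneg (φ ⊘ √5 ⊖ (√5 ⊛ fromℕ n) ⊘ v) → Nonneg (φ ⊛ v ⊖ fromℕ 5 ⊛ fromℕ n)
  5n≤ up = subst Nonneg (clear-upper √5 (inv √5) (fromℕ n) u v φ √5⊛√5≡5 √5⊛inv-√5 vu≡1)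
    (Nonneg-⊛ (Nonneg-⊛ Nonneg-√5 0≤v) (subst (λ z → Nonneg (φ ⊛ inv √5 ⊖ (√5 ⊛ fromℕ n) ⊛ z)) inv-v up))

-- A nonpositive power of φ is at most 1, but 5 n ≥ 5. Applied to φ^(p+1) ≥ 5 n this excludes p < 0.
negative-exponent-impossible : ∀ n k → 1 ≤ n → ¬ Nonneg (powℕ φ⁻¹ k ⊖ fromℕ 5 ⊛ fromℕ n)
negative-exponent-impossible n k 1≤n le = contradiction
  (≤-trans (*-monoʳ-≤ 5 1≤n) (fromℕ-cancel-≤ {5 * n} {1} (subst Nonneg
    (trans (lem (powℕ φ⁻¹ k) (fromℕ 5 ⊛ fromℕ n)) (cong (one ⊖_) (sym (fromℕ-* 5 n))))
    (Nonneg-⊕ (pow-φ⁻¹≤1 k) le))))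
  (λ { (s≤s ()) })
  where
    lem : ∀ u a → (one ⊖ u) ⊕ (u ⊖ a) ≡ one ⊖ a
    lem = solve 2 (λ u a → (con 1ℚ :- u) :+ (u :- a) := con 1ℚ :- a) refl

φ⊛pow-φ⁻¹ : ∀ k → φ ⊛ powℕ φ⁻¹ (suc k) ≡ powℕ φ⁻¹ k
φ⊛pow-φ⁻¹ k = ⊛-cancel φ φ⁻¹ (powℕ φ⁻¹ k) refl

pow-φ⁻¹-inverse : ∀ k → powℕ φ⁻¹ k ⊛ powℕ φ k ≡ one
pow-φ⁻¹-inverse k = trans (comm (powℕ φ⁻¹ k) (powℕ φ k)) (pow-φ-inverse k)
  where
    comm : ∀ x y → x ⊛ y ≡ y ⊛ x
    comm = solve 2 (λ x y → x :* y := y :* x) refl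

theorem3 : Σ ℕ λ C → ∀ (n : ℕ) → 1 ≤ n → ∀ (p : ℤ) →
    (fromℕ 1 ⊘ √5 ≤₅ (√5 ⊛ fromℕ n) ⊘ φ^ p) →
    ((√5 ⊛ fromℕ n) ⊘ φ^ p <₅ φ ⊘ √5) →
    ∀ (S : Subset n) → RepresentsD n S →
    BoundedBy (fromℕ ∣ S ∣ ⊘ fromℕ n ⊖ mainTerm (p %ℕ 4) ((√5 ⊛ fromℕ n) ⊘ φ^ p)) C n
theorem3 = 8 , λ
  { n 1≤n (ℤ.+ p) low (up , _) S rep →
      let 0≤v = Nonneg-pow Nonneg-φ p in
      isBoundedBy (subst
        (λ z → Bounded (fromℕ ∣ S ∣ ⊘ fromℕ n ⊖ mainTerm (p % 4) ((√5 ⊛ fromℕ n) ⊛ z)) 8 n)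
        (sym (inv-unique (powℕ φ p) (powℕ φ⁻¹ p) (pow-φ-inverse p)))
        (density n 1≤n S rep p
          (5n≥ n (powℕ φ⁻¹ p) (powℕ φ p) (pow-φ-inverse p) 0≤v (nonneg low))
          (5n≤ n (powℕ φ⁻¹ p) (powℕ φ p) (pow-φ-inverse p) 0≤v (nonneg up))))
  ; n 1≤n ℤ.-[1+ k ] low (up , _) S rep → contradiction
      (subst (λ z → Nonneg (z ⊖ fromℕ 5 ⊛ fromℕ n)) (φ⊛pow-φ⁻¹ k)
        (5n≤ n (powℕ φ (suc k)) (powℕ φ⁻¹ (suc k)) (pow-φ⁻¹-inverse (suc k)) (Nonneg-pow Nonneg-φ⁻¹ (suc k)) (nonneg up)))
      (negative-exponent-impossible n k 1≤n)
  }
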